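{- Let $q=1-p=o\!\left(\frac1n\right)$ and $qn^{1.5}\to\infty$ as $n\to\infty$. Then for all sufficiently large $n\in\mathbb{N}$ we have $u_2(n,p)=u_2'(n,p)=4$.
   Context: $G(n,p)$ is the Erdős–Rényi random graph on $n$ labelled vertices (vertex set $V$), each edge present independently with probability $p=p(n)$; $\mathbb{P}_{n,p}$ is the corresponding probability and $q=1-p$. A diameter graph in $\mathbb{R}^d$ is a graph $(V,E)$ with $V\subset\mathbb{R}^d$ finite and $E=\{\{\mathbf{x},\mathbf{y}\}\subseteq V: |\mathbf{x}-\mathbf{y}|=\operatorname{diam}V\}$, where $\operatorname{diam}V=\max_{\mathbf{x},\mathbf{y}\in V}|\mathbf{x}-\mathbf{y}|$ (Euclidean norm); a graph is a diameter graph in $\mathbb{R}^d$ if it is isomorphic to one. $u_d(n,p)$ is the largest positive integer $k$ such that $\mathbb{P}_{n,p}\big(\exists W\subseteq V,\ |W|=k,\ G[W]$ is a diameter graph in $\mathbb{R}^d$ and $\chi(G[W])=d+1\big)>\frac12$, where $G[W]$ is the induced subgraph; if no such $k$ exists, $u_d(n,p)=0$. $u_d'(n,p)$ is defined identically with the additional requirement that $G[W]$ be connected. -}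

module Defs where

open import Data.Bool using (Bool; true; false; T; if_then_else_)
open import Data.Empty using (⊥)
open import Data.Fin using (Fin; zero; suc)
open import Data.Fin.Subset as Subset using (Subset; _∈_)
open import Data.Integer as ℤ using (+_)
import Data.Integer.Properties as ℤP
open import Data.List as List using (List; []; _∷_; map; filterᵇ; cartesianProductWith)
open import Data.Nat as ℕ using (ℕ; zero; suc)
import Data.Nat.Properties as ℕP
open import Data.Product using (Σ-syntax; ∃; _×_; _,_; proj₁; proj₂)
open import Data.Rational as ℚ using (ℚ; 0ℚ; 1ℚ; ½)
import Data.Rational.Properties as ℚP
open import Data.Rational.Solver using (module +-*-Solver)
import Data.Rational.Unnormalised as ℚᵘ
import Data.Rational.Unnormalised.Properties as ℚᵘP
open import Data.Sum using (_⊎_; inj₁; inj₂)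
open import Data.Vec as Vec using ([]; _∷_)
open import Data.Vec.Functional as Vector using (Vector)
open import Function.Bundles using (_↔_; _⇔_; Inverse)
open import Relation.Binary.Construct.Closure.ReflexiveTransitive using (Star)
open import Relation.Binary.PropositionalEquality
  using (_≡_; _≢_; refl; sym; trans; cong; cong₂; subst; subst₂)
open import Relation.Nullary using (¬_)

Eventually : (ℕ → Set) → Set
Eventually P = Σ[ N ∈ ℕ ] (∀ n → N ℕ.≤ n → P n)

module ℚ-Lemmas where
  open import Data.Rational
  open ℚP
  open +-*-Solver

  nn : ∀ {p} → 0ℚ ≤ p → NonNegative p
  nn = nonNegative

  p≤∣p∣ : ∀ p → p ≤ ∣ p ∣
  p≤∣p∣ p with ≤-total 0ℚ p
  ... | inj₁ 0≤p = ≤-reflexive (sym (0≤p⇒∣p∣≡p 0≤p))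
  ... | inj₂ p≤0 = ≤-trans p≤0 (0≤∣p∣ p)

  ∣p-q∣≡∣q-p∣ : ∀ p q → ∣ p - q ∣ ≡ ∣ q - p ∣
  ∣p-q∣≡∣q-p∣ p q =
    trans (cong ∣_∣ (solve 2 (λ p q → p :- q := :- (q :- p)) refl p q)) (∣-p∣≡∣p∣ (q - p))

  ∣p-q∣≤e⇒p≤q+e : ∀ {p q e} → ∣ p - q ∣ ≤ e → p ≤ q + e
  ∣p-q∣≤e⇒p≤q+e {p} {q} {e} h = begin
    p            ≡⟨ solve 2 (λ p q → p := q :+ (p :- q)) refl p q ⟩
    q + (p - q)  ≤⟨ +-monoʳ-≤ q (≤-trans (p≤∣p∣ (p - q)) h) ⟩
    q + e        ∎
    where open ≤-Reasoning

  p≤q+e⇒p-q≤e : ∀ {p q e} → p ≤ q + e → p - q ≤ e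
  p≤q+e⇒p-q≤e {p} {q} {e} h = begin
    p - q        ≤⟨ +-monoˡ-≤ (- q) h ⟩
    q + e - q    ≡⟨ solve 2 (λ q e → q :+ e :- q := e) refl q e ⟩
    e            ∎
    where open ≤-Reasoning

  p≤q+e∧q≤p+e⇒∣p-q∣≤e : ∀ {p q e} → p ≤ q + e → q ≤ p + e → ∣ p - q ∣ ≤ e
  p≤q+e∧q≤p+e⇒∣p-q∣≤e {p} {q} {e} h₁ h₂ with ∣p∣≡p∨∣p∣≡-p (p - q)
  ... | inj₁ eq = subst (_≤ e) (sym eq) (p≤q+e⇒p-q≤e h₁)
  ... | inj₂ eq = subst (_≤ e)
    (sym (trans eq (solve 2 (λ p q → :- (p :- q) := q :- p) refl p q))) (p≤q+e⇒p-q≤e h₂)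

  ½*-pos : ∀ {e} → 0ℚ < e → 0ℚ < ½ * e
  ½*-pos {e} 0<e = subst (_< ½ * e) (*-zeroʳ ½) (*-monoʳ-<-pos ½ 0<e)

  ½e+½e≡e : ∀ e → ½ * e + ½ * e ≡ e
  ½e+½e≡e e = trans (sym (*-distribʳ-+ e ½ ½)) (*-identityˡ e)

  *-mono-≤-nonNeg : ∀ {p q r s} → 0ℚ ≤ p → 0ℚ ≤ s → p ≤ q → r ≤ s → p * r ≤ q * s
  *-mono-≤-nonNeg {p} {q} {r} {s} 0≤p 0≤s p≤q r≤s =
    ≤-trans (*-monoˡ-≤-nonNeg p {{nn 0≤p}} r≤s) (*-monoʳ-≤-nonNeg s {{nn 0≤s}} p≤q)

  0≤p*q : ∀ {p q} → 0ℚ ≤ p → 0ℚ ≤ q → 0ℚ ≤ p * q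
  0≤p*q {p} {q} 0≤p 0≤q = subst (_≤ p * q) (*-zeroʳ p) (*-monoˡ-≤-nonNeg p {{nn 0≤p}} 0≤q)

  0<p*q : ∀ {p q} → 0ℚ < p → 0ℚ < q → 0ℚ < p * q
  0<p*q {p} {q} 0<p 0<q =
    subst (_< p * q) (*-zeroʳ p) (*-monoʳ-<-pos p {{positive 0<p}} 0<q)

  p≤p+q : ∀ {p q} → 0ℚ ≤ q → p ≤ p + q
  p≤p+q {p} {q} 0≤q = subst (_≤ p + q) (+-identityʳ p) (+-monoʳ-≤ p 0≤q)

  0≤p+q : ∀ {p q} → 0ℚ ≤ p → 0ℚ ≤ q → 0ℚ ≤ p + q
  0≤p+q 0≤p 0≤q = ≤-trans 0≤p (p≤p+q 0≤q)

  0≤1 : 0ℚ ≤ 1ℚ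
  0≤1 = nonNegative⁻¹ 1ℚ

  divide : ∀ {K e} → 0ℚ < K → 0ℚ < e → Σ[ δ ∈ ℚ ] (0ℚ < δ × K * δ ≡ e)
  divide {K} {e} 0<K 0<e =
    let instance _ = positive 0<K ; _ = pos⇒nonZero K ; _ = 1/pos⇒pos K in
    (1/ K) * e ,
    0<p*q (positive⁻¹ (1/ K)) 0<e ,
    trans (sym (*-assoc K (1/ K) e)) (trans (cong (_* e) (*-inverseʳ K)) (*-identityˡ e))

  n/1 : ℕ → ℚ
  n/1 n = + n / 1

  n/1-suc : ∀ n → n/1 (suc n) ≡ 1ℚ + n/1 n
  n/1-suc n = toℚᵘ-injective (begin
    toℚᵘ (n/1 (suc n))                 ≈⟨ toℚᵘ-fromℚᵘ (ℚᵘ.mkℚᵘ (+ suc n) 0) ⟩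
    ℚᵘ.mkℚᵘ (+ suc n) 0                ≈⟨ ℚᵘ.*≡* (cong (ℤ._* + 1) lem) ⟩
    ℚᵘ.1ℚᵘ ℚᵘ.+ ℚᵘ.mkℚᵘ (+ n) 0        ≈⟨ ℚᵘP.+-congʳ ℚᵘ.1ℚᵘ (ℚᵘP.≃-sym (toℚᵘ-fromℚᵘ (ℚᵘ.mkℚᵘ (+ n) 0))) ⟩
    toℚᵘ 1ℚ ℚᵘ.+ toℚᵘ (n/1 n)          ≈⟨ ℚᵘP.≃-sym (toℚᵘ-homo-+ 1ℚ (n/1 n)) ⟩
    toℚᵘ (1ℚ + n/1 n)                  ∎)
    where
    open ℚᵘP.≃-Reasoning
    lem : + suc n ≡ + 1 ℤ.* + 1 ℤ.+ + n ℤ.* + 1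
    lem = cong (λ z → + 1 ℤ.+ z) (sym (ℤP.*-identityʳ (+ n)))

  0≤n/1 : ∀ n → 0ℚ ≤ n/1 n
  0≤n/1 zero    = ≤-refl
  0≤n/1 (suc n) = subst (0ℚ ≤_) (sym (n/1-suc n)) (0≤p+q 0≤1 (0≤n/1 n))

  n/1-mono : ∀ {m n} → m ℕ.≤ n → n/1 m ≤ n/1 n
  n/1-mono {n = n} ℕ.z≤n = 0≤n/1 n
  n/1-mono (ℕ.s≤s {m} {n} m≤n) =
    subst₂ _≤_ (sym (n/1-suc m)) (sym (n/1-suc n)) (+-monoʳ-≤ 1ℚ (n/1-mono m≤n))

  archimedean : ∀ p → Σ[ n ∈ ℕ ] p ≤ n/1 n
  archimedean p@(mkℚ i d-1 _) = ℤ.∣ i ∣ , toℚᵘ-cancel-≤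
    (ℚᵘP.≤-respʳ-≃ (ℚᵘP.≃-sym (toℚᵘ-fromℚᵘ (ℚᵘ.mkℚᵘ (+ ℤ.∣ i ∣) 0)))
      (ℚᵘ.*≤* (ℤP.≤-trans (ℤP.≤-reflexive (ℤP.*-identityʳ i)) (lem i))))
    where
    lem : ∀ i → i ℤ.≤ + ℤ.∣ i ∣ ℤ.* + suc d-1
    lem (+ n) = subst (+ n ℤ.≤_) (ℤP.pos-* n (suc d-1)) (ℤ.+≤+ (ℕP.m≤m*n n (suc d-1)))
    lem ℤ.-[1+ n ] = subst (ℤ.-[1+ n ] ℤ.≤_) (ℤP.pos-* (suc n) (suc d-1)) ℤ.-≤+

  infix 8 ½^_
  ½^_ : ℕ → ℚ
  ½^ zero  = 1ℚ
  ½^ suc n = ½ * ½^ n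

  0≤½^n : ∀ n → 0ℚ ≤ ½^ n
  0≤½^n zero    = 0≤1
  0≤½^n (suc n) = 0≤p*q (nonNegative⁻¹ ½) (0≤½^n n)

  [1+n]*½^n≤1 : ∀ n → (1ℚ + n/1 n) * ½^ n ≤ 1ℚ
  [1+n]*½^n≤1 zero    = ≤-refl
  [1+n]*½^n≤1 (suc n) = begin
    (1ℚ + n/1 (suc n)) * (½ * ½^ n)     ≡⟨ cong (λ z → (1ℚ + z) * (½ * ½^ n)) (n/1-suc n) ⟩
    (1ℚ + (1ℚ + k)) * (½ * ½^ n)        ≤⟨ *-monoʳ-≤-nonNeg (½ * ½^ n) {{nn (0≤½^n (suc n))}}
                                             (+-monoʳ-≤ 1ℚ (+-monoʳ-≤ 1ℚ (p≤p+q {k} {k} (0≤n/1 n)))) ⟩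
    (1ℚ + (1ℚ + (k + k))) * (½ * ½^ n)  ≡⟨ solve 2 (λ k h →
                                             (con 1ℚ :+ (con 1ℚ :+ (k :+ k))) :* (con ½ :* h)
                                               := (con 1ℚ :+ k) :* h) refl k (½^ n) ⟩
    (1ℚ + k) * ½^ n                     ≤⟨ [1+n]*½^n≤1 n ⟩
    1ℚ                                  ∎
    where
    open ≤-Reasoning
    k = n/1 n

  K*½^n→0 : ∀ {K e} → 0ℚ ≤ K → 0ℚ < e → Eventually (λ n → K * ½^ n ≤ e)
  K*½^n→0 {K} {e} 0≤K 0<e = N , λ n N≤n → begin
    K * ½^ n                    ≡⟨ cong (_* ½^ n) (sym eδ≡K) ⟩
    (e * δ) * ½^ n              ≡⟨ *-assoc e δ (½^ n) ⟩
    e * (δ * ½^ n)              ≤⟨ *-monoˡ-≤-nonNeg e {{0≤e}}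
                                     (*-monoʳ-≤-nonNeg (½^ n) {{nn (0≤½^n n)}}
                                       (≤-trans δ≤N (≤-trans (n/1-mono N≤n)
                                         (subst (n/1 n ≤_) (+-comm (n/1 n) 1ℚ) (p≤p+q 0≤1))))) ⟩
    e * ((1ℚ + n/1 n) * ½^ n)   ≤⟨ *-monoˡ-≤-nonNeg e {{0≤e}} ([1+n]*½^n≤1 n) ⟩
    e * 1ℚ                      ≡⟨ *-identityʳ e ⟩
    e                           ∎
    where
    open ≤-Reasoning
    0≤e : NonNegative e
    0≤e = nn (<⇒≤ 0<e)
    instance
      _ = positive 0<e
      _ = pos⇒nonZero e
    δ = (1/ e) * K
    eδ≡K : e * δ ≡ K
    eδ≡K = trans (sym (*-assoc e (1/ e) K)) (trans (cong (_* K) (*-inverseʳ e)) (*-identityˡ K))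
    N = proj₁ (archimedean δ)
    δ≤N : δ ≤ n/1 N
    δ≤N = proj₂ (archimedean δ)

-- Cauchy reals: equality and order are taken up to limits, so _≈_, not _≡_, is
-- equality of real numbers.
record ℝ : Set where
  constructor mkℝ
  field
    seq    : ℕ → ℚ
    cauchy : ∀ ε → 0ℚ ℚ.< ε →
             Σ[ N ∈ ℕ ] (∀ m n → N ℕ.≤ m → N ℕ.≤ n → ℚ.∣ seq m ℚ.- seq n ∣ ℚ.≤ ε)

open ℝ public

infix 4 _≈_ _≤_ _<_
_≈_ _≤_ _<_ : ℝ → ℝ → Set
x ≈ y = ∀ ε → 0ℚ ℚ.< ε → Eventually (λ n → ℚ.∣ seq x n ℚ.- seq y n ∣ ℚ.≤ ε)
x ≤ y = ∀ ε → 0ℚ ℚ.< ε → Eventually (λ n → seq x n ℚ.≤ seq y n ℚ.+ ε)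
x < y = Σ[ ε ∈ ℚ ] (0ℚ ℚ.< ε × Eventually (λ n → seq x n ℚ.+ ε ℚ.≤ seq y n))

fromℚ : ℚ → ℝ
fromℚ p = mkℝ (λ _ → p) λ ε 0<ε → 0 , λ _ _ _ _ →
  ℚP.≤-trans (ℚP.≤-reflexive (cong ℚ.∣_∣ (ℚP.+-inverseʳ p))) (ℚP.<⇒≤ 0<ε)

fromℕ : ℕ → ℝ
fromℕ n = fromℚ (+ n ℚ./ 1)

0ℝ 1ℝ ½ℝ : ℝ
0ℝ = fromℚ 0ℚ
1ℝ = fromℚ 1ℚ
½ℝ = fromℚ ½

module Cauchy where
  open import Data.Rational using (_+_; _*_; _-_; ∣_∣; _⊔_) renaming (-_ to neg; _≤_ to _≤q_; _<_ to _<q_)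
  open +-*-Solver
  open ℚP.≤-Reasoning
  open ℚ-Lemmas

  cauchy₂ : (x y : ℝ) → ∀ ε → 0ℚ <q ε → Σ[ N ∈ ℕ ] (∀ m n → N ℕ.≤ m → N ℕ.≤ n →
            ∣ seq x m - seq x n ∣ ≤q ε × ∣ seq y m - seq y n ∣ ≤q ε)
  cauchy₂ x y ε 0<ε with cauchy x ε 0<ε | cauchy y ε 0<ε
  ... | M , hx | N , hy = M ℕ.⊔ N , λ m n h₁ h₂ →
    hx m n (ℕP.m⊔n≤o⇒m≤o M N h₁) (ℕP.m⊔n≤o⇒m≤o M N h₂) ,
    hy m n (ℕP.m⊔n≤o⇒n≤o M N h₁) (ℕP.m⊔n≤o⇒n≤o M N h₂)

  bounded : (x : ℝ) → Σ[ K ∈ ℚ ] (0ℚ <q K × Eventually (λ n → ∣ seq x n ∣ ≤q K))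
  bounded x with cauchy x 1ℚ (ℚP.positive⁻¹ 1ℚ)
  ... | N , h = ∣ seq x N ∣ + 1ℚ ,
    ℚP.<-≤-trans (ℚP.positive⁻¹ 1ℚ)
      (subst (1ℚ ≤q_) (ℚP.+-comm 1ℚ ∣ seq x N ∣) (p≤p+q {1ℚ} {∣ seq x N ∣} (ℚP.0≤∣p∣ (seq x N)))) ,
    N , λ n N≤n → begin
      ∣ seq x n ∣                          ≡⟨ cong ∣_∣ (solve 2 (λ a b → a := b :+ (a :- b)) refl (seq x n) (seq x N)) ⟩
      ∣ seq x N + (seq x n - seq x N) ∣    ≤⟨ ℚP.∣p+q∣≤∣p∣+∣q∣ (seq x N) _ ⟩
      ∣ seq x N ∣ + ∣ seq x n - seq x N ∣  ≤⟨ ℚP.+-monoʳ-≤ ∣ seq x N ∣ (h n N N≤n ℕP.≤-refl) ⟩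
      ∣ seq x N ∣ + 1ℚ                     ∎

  +-cauchy : (x y : ℝ) → ∀ ε → 0ℚ <q ε → Σ[ N ∈ ℕ ] (∀ m n → N ℕ.≤ m → N ℕ.≤ n →
             ∣ (seq x m + seq y m) - (seq x n + seq y n) ∣ ≤q ε)
  +-cauchy x y ε 0<ε with cauchy₂ x y (½ * ε) (½*-pos 0<ε)
  ... | N , h = N , λ m n N≤m N≤n → begin
    ∣ (seq x m + seq y m) - (seq x n + seq y n) ∣
      ≡⟨ cong ∣_∣ (solve 4 (λ a b c d → (a :+ b) :- (c :+ d) := (a :- c) :+ (b :- d)) refl
           (seq x m) (seq y m) (seq x n) (seq y n)) ⟩
    ∣ (seq x m - seq x n) + (seq y m - seq y n) ∣
      ≤⟨ ℚP.∣p+q∣≤∣p∣+∣q∣ (seq x m - seq x n) (seq y m - seq y n) ⟩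
    ∣ seq x m - seq x n ∣ + ∣ seq y m - seq y n ∣
      ≤⟨ ℚP.+-mono-≤ (proj₁ (h m n N≤m N≤n)) (proj₂ (h m n N≤m N≤n)) ⟩
    ½ * ε + ½ * ε
      ≡⟨ ½e+½e≡e ε ⟩
    ε ∎

  neg-cauchy : (x : ℝ) → ∀ ε → 0ℚ <q ε → Σ[ N ∈ ℕ ] (∀ m n → N ℕ.≤ m → N ℕ.≤ n →
               ∣ neg (seq x m) - neg (seq x n) ∣ ≤q ε)
  neg-cauchy x ε 0<ε with cauchy x ε 0<ε
  ... | N , h = N , λ m n N≤m N≤n → subst (_≤q ε)
    (trans (∣p-q∣≡∣q-p∣ (seq x m) (seq x n))
      (cong ∣_∣ (solve 2 (λ a b → b :- a := (:- a) :- (:- b)) refl (seq x m) (seq x n))))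
    (h m n N≤m N≤n)

  *-step : ∀ {K L δ} a b c d → 0ℚ ≤q δ → ∣ a ∣ ≤q K → ∣ d ∣ ≤q L →
           ∣ a - c ∣ ≤q δ → ∣ b - d ∣ ≤q δ → ∣ a * b - c * d ∣ ≤q (K + L) * δ
  *-step {K} {L} {δ} a b c d 0≤δ a≤K d≤L a-c≤δ b-d≤δ = begin
    ∣ a * b - c * d ∣
      ≡⟨ cong ∣_∣ (solve 4 (λ a b c d → a :* b :- c :* d := a :* (b :- d) :+ d :* (a :- c)) refl a b c d) ⟩
    ∣ a * (b - d) + d * (a - c) ∣
      ≤⟨ ℚP.∣p+q∣≤∣p∣+∣q∣ (a * (b - d)) (d * (a - c)) ⟩
    ∣ a * (b - d) ∣ + ∣ d * (a - c) ∣
      ≡⟨ cong₂ _+_ (ℚP.∣p*q∣≡∣p∣*∣q∣ a (b - d)) (ℚP.∣p*q∣≡∣p∣*∣q∣ d (a - c)) ⟩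
    ∣ a ∣ * ∣ b - d ∣ + ∣ d ∣ * ∣ a - c ∣
      ≤⟨ ℚP.+-mono-≤
           (*-mono-≤-nonNeg {∣ a ∣} {K} {∣ b - d ∣} {δ} (ℚP.0≤∣p∣ a) 0≤δ a≤K b-d≤δ)
           (*-mono-≤-nonNeg {∣ d ∣} {L} {∣ a - c ∣} {δ} (ℚP.0≤∣p∣ d) 0≤δ d≤L a-c≤δ) ⟩
    K * δ + L * δ
      ≡⟨ sym (ℚP.*-distribʳ-+ δ K L) ⟩
    (K + L) * δ ∎

  *-cauchy : (x y : ℝ) → ∀ ε → 0ℚ <q ε → Σ[ N ∈ ℕ ] (∀ m n → N ℕ.≤ m → N ℕ.≤ n →
             ∣ (seq x m * seq y m) - (seq x n * seq y n) ∣ ≤q ε)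
  *-cauchy x y ε 0<ε =
    let K , 0<K , M₁ , hK    = bounded x
        L , 0<L , M₂ , hL    = bounded y
        δ , 0<δ , [K+L]δ≡ε   = divide {K + L} {ε} (ℚP.+-mono-< 0<K 0<L) 0<ε
        M₃ , h               = cauchy₂ x y δ 0<δ
        M                    = M₁ ℕ.⊔ M₂
    in M ℕ.⊔ M₃ , λ m n N≤m N≤n →
      let hx , hy = h m n (ℕP.m⊔n≤o⇒n≤o M M₃ N≤m) (ℕP.m⊔n≤o⇒n≤o M M₃ N≤n)
      in subst (∣ (seq x m * seq y m) - (seq x n * seq y n) ∣ ≤q_) [K+L]δ≡ε
           (*-step {K} {L} {δ} (seq x m) (seq y m) (seq x n) (seq y n) (ℚP.<⇒≤ 0<δ)
             (hK m (ℕP.m⊔n≤o⇒m≤o M₁ M₂ (ℕP.m⊔n≤o⇒m≤o M M₃ N≤m)))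
             (hL n (ℕP.m⊔n≤o⇒n≤o M₁ M₂ (ℕP.m⊔n≤o⇒m≤o M M₃ N≤n)))
             hx hy)

  ⊔-step : ∀ {e} a b c d → ∣ a - c ∣ ≤q e → ∣ b - d ∣ ≤q e → a ⊔ b ≤q (c ⊔ d) + e
  ⊔-step {e} a b c d a-c≤e b-d≤e = ℚP.⊔-lub {(c ⊔ d) + e} {a} {b}
    (ℚP.≤-trans (∣p-q∣≤e⇒p≤q+e {a} {c} a-c≤e) (ℚP.+-monoˡ-≤ e (ℚP.p≤p⊔q c d)))
    (ℚP.≤-trans (∣p-q∣≤e⇒p≤q+e {b} {d} b-d≤e) (ℚP.+-monoˡ-≤ e (ℚP.p≤q⊔p c d)))

  ⊔-cauchy : (x y : ℝ) → ∀ ε → 0ℚ <q ε → Σ[ N ∈ ℕ ] (∀ m n → N ℕ.≤ m → N ℕ.≤ n →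
             ∣ (seq x m ⊔ seq y m) - (seq x n ⊔ seq y n) ∣ ≤q ε)
  ⊔-cauchy x y ε 0<ε =
    let N , h = cauchy₂ x y ε 0<ε
    in N , λ m n N≤m N≤n → p≤q+e∧q≤p+e⇒∣p-q∣≤e
         {seq x m ⊔ seq y m} {seq x n ⊔ seq y n} {ε}
         (⊔-step (seq x m) (seq y m) (seq x n) (seq y n) (proj₁ (h m n N≤m N≤n)) (proj₂ (h m n N≤m N≤n)))
         (⊔-step (seq x n) (seq y n) (seq x m) (seq y m) (proj₁ (h n m N≤n N≤m)) (proj₂ (h n m N≤n N≤m)))

  -- For a ≥ 0, √ a lies in [ bisect a n , bisect a n + width a n ); see Bisected.
  width : ℚ → ℕ → ℚ
  width a n = (a + 1ℚ) * ½^ n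

  bisect : ℚ → ℕ → ℚ
  bisect a zero    = 0ℚ
  bisect a (suc n) =
    let mid = bisect a n + width a (suc n) in
    if mid * mid ℚ.≤ᵇ a then mid else bisect a n

  width-halves : ∀ a n → width a (suc n) + width a (suc n) ≡ width a n
  width-halves a n = solve 2 (λ s h → s :* (con ½ :* h) :+ s :* (con ½ :* h) := s :* h) refl
    (a + 1ℚ) (½^ n)

  0≤width : ∀ {a} n → 0ℚ ≤q a → 0ℚ ≤q width a n
  0≤width n 0≤a = 0≤p*q (0≤p+q 0≤a 0≤1) (0≤½^n n)

  record Bisected (a : ℚ) (n : ℕ) (l : ℚ) : Set where
    field
      0≤l    : 0ℚ ≤q l
      l²≤a   : l * l ≤q a
      a<l+w² : a <q (l + width a n) * (l + width a n)

  bisect-correct : ∀ {a} n → 0ℚ ≤q a → Bisected a n (bisect a n)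
  bisect-correct {a} zero 0≤a = record
    { 0≤l    = ℚP.≤-refl
    ; l²≤a   = 0≤a
    ; a<l+w² = begin-strict
        a                  ≡⟨ sym (ℚP.+-identityʳ a) ⟩
        a + 0ℚ             <⟨ ℚP.+-monoʳ-< a (ℚP.positive⁻¹ 1ℚ) ⟩
        a + 1ℚ             ≤⟨ p≤p+q (0≤p*q 0≤a (0≤p+q 0≤a 0≤1)) ⟩
        (a + 1ℚ) + a * (a + 1ℚ)
          ≡⟨ solve 1 (λ a → (a :+ con 1ℚ) :+ a :* (a :+ con 1ℚ)
               := (con 0ℚ :+ (a :+ con 1ℚ) :* con 1ℚ) :* (con 0ℚ :+ (a :+ con 1ℚ) :* con 1ℚ)) refl a ⟩
        (0ℚ + width a 0) * (0ℚ + width a 0) ∎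
    }
  bisect-correct {a} (suc n) 0≤a
    with (bisect a n + width a (suc n)) * (bisect a n + width a (suc n)) ℚ.≤ᵇ a
       | ℚP.≤ᵇ⇒≤ {(bisect a n + width a (suc n)) * (bisect a n + width a (suc n))} {a}
       | ℚP.≤⇒≤ᵇ {(bisect a n + width a (suc n)) * (bisect a n + width a (suc n))} {a}
  ... | true  | mid²≤a | _ = record
    { 0≤l    = 0≤p+q 0≤l (0≤width (suc n) 0≤a)
    ; l²≤a   = mid²≤a _
    ; a<l+w² = subst (λ z → a <q z * z)
        (trans (cong (bisect a n ℚ.+_) (sym (width-halves a n)))
          (sym (ℚP.+-assoc (bisect a n) (width a (suc n)) (width a (suc n))))) a<l+w²
    }
    where open Bisected (bisect-correct n 0≤a)
  ... | false | _ | mid²≰a = record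
    { 0≤l    = 0≤l
    ; l²≤a   = l²≤a
    ; a<l+w² = ℚP.≰⇒> mid²≰a
    }
    where open Bisected (bisect-correct n 0≤a)

  √-step : ∀ {a b ε} m n → 0ℚ ≤q a → 0ℚ ≤q b → 0ℚ <q ε →
           ∣ b - a ∣ ≤q (½ * ε) * (½ * ε) → width a n ≤q ½ * ε →
           bisect b m ≤q bisect a n + ε
  √-step {a} {b} {ε} m n 0≤a 0≤b 0<ε b-a≤h² w≤h =
    ℚP.≮⇒≥ λ l+ε<k → ℚP.<-irrefl {b} refl (begin-strict
      b                              ≤⟨ ∣p-q∣≤e⇒p≤q+e {b} {a} {h * h} b-a≤h² ⟩
      a + h * h                      <⟨ ℚP.+-monoˡ-< (h * h) A.a<l+w² ⟩
      t * t + h * h                  ≤⟨ p≤p+q {t * t + h * h} {t * h + t * h} (0≤p+q {t * h} {t * h} 0≤th 0≤th) ⟩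
      (t * t + h * h) + (t * h + t * h)
        ≡⟨ solve 2 (λ t h → (t :* t :+ h :* h) :+ (t :* h :+ t :* h) := (t :+ h) :* (t :+ h)) refl t h ⟩
      (t + h) * (t + h)              ≤⟨ *-mono-≤-nonNeg {t + h} {k} {t + h} {k}
                                          (0≤p+q {t} {h} 0≤t 0≤h) B.0≤l (t+h≤k l+ε<k) (t+h≤k l+ε<k) ⟩
      k * k                          ≤⟨ B.l²≤a ⟩
      b                              ∎)
    where
    module A = Bisected (bisect-correct {a} n 0≤a)
    module B = Bisected (bisect-correct {b} m 0≤b)
    l = bisect a n
    k = bisect b m
    t = l + width a n
    h = ½ * ε
    0≤h : 0ℚ ≤q h
    0≤h = ℚP.<⇒≤ (½*-pos {ε} 0<ε)
    0≤t : 0ℚ ≤q t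
    0≤t = 0≤p+q {l} {width a n} A.0≤l (0≤width {a} n 0≤a)
    0≤th : 0ℚ ≤q t * h
    0≤th = 0≤p*q {t} {h} 0≤t 0≤h
    t+h≤k : l + ε <q k → t + h ≤q k
    t+h≤k l+ε<k = begin
      t + h        ≤⟨ ℚP.+-monoˡ-≤ h (ℚP.+-monoʳ-≤ l w≤h) ⟩
      l + h + h    ≡⟨ ℚP.+-assoc l h h ⟩
      l + (h + h)  ≡⟨ cong (l ℚ.+_) (½e+½e≡e ε) ⟩
      l + ε        <⟨ l+ε<k ⟩
      k            ∎

  √-cauchy : (x : ℝ) → ∀ ε → 0ℚ <q ε → Σ[ N ∈ ℕ ] (∀ m n → N ℕ.≤ m → N ℕ.≤ n →
             ∣ bisect (0ℚ ⊔ seq x m) m - bisect (0ℚ ⊔ seq x n) n ∣ ≤q ε)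
  √-cauchy x ε 0<ε =
    let K , 0<K , M₁ , hK = bounded x
        h                 = ½ * ε
        0<h               = ½*-pos {ε} 0<ε
        M₂ , hw           = K*½^n→0 {K + 1ℚ} {h} (0≤p+q {K} {1ℚ} (ℚP.<⇒≤ 0<K) 0≤1) 0<h
        M₃ , ha           = ⊔-cauchy 0ℝ x (h * h) (0<p*q {h} {h} 0<h 0<h)
        M                 = M₁ ℕ.⊔ M₂
        narrow : ∀ n → M ℕ.⊔ M₃ ℕ.≤ n → width (0ℚ ⊔ seq x n) n ≤q h
        narrow n N≤n = ℚP.≤-trans
          (ℚP.*-monoʳ-≤-nonNeg (½^ n) {{nn (0≤½^n n)}} (ℚP.+-monoˡ-≤ 1ℚ
            (ℚP.⊔-lub {K} {0ℚ} {seq x n} (ℚP.<⇒≤ 0<K) (ℚP.≤-trans (p≤∣p∣ (seq x n))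
              (hK n (ℕP.m⊔n≤o⇒m≤o M₁ M₂ (ℕP.m⊔n≤o⇒m≤o M M₃ N≤n)))))))
          (hw n (ℕP.m⊔n≤o⇒n≤o M₁ M₂ (ℕP.m⊔n≤o⇒m≤o M M₃ N≤n)))
        half : ∀ m n → M ℕ.⊔ M₃ ℕ.≤ m → M ℕ.⊔ M₃ ℕ.≤ n →
               bisect (0ℚ ⊔ seq x m) m ≤q bisect (0ℚ ⊔ seq x n) n + ε
        half m n N≤m N≤n = √-step {0ℚ ⊔ seq x n} {0ℚ ⊔ seq x m} {ε} m n
          (ℚP.p≤p⊔q 0ℚ (seq x n)) (ℚP.p≤p⊔q 0ℚ (seq x m)) 0<ε
          (ha m n (ℕP.m⊔n≤o⇒n≤o M M₃ N≤m) (ℕP.m⊔n≤o⇒n≤o M M₃ N≤n))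
          (narrow n N≤n)
    in M ℕ.⊔ M₃ , λ m n N≤m N≤n → p≤q+e∧q≤p+e⇒∣p-q∣≤e
         {bisect (0ℚ ⊔ seq x m) m} {bisect (0ℚ ⊔ seq x n) n} {ε}
         (half m n N≤m N≤n) (half n m N≤n N≤m)

infix  8 -_
infixl 7 _*_
infixl 6 _+_ _-_ _⊔_

_+_ : ℝ → ℝ → ℝ
x + y = mkℝ (λ n → seq x n ℚ.+ seq y n) (Cauchy.+-cauchy x y)

_*_ : ℝ → ℝ → ℝ
x * y = mkℝ (λ n → seq x n ℚ.* seq y n) (Cauchy.*-cauchy x y)

_⊔_ : ℝ → ℝ → ℝ
x ⊔ y = mkℝ (λ n → seq x n ℚ.⊔ seq y n) (Cauchy.⊔-cauchy x y)

-_ : ℝ → ℝ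
- x = mkℝ (λ n → ℚ.- seq x n) (Cauchy.neg-cauchy x)

_-_ : ℝ → ℝ → ℝ
x - y = x + (- y)

∣_∣ : ℝ → ℝ
∣ x ∣ = x ⊔ (- x)

-- √ x is 0 for x ≤ 0.
√ : ℝ → ℝ
√ x = mkℝ (λ n → Cauchy.bisect (0ℚ ℚ.⊔ seq x n) n) (Cauchy.√-cauchy x)

_⟶∞ : (ℕ → ℝ) → Set
f ⟶∞ = ∀ M → Eventually (λ n → M < f n)

infix 4 _=o_
_=o_ : (ℕ → ℝ) → (ℕ → ℝ) → Set
f =o g = ∀ ε → 0ℝ < ε → Eventually (λ n → ∣ f n ∣ ≤ ε * ∣ g n ∣)

-- 1/ n; the value at 0 is immaterial, as only limits n → ∞ are taken.
recip : ℕ → ℝ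
recip zero    = 0ℝ
recip (suc n) = fromℚ (+ 1 ℚ./ suc n)

_^3/2 : ℕ → ℝ
n ^3/2 = √ (fromℕ (n ℕ.^ 3))

Point : ℕ → Set
Point d = Vector ℝ d

_≈ᵖ_ : ∀ {d} → Point d → Point d → Set
x ≈ᵖ y = ∀ i → x i ≈ y i

dist : ∀ {d} → Point d → Point d → ℝ
dist x y = √ (Vector.foldr _+_ 0ℝ (λ i → (x i - y i) * (x i - y i)))

-- Distances are nonnegative, so starting the maximum at 0 changes nothing for a
-- nonempty family.
max : ∀ {k} → Vector ℝ k → ℝ
max = Vector.foldr _⊔_ 0ℝ

diam : ∀ {d k} → Vector (Point d) k → ℝ
diam x = max (λ i → max (λ j → dist (x i) (x j)))

dist-sym : ∀ {d} (x y : Point d) n → seq (dist x y) n ≡ seq (dist y x) n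
dist-sym x y n = cong (λ z → Cauchy.bisect (0ℚ ℚ.⊔ z) n) (squares x y)
  where
  open +-*-Solver
  squares : ∀ {d} (x y : Point d) →
            seq (Vector.foldr _+_ 0ℝ (λ i → (x i - y i) * (x i - y i))) n ≡
            seq (Vector.foldr _+_ 0ℝ (λ i → (y i - x i) * (y i - x i))) n
  squares {zero}  x y = refl
  squares {suc d} x y = cong₂ ℚ._+_
    (solve 2 (λ a b → (a :- b) :* (a :- b) := (b :- a) :* (b :- a)) refl
      (seq (x zero) n) (seq (y zero) n))
    (squares (λ i → x (suc i)) (λ i → y (suc i)))

record SimpleGraph : Set₁ where
  field
    Vertex : Set
    Adj    : Vertex → Vertex → Set
    symm   : ∀ {u v} → Adj u v → Adj v u
    irrefl : ∀ {v} → ¬ Adj v v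

open SimpleGraph public

record _≅_ (G H : SimpleGraph) : Set where
  field
    bijection : Vertex G ↔ Vertex H
    adjacency : ∀ u v → Adj G u v ⇔ Adj H (Inverse.to bijection u) (Inverse.to bijection v)

Colourable : SimpleGraph → ℕ → Set
Colourable G c =
  Σ[ f ∈ (Vertex G → Fin c) ] (∀ u v → Adj G u v → f u ≢ f v)

-- χ(G) = c
HasChromaticNumber : SimpleGraph → ℕ → Set
HasChromaticNumber G c = Colourable G c × (∀ m → Colourable G m → c ℕ.≤ m)

Connected : SimpleGraph → Set
Connected G = ∀ u v → Star (Adj G) u v

-- A finite V ⊂ ℝᵈ is given by an injective family of its points.
InjectiveFamily : ∀ {d k} → Vector (Point d) k → Set
InjectiveFamily x = ∀ i j → x i ≈ᵖ x j → i ≡ j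

diameterGraph : ∀ {d k} → Vector (Point d) k → SimpleGraph
diameterGraph {d} {k} x = record
  { Vertex = Fin k
  ; Adj    = λ i j → i ≢ j × dist (x i) (x j) ≈ diam x
  ; symm   = λ {i} {j} (i≢j , eq) →
      (λ j≡i → i≢j (sym j≡i)) ,
      λ ε 0<ε → let N , h = eq ε 0<ε in N , λ n N≤n →
        subst (λ z → ℚ.∣ z ℚ.- seq (diam x) n ∣ ℚ.≤ ε) (dist-sym (x i) (x j) n) (h n N≤n)
  ; irrefl = λ (i≢i , _) → i≢i refl
  }

IsDiameterGraph : ℕ → SimpleGraph → Set
IsDiameterGraph d G =
  Σ[ k ∈ ℕ ] Σ[ x ∈ Vector (Point d) k ] (InjectiveFamily x × G ≅ diameterGraph x)

-- Graphs on the vertex set Fin n: G ▹ S adds a vertex zero whose neighbours are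
-- the (shifted) elements of S. Each labelled graph has exactly one such code.
infixl 5 _▹_
data LabelledGraph : ℕ → Set where
  ∅   : LabelledGraph 0
  _▹_ : ∀ {n} → LabelledGraph n → Subset n → LabelledGraph (suc n)

LAdj : ∀ {n} → LabelledGraph n → Fin n → Fin n → Set
LAdj (G ▹ S) zero    zero    = ⊥
LAdj (G ▹ S) zero    (suc j) = j ∈ S
LAdj (G ▹ S) (suc i) zero    = i ∈ S
LAdj (G ▹ S) (suc i) (suc j) = LAdj G i j

LAdj-symm : ∀ {n} (G : LabelledGraph n) i j → LAdj G i j → LAdj G j i
LAdj-symm (G ▹ S) zero    (suc j) h = h
LAdj-symm (G ▹ S) (suc i) zero    h = h
LAdj-symm (G ▹ S) (suc i) (suc j) h = LAdj-symm G i j h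

LAdj-irrefl : ∀ {n} (G : LabelledGraph n) i → ¬ LAdj G i i
LAdj-irrefl (G ▹ S) (suc i) h = LAdj-irrefl G i h

induced : ∀ {n} → LabelledGraph n → Subset n → SimpleGraph
induced G W = record
  { Vertex = ∃ (_∈ W)
  ; Adj    = λ (u , _) (v , _) → LAdj G u v
  ; symm   = λ {(u , _)} {(v , _)} → LAdj-symm G u v
  ; irrefl = λ {(v , _)} → LAdj-irrefl G v
  }

subsets : ∀ n → List (Subset n)
subsets zero    = [] ∷ []
subsets (suc n) = cartesianProductWith _∷_ (true ∷ false ∷ []) (subsets n)

graphs : ∀ n → List (LabelledGraph n)
graphs zero    = ∅ ∷ []
graphs (suc n) = cartesianProductWith _▹_ (graphs n) (subsets n)

edgeWeight : ℝ → Bool → ℝ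
edgeWeight p e = if e then p else 1ℝ - p

-- The probability that G(n,p) is the given graph.
weight : ∀ {n} → ℝ → LabelledGraph n → ℝ
weight p ∅       = 1ℝ
weight p (G ▹ S) = weight p G * Vec.foldr′ (λ e w → edgeWeight p e * w) 1ℝ S

ℙ : ∀ {n} → ℝ → (LabelledGraph n → Bool) → ℝ
ℙ {n} p A = List.foldr _+_ 0ℝ (map (weight p) (filterᵇ A (graphs n)))

-- ℙₙ,ₚ(E) > c. As E need not come with a decision procedure, the probability of E
-- is taken to be the largest probability of a decidable event contained in E.
-- Classically E is itself decidable, and then for 0 ≤ p ≤ 1 this says ℙ p E > c.
ℙ[_]⟨_⟩>_ : ∀ {n} → ℝ → (LabelledGraph n → Set) → ℝ → Set
ℙ[_]⟨_⟩>_ {n} p E c =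
  Σ[ A ∈ (LabelledGraph n → Bool) ] ((∀ G → T (A G) → E G) × c < ℙ p A)

HasDiameterSubgraph HasConnectedDiameterSubgraph :
  ∀ {n} → ℕ → ℕ → LabelledGraph n → Set
HasDiameterSubgraph {n} d k G = Σ[ W ∈ Subset n ]
  ( Subset.∣ W ∣ ≡ k
  × IsDiameterGraph d (induced G W)
  × HasChromaticNumber (induced G W) (d ℕ.+ 1))
HasConnectedDiameterSubgraph {n} d k G = Σ[ W ∈ Subset n ]
  ( Subset.∣ W ∣ ≡ k
  × IsDiameterGraph d (induced G W)
  × HasChromaticNumber (induced G W) (d ℕ.+ 1)
  × Connected (induced G W))

LargestPositiveOrZero : (ℕ → Set) → ℕ → Set
LargestPositiveOrZero Q u =
    (1 ℕ.≤ u × Q u × (∀ k → 1 ℕ.≤ k → Q k → k ℕ.≤ u))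
  ⊎ (u ≡ 0 × (∀ k → 1 ℕ.≤ k → ¬ Q k))

-- IsU d n p u means u_d(n,p) = u, and IsU′ d n p u means u′_d(n,p) = u.
IsU IsU′ : ℕ → ℕ → ℝ → ℕ → Set
IsU d n p = LargestPositiveOrZero
  (λ k → ℙ[ p ]⟨ HasDiameterSubgraph {n} d k ⟩> ½ℝ)
IsU′ d n p = LargestPositiveOrZero
  (λ k → ℙ[ p ]⟨ HasConnectedDiameterSubgraph {n} d k ⟩> ½ℝ)

module Submission where

-- In the complement of G(n,p) every vertex set of bounded size spans a forest with high
-- probability, since nq → 0. If a graph on five vertices contains no 4-cycle then its
-- complement contains a cycle, while a planar diameter graph contains no 4-cycle; so no
-- diameter graph of the plane has five or more vertices. Conversely, n³q² → ∞ forces a path of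
-- length two in the complement, and together with a vertex missing no edge it gives a triangle
-- with a pendant edge, which is a 3-chromatic diameter graph of the plane.

open import Data.Bool using (Bool; true; false; T; not; _∧_; _∨_; if_then_else_)
open import Data.Bool.ListAction using (all; any)
open import Data.Bool.Properties using (T-∧; T-∨)
open import Data.Empty using (⊥; ⊥-elim)
open import Data.Fin using (Fin; zero; suc)
open import Data.Fin.Patterns using (0F; 1F; 2F; 3F; 4F)
import Data.Fin.Properties as FinP
open import Data.Fin.Subset as Subset using (Subset; _∈_)
import Data.Fin.Subset.Properties as SubsetP
open import Data.Integer as ℤ using (ℤ)
open import Data.List as List using (List; []; _∷_; cartesianProductWith; filterᵇ)
import Data.List.Membership.Propositional as List∈
open import Data.List.Membership.Propositional.Properties using (∈-cartesianProductWith⁺; ∈-allFin)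
import Data.List.Properties as ListP
open import Data.List.Relation.Unary.All as All using (All; []; _∷_)
import Data.List.Relation.Unary.All.Properties as AllP
open import Data.List.Relation.Unary.AllPairs as AllPairs using (AllPairs; []; _∷_)
import Data.List.Relation.Unary.AllPairs.Properties as AllPairsP
open import Data.List.Relation.Unary.Any as Any using (Any; here; there)
import Data.List.Relation.Unary.Any.Properties as AnyP
open import Data.Nat as ℕ using (ℕ; zero; suc)
import Data.Nat.Properties as ℕP
import Data.Nat.Solver as ℕSolver
open import Data.Nat.Tactic.RingSolver using (solve-∀)
open import Data.Product as Product using (Σ-syntax; ∃; _×_; _,_; proj₁; proj₂; uncurry)
open import Data.Rational as ℚ using (ℚ; 0ℚ; 1ℚ; ½)
import Data.Rational.Properties as ℚP
open import Data.Rational.Solver using (module +-*-Solver)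
import Data.Rational.Unnormalised as ℚᵘ
import Data.Rational.Unnormalised.Properties as ℚᵘP
open import Data.Sum as Sum using (_⊎_; inj₁; inj₂; [_,_]′)
open import Data.Unit using (tt)
open import Data.Vec as Vec using (Vec; []; _∷_; lookup; tabulate; _[_]≔_; here; there)
import Data.Vec.Properties as VecP
open import Data.Vec.Properties.WithK using ([]=-irrelevant)
open import Data.Vec.Functional using (Vector)
open import Function using (_∘_; case_of_)
open import Function.Bundles using (_↔_; Inverse; Equivalence; mk⇔; mk↔ₛ′)
open import Relation.Binary.Construct.Closure.ReflexiveTransitive as Star using (Star; _◅_; _◅◅_)
open import Relation.Binary.PropositionalEquality
  using (_≡_; _≢_; refl; sym; trans; cong; cong₂; subst; subst₂; module ≡-Reasoning)
open import Relation.Nullary using (¬_; Dec; yes; no; does)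
open import Relation.Nullary.Decidable using (_→-dec_; _×-dec_; _⊎-dec_; ¬?; dec-true; from-yes)
import Defs
open Defs using (LabelledGraph; ∅; _▹_; LAdj; subsets; graphs; ℝ; seq; weight; ℙ; module ℚ-Lemmas)

-- Real operations act termwise on Cauchy sequences, so the probability of an event has at index m
-- the exact rational value given by the m-th approximation of p. All probabilistic estimates are
-- therefore made over the rationals, for one pair p, q at a time. The two events involved have
-- probability at most 1/4 and at least 3/4, which leaves a fixed margin around 1/2 for the passage
-- back to the reals. Existence of the path of length two would usually need a second moment.
-- Instead the graph is exposed vertex by vertex: the events that a new vertex misses two older ones
-- are independent, so the probability that none occurs is a product. The vertex missing no edge is
-- likewise fixed in advance, as the newest one. Order and equality of reals are not decidable,
-- which is an obstacle to arguing by the position of crossing diameters. A 4-cycle of diameters is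
-- excluded by polynomial identities alone: its two diagonals and the vector between their midpoints
-- are pairwise orthogonal, so in the plane one of the three vanishes.

module Combinatorics where

  -- Boolean adjacency, restriction to chosen vertices, exhaustive search over small graphs

  adj missing : ∀ {n} → LabelledGraph n → Fin n → Fin n → Bool
  adj (G ▹ S) zero    zero    = false
  adj (G ▹ S) zero    (suc j) = lookup S j
  adj (G ▹ S) (suc i) zero    = lookup S i
  adj (G ▹ S) (suc i) (suc j) = adj G i j
  missing G i j = not (adj G i j)

  T-lookup⇒∈ : ∀ {n} {S : Subset n} {i} → T (lookup S i) → i ∈ S
  T-lookup⇒∈ {S = true ∷ S} {zero}  _ = here
  T-lookup⇒∈ {S = _ ∷ S}    {suc i} h = there (T-lookup⇒∈ h)

  ∈⇒T-lookup : ∀ {n} {S : Subset n} {i} → i ∈ S → T (lookup S i)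
  ∈⇒T-lookup here      = tt
  ∈⇒T-lookup (there h) = ∈⇒T-lookup h

  adj⇒LAdj : ∀ {n} (G : LabelledGraph n) i j → T (adj G i j) → LAdj G i j
  adj⇒LAdj (G ▹ S) zero    (suc j) h = T-lookup⇒∈ h
  adj⇒LAdj (G ▹ S) (suc i) zero    h = T-lookup⇒∈ h
  adj⇒LAdj (G ▹ S) (suc i) (suc j) h = adj⇒LAdj G i j h

  LAdj⇒adj : ∀ {n} (G : LabelledGraph n) i j → LAdj G i j → T (adj G i j)
  LAdj⇒adj (G ▹ S) zero    (suc j) h = ∈⇒T-lookup h
  LAdj⇒adj (G ▹ S) (suc i) zero    h = ∈⇒T-lookup h
  LAdj⇒adj (G ▹ S) (suc i) (suc j) h = LAdj⇒adj G i j h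

  adj-irrefl : ∀ {n} (G : LabelledGraph n) i → adj G i i ≡ false
  adj-irrefl (G ▹ S) zero    = refl
  adj-irrefl (G ▹ S) (suc i) = adj-irrefl G i

  adj-symm : ∀ {n} (G : LabelledGraph n) i j → adj G i j ≡ adj G j i
  adj-symm (G ▹ S) zero    zero    = refl
  adj-symm (G ▹ S) zero    (suc j) = refl
  adj-symm (G ▹ S) (suc i) zero    = refl
  adj-symm (G ▹ S) (suc i) (suc j) = adj-symm G i j

  T-not : ∀ {b} → T (not b) → b ≡ false
  T-not {false} _ = refl

  ¬T-not⇒T : ∀ {b} → ¬ T (not b) → T b
  ¬T-not⇒T {true}  _ = tt
  ¬T-not⇒T {false} h = ⊥-elim (h tt)

  -- Gives an induced subgraph a code on `Fin k` of its own, so that a property checked for all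
  -- codes on five vertices applies to any five vertices of a large graph.
  restrict : ∀ {k n} → LabelledGraph n → (Fin k → Fin n) → LabelledGraph k
  restrict {zero}  G ι = ∅
  restrict {suc k} G ι = restrict G (ι ∘ suc) ▹ tabulate (λ j → adj G (ι zero) (ι (suc j)))

  adj-restrict : ∀ {k n} (G : LabelledGraph n) (ι : Fin k → Fin n) i j →
                 adj (restrict G ι) i j ≡ adj G (ι i) (ι j)
  adj-restrict G ι zero    zero    = sym (adj-irrefl G (ι zero))
  adj-restrict G ι zero    (suc j) = VecP.lookup∘tabulate _ j
  adj-restrict G ι (suc i) zero    = trans (VecP.lookup∘tabulate _ i) (adj-symm G (ι zero) (ι (suc i)))
  adj-restrict G ι (suc i) (suc j) = adj-restrict G (ι ∘ suc) i j

  allSubsets : ∀ {n} → (Subset n → Bool) → Bool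
  allSubsets {zero}  f = f []
  allSubsets {suc n} f = allSubsets (f ∘ (true ∷_)) ∧ allSubsets (f ∘ (false ∷_))

  allSubsets⇒ : ∀ {n} {f : Subset n → Bool} → T (allSubsets f) → ∀ S → T (f S)
  allSubsets⇒ h []          = h
  allSubsets⇒ h (true ∷ S)  = allSubsets⇒ (proj₁ (Equivalence.to T-∧ h)) S
  allSubsets⇒ h (false ∷ S) = allSubsets⇒ (proj₂ (Equivalence.to T-∧ h)) S

  allGraphs : ∀ {n} → (LabelledGraph n → Bool) → Bool
  allGraphs {zero}  f = f ∅
  allGraphs {suc n} f = allGraphs λ G → allSubsets λ S → f (G ▹ S)

  allGraphs⇒ : ∀ {n} {f : LabelledGraph n → Bool} → T (allGraphs f) → ∀ G → T (f G)
  allGraphs⇒ h ∅       = h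
  allGraphs⇒ h (G ▹ S) = allSubsets⇒ (allGraphs⇒ h G) S

  -- Copies of a pattern in a relation on the vertices

  Edge : ℕ → Set
  Edge n = Fin n × Fin n

  Inj : ∀ {k n} → (Fin k → Fin n) → Set
  Inj ι = ∀ i j → ι i ≡ ι j → i ≡ j

  image : ∀ {k n} → (Fin k → Fin n) → List (Edge k) → List (Edge n)
  image ι = List.map (Product.map ι ι)

  Copy : ∀ {k n} → (Fin n → Fin n → Bool) → List (Edge k) → Set
  Copy {k} {n} r π = Σ[ ι ∈ (Fin k → Fin n) ] (Inj ι × All (T ∘ uncurry r) (image ι π))

  injective? : ∀ {k n} (v : Vec (Fin n) k) → Dec (Inj (lookup v))
  injective? v = FinP.all? λ i → FinP.all? λ j → (lookup v i FinP.≟ lookup v j) →-dec (i FinP.≟ j)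

  -- All maps from `Fin k` to `Fin n`, injective or not: the length is then exactly n^k, the number
  -- of terms in the union bound, and `isCopy` rejects the maps that are not injective.
  vecs : ∀ k n → List (Vec (Fin n) k)
  vecs zero    n = [] ∷ []
  vecs (suc k) n = cartesianProductWith _∷_ (List.allFin n) (vecs k n)

  ∈-vecs : ∀ {k n} (v : Vec (Fin n) k) → v List∈.∈ vecs k n
  ∈-vecs []      = here refl
  ∈-vecs (x ∷ v) = ∈-cartesianProductWith⁺ _∷_ (∈-allFin x) (∈-vecs v)

  length-cartesianProductWith : ∀ {A B C : Set} (f : A → B → C) xs ys →
    List.length (cartesianProductWith f xs ys) ≡ List.length xs ℕ.* List.length ys
  length-cartesianProductWith f []       ys = refl
  length-cartesianProductWith f (x ∷ xs) ys =
    trans (ListP.length-++ (List.map (f x) ys))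
      (cong₂ ℕ._+_ (ListP.length-map (f x) ys) (length-cartesianProductWith f xs ys))

  length-vecs : ∀ k n → List.length (vecs k n) ≡ n ℕ.^ k
  length-vecs zero    n = refl
  length-vecs (suc k) n = trans (length-cartesianProductWith _∷_ (List.allFin n) (vecs k n))
    (cong₂ ℕ._*_ (ListP.length-tabulate {n = n} (λ i → i)) (length-vecs k n))

  isCopy : ∀ {k n} → (Fin n → Fin n → Bool) → List (Edge k) → Vec (Fin n) k → Bool
  isCopy r π v = does (injective? v) ∧ all (uncurry r) (image (lookup v) π)

  occurs : ∀ {k n} → (Fin n → Fin n → Bool) → List (Edge k) → Bool
  occurs {k} {n} r π = any (isCopy r π) (vecs k n)

  copy⇒occurs : ∀ {k n} {r : Fin n → Fin n → Bool} {π : List (Edge k)} → Copy r π → T (occurs r π)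
  copy⇒occurs {r = r} {π} (ι , inj , edges) =
    AnyP.any⁺ (isCopy r π) (Any.map (λ { refl → Equivalence.from T-∧ (inj-v , edges-v) }) (∈-vecs v))
    where
    v = tabulate ι
    lk : ∀ i → lookup v i ≡ ι i
    lk = VecP.lookup∘tabulate ι
    inj-v : T (does (injective? v))
    inj-v = subst T (sym (dec-true (injective? v)
      (λ i j eq → inj i j (trans (sym (lk i)) (trans eq (lk j)))))) tt
    edges-v : T (all (uncurry r) (image (lookup v) π))
    edges-v = AllP.all⁻ (uncurry r) (AllP.map⁺ (All.map
      (λ {(i , j)} → subst T (sym (cong₂ r (lk i) (lk j)))) (AllP.map⁻ edges)))

  copy-restrict : ∀ {k m n} {r : Fin n → Fin n → Bool} {s : Fin m → Fin m → Bool} {π : List (Edge k)}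
                  (ι : Fin m → Fin n) → Inj ι → (∀ i j → s i j ≡ r (ι i) (ι j)) → Copy s π → Copy r π
  copy-restrict ι ι-inj s≡r (κ , κ-inj , edges) =
    ι ∘ κ , (λ i j eq → κ-inj i j (ι-inj _ _ eq)) ,
    AllP.map⁺ (All.map (λ {(i , j)} → subst T (s≡r (κ i) (κ j))) (AllP.map⁻ edges))

  -- Cycles in graphs on five vertices and in their complements

  triangle : List (Edge 3)
  triangle = (0F , 1F) ∷ (1F , 2F) ∷ (2F , 0F) ∷ []

  square : List (Edge 4)
  square = (0F , 1F) ∷ (1F , 2F) ∷ (2F , 3F) ∷ (3F , 0F) ∷ []

  pentagon : List (Edge 5)
  pentagon = (0F , 1F) ∷ (1F , 2F) ∷ (2F , 3F) ∷ (3F , 4F) ∷ (4F , 0F) ∷ []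

  -- One representative of each cycle up to rotation and reflection: 10 triangles, 15 squares and 12
  -- pentagons. These short lists replace `vecs` in the exhaustive check to keep its evaluation
  -- cheap.
  triangles₅ : List (Vec (Fin 5) 3)
  triangles₅ =
    (0F ∷ 1F ∷ 2F ∷ []) ∷ (0F ∷ 1F ∷ 3F ∷ []) ∷ (0F ∷ 1F ∷ 4F ∷ []) ∷ (0F ∷ 2F ∷ 3F ∷ []) ∷
    (0F ∷ 2F ∷ 4F ∷ []) ∷ (0F ∷ 3F ∷ 4F ∷ []) ∷ (1F ∷ 2F ∷ 3F ∷ []) ∷ (1F ∷ 2F ∷ 4F ∷ []) ∷
    (1F ∷ 3F ∷ 4F ∷ []) ∷ (2F ∷ 3F ∷ 4F ∷ []) ∷ []

  squares₅ : List (Vec (Fin 5) 4)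
  squares₅ =
    (0F ∷ 1F ∷ 2F ∷ 3F ∷ []) ∷ (0F ∷ 1F ∷ 3F ∷ 2F ∷ []) ∷ (0F ∷ 2F ∷ 1F ∷ 3F ∷ []) ∷
    (0F ∷ 1F ∷ 2F ∷ 4F ∷ []) ∷ (0F ∷ 1F ∷ 4F ∷ 2F ∷ []) ∷ (0F ∷ 2F ∷ 1F ∷ 4F ∷ []) ∷
    (0F ∷ 1F ∷ 3F ∷ 4F ∷ []) ∷ (0F ∷ 1F ∷ 4F ∷ 3F ∷ []) ∷ (0F ∷ 3F ∷ 1F ∷ 4F ∷ []) ∷
    (0F ∷ 2F ∷ 3F ∷ 4F ∷ []) ∷ (0F ∷ 2F ∷ 4F ∷ 3F ∷ []) ∷ (0F ∷ 3F ∷ 2F ∷ 4F ∷ []) ∷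
    (1F ∷ 2F ∷ 3F ∷ 4F ∷ []) ∷ (1F ∷ 2F ∷ 4F ∷ 3F ∷ []) ∷ (1F ∷ 3F ∷ 2F ∷ 4F ∷ []) ∷ []

  pentagons₅ : List (Vec (Fin 5) 5)
  pentagons₅ =
    (0F ∷ 1F ∷ 2F ∷ 3F ∷ 4F ∷ []) ∷ (0F ∷ 1F ∷ 2F ∷ 4F ∷ 3F ∷ []) ∷ (0F ∷ 1F ∷ 3F ∷ 2F ∷ 4F ∷ []) ∷
    (0F ∷ 1F ∷ 3F ∷ 4F ∷ 2F ∷ []) ∷ (0F ∷ 1F ∷ 4F ∷ 2F ∷ 3F ∷ []) ∷ (0F ∷ 1F ∷ 4F ∷ 3F ∷ 2F ∷ []) ∷
    (0F ∷ 2F ∷ 1F ∷ 3F ∷ 4F ∷ []) ∷ (0F ∷ 2F ∷ 1F ∷ 4F ∷ 3F ∷ []) ∷ (0F ∷ 2F ∷ 3F ∷ 1F ∷ 4F ∷ []) ∷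
    (0F ∷ 2F ∷ 4F ∷ 1F ∷ 3F ∷ []) ∷ (0F ∷ 3F ∷ 1F ∷ 2F ∷ 4F ∷ []) ∷ (0F ∷ 3F ∷ 2F ∷ 1F ∷ 4F ∷ []) ∷ []

  anyCopy : ∀ {k n} → List (Vec (Fin n) k) → (Fin n → Fin n → Bool) → List (Edge k) → Bool
  anyCopy vs r π = any (λ v → all (uncurry r) (image (lookup v) π)) vs

  anyCopy⇒copy : ∀ {k n} {vs : List (Vec (Fin n) k)} {r : Fin n → Fin n → Bool} {π : List (Edge k)} →
                 All (λ v → Inj (lookup v)) vs → T (anyCopy vs r π) → Copy r π
  anyCopy⇒copy {vs = vs} {r} {π} injs h = go injs (AnyP.any⁻ _ vs h)
    where
    go : ∀ {vs} → All (λ v → Inj (lookup v)) vs →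
         Any (λ v → T (all (uncurry r) (image (lookup v) π))) vs → Copy r π
    go {v ∷ _} (inj ∷ _)    (here edges) = lookup v , inj , AllP.all⁺ (uncurry r) _ edges
    go         (_   ∷ injs) (there h)    = go injs h

  -- True of every graph: the complement of a forest on five vertices contains a 4-cycle.
  cyclic : LabelledGraph 5 → Bool
  cyclic H = anyCopy squares₅ (adj H) square ∨ anyCopy triangles₅ (missing H) triangle
           ∨ anyCopy squares₅ (missing H) square ∨ anyCopy pentagons₅ (missing H) pentagon

  -- Evaluation over all 2^10 codes. By hand: if the complement is a forest, H has at least six
  -- edges; the only graph on five vertices with six or more edges and no 4-cycle is a pair of
  -- triangles sharing a vertex, and its complement is itself a 4-cycle with an isolated vertex.
  all-cyclic : ∀ H → T (cyclic H)
  all-cyclic = allGraphs⇒ {f = cyclic} tt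

  triangles₅-injective : All (λ v → Inj (lookup v)) triangles₅
  triangles₅-injective = from-yes (All.all? injective? triangles₅)

  squares₅-injective : All (λ v → Inj (lookup v)) squares₅
  squares₅-injective = from-yes (All.all? injective? squares₅)

  pentagons₅-injective : All (λ v → Inj (lookup v)) pentagons₅
  pentagons₅-injective = from-yes (All.all? injective? pentagons₅)

  CyclicComplement : ∀ {n} → LabelledGraph n → Set
  CyclicComplement G = Copy (missing G) triangle ⊎ Copy (missing G) square ⊎ Copy (missing G) pentagon

  T-∨⇒ : ∀ x {y} → T (x ∨ y) → T x ⊎ T y
  T-∨⇒ x = Equivalence.to (T-∨ {x})

  cyclic⇒ : ∀ H → Copy (adj H) square ⊎ CyclicComplement H
  cyclic⇒ H with T-∨⇒ (anyCopy squares₅ (adj H) square) (all-cyclic H)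
  ... | inj₁ h = inj₁ (anyCopy⇒copy squares₅-injective h)
  ... | inj₂ h with T-∨⇒ (anyCopy triangles₅ (missing H) triangle) h
  ...   | inj₁ h = inj₂ (inj₁ (anyCopy⇒copy triangles₅-injective h))
  ...   | inj₂ h with T-∨⇒ (anyCopy squares₅ (missing H) square) h
  ...     | inj₁ h = inj₂ (inj₂ (inj₁ (anyCopy⇒copy squares₅-injective h)))
  ...     | inj₂ h = inj₂ (inj₂ (inj₂ (anyCopy⇒copy pentagons₅-injective h)))

  five-vertices : ∀ {n} (G : LabelledGraph n) (ι : Fin 5 → Fin n) → Inj ι →
                  Copy (λ i j → adj G (ι i) (ι j)) square ⊎ CyclicComplement G
  five-vertices G ι inj with cyclic⇒ (restrict G ι)
  ... | inj₁ c = inj₁ (copy-restrict (λ i → i) (λ _ _ eq → eq) (adj-restrict G ι) c)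
  ... | inj₂ c = inj₂ (Sum.map up (Sum.map up up) c)
    where
    up : ∀ {k} {π : List (Edge k)} → Copy (missing (restrict G ι)) π → Copy (missing G) π
    up = copy-restrict ι inj (λ i j → cong not (adj-restrict G ι i j))

  -- Vertex subsets and injections

  record Enumeration {n} (W : Subset n) (k : ℕ) : Set where
    field
      ι   : Fin k → Fin n
      inj : Inj ι
      ι∈W : ∀ i → ι i ∈ W

  enumerate : ∀ {n} (W : Subset n) k → k ℕ.≤ Subset.∣ W ∣ → Enumeration W k
  enumerate W zero _ = record { ι = λ () ; inj = λ () ; ι∈W = λ () }
  enumerate (false ∷ W) k@(suc _) h = record
    { ι = suc ∘ ι ; inj = λ i j eq → inj i j (FinP.suc-injective eq) ; ι∈W = λ i → there (ι∈W i) }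
    where open Enumeration (enumerate W k h)
  enumerate {suc n} (true ∷ W) (suc k) (ℕ.s≤s h) = record { ι = ι′ ; inj = inj′ ; ι∈W = ι′∈W }
    where
    open Enumeration (enumerate W k h)
    ι′ : Fin (suc k) → Fin (suc n)
    ι′ zero    = zero
    ι′ (suc i) = suc (ι i)
    inj′ : Inj ι′
    inj′ zero    zero    _  = refl
    inj′ (suc i) (suc j) eq = cong suc (inj i j (FinP.suc-injective eq))
    ι′∈W : ∀ i → ι′ i ∈ true ∷ W
    ι′∈W zero    = here
    ι′∈W (suc i) = there (ι∈W i)

  ∣insert∣ : ∀ {n} (W : Subset n) x → ¬ x ∈ W → Subset.∣ W [ x ]≔ true ∣ ≡ suc Subset.∣ W ∣
  ∣insert∣ (true  ∷ W) zero    x∉W = ⊥-elim (x∉W here)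
  ∣insert∣ (false ∷ W) zero    x∉W = refl
  ∣insert∣ (true  ∷ W) (suc x) x∉W = cong suc (∣insert∣ W x (x∉W ∘ there))
  ∣insert∣ (false ∷ W) (suc x) x∉W = ∣insert∣ W x (x∉W ∘ there)

  ∈-insert⁻ : ∀ {n} (W : Subset n) {x y} → y ∈ W [ x ]≔ true → y ≡ x ⊎ y ∈ W
  ∈-insert⁻ (_ ∷ W) {zero}  {zero}  h         = inj₁ refl
  ∈-insert⁻ (_ ∷ W) {zero}  {suc y} (there h) = inj₂ (there h)
  ∈-insert⁻ (_ ∷ W) {suc x} {zero}  here      = inj₂ here
  ∈-insert⁻ (_ ∷ W) {suc x} {suc y} (there h) = Sum.map (cong suc) there (∈-insert⁻ W h)

  record Range {k n} (ι : Fin k → Fin n) : Set where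
    field
      W   : Subset n
      ∣W∣ : Subset.∣ W ∣ ≡ k
      ι∈W : ∀ i → ι i ∈ W
      ∈W⇒ : ∀ {u} → u ∈ W → ∃ λ i → ι i ≡ u

  range : ∀ {k n} (ι : Fin k → Fin n) → Inj ι → Range ι
  range {zero} {n} ι _ = record
    { W = Subset.⊥ ; ∣W∣ = SubsetP.∣⊥∣≡0 n ; ι∈W = λ () ; ∈W⇒ = λ h → ⊥-elim (SubsetP.∉⊥ h) }
  range {suc k} {n} ι inj = record
    { W   = W [ ι zero ]≔ true
    ; ∣W∣ = trans (∣insert∣ W (ι zero) new) (cong suc ∣W∣)
    ; ι∈W = λ { zero    → VecP.[]≔-updates W (ι zero)
              ; (suc i) → VecP.[]≔-minimal W (ι (suc i)) (ι zero)
                  (λ eq → case inj _ _ eq of λ ()) (ι∈W i) }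
    ; ∈W⇒ = λ h → [ (λ eq → zero , sym eq) , (λ h → let i , eq = ∈W⇒ h in suc i , eq) ]′ (∈-insert⁻ W h)
    }
    where
    open Range (range (ι ∘ suc) (λ i j eq → FinP.suc-injective (inj _ _ eq)))
    new : ¬ ι zero ∈ W
    new h = let i , eq = ∈W⇒ h in case inj _ _ eq of λ ()

  -- Missing edges at the newest vertex and cherries of the complement

  hasMissing twoMissing : ∀ {n} → Subset n → Bool
  hasMissing []          = false
  hasMissing (true ∷ S)  = hasMissing S
  hasMissing (false ∷ S) = true
  twoMissing []          = false
  twoMissing (true ∷ S)  = twoMissing S
  twoMissing (false ∷ S) = hasMissing S

  -- Only the cherries of the complement whose centre is newer than both leaves are
  -- counted: for distinct centres these are independent events.
  cherry : ∀ {n} → LabelledGraph n → Bool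
  cherry ∅       = false
  cherry (G ▹ S) = twoMissing S ∨ cherry G

  hasMissing⇒ : ∀ {n} (S : Subset n) → T (hasMissing S) → ∃ λ j → lookup S j ≡ false
  hasMissing⇒ (true ∷ S)  h = let j , eq = hasMissing⇒ S h in suc j , eq
  hasMissing⇒ (false ∷ S) _ = zero , refl

  twoMissing⇒ : ∀ {n} (S : Subset n) → T (twoMissing S) →
                ∃ λ i → ∃ λ j → i ≢ j × lookup S i ≡ false × lookup S j ≡ false
  twoMissing⇒ (true ∷ S)  h = let i , j , i≢j , eqs = twoMissing⇒ S h
                              in suc i , suc j , i≢j ∘ FinP.suc-injective , eqs
  twoMissing⇒ (false ∷ S) h = let j , eq = hasMissing⇒ S h in zero , suc j , (λ ()) , refl , eq

  record Cherry {n} (G : LabelledGraph n) : Set where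
    field
      a b c : Fin n
      a≢b   : a ≢ b
      a≢c   : a ≢ c
      b≢c   : b ≢ c
      ab    : adj G a b ≡ false
      ac    : adj G a c ≡ false

  cherry⇒ : ∀ {n} (G : LabelledGraph n) → T (cherry G) → Cherry G
  cherry⇒ (G ▹ S) h with Equivalence.to (T-∨ {twoMissing S}) h
  ... | inj₁ h = let i , j , i≢j , si , sj = twoMissing⇒ S h in record
    { a = zero ; b = suc i ; c = suc j ; a≢b = λ () ; a≢c = λ ()
    ; b≢c = i≢j ∘ FinP.suc-injective ; ab = si ; ac = sj }
  ... | inj₂ h = record
    { a = suc a ; b = suc b ; c = suc c ; a≢b = a≢b ∘ FinP.suc-injective
    ; a≢c = a≢c ∘ FinP.suc-injective ; b≢c = b≢c ∘ FinP.suc-injective ; ab = ab ; ac = ac }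
    where open Cherry (cherry⇒ G h)

-- A cubic lower bound for the number of triples

module Triples where
  open ℕSolver.+-*-Solver

  -- The binomial coefficients of n over 2 and over 3, by Pascal's rule.
  pairs triples : ℕ → ℕ
  pairs zero      = 0
  pairs (suc n)   = n ℕ.+ pairs n
  triples zero    = 0
  triples (suc n) = pairs n ℕ.+ triples n

  2*pairs : ∀ n → 2 ℕ.* pairs (suc n) ≡ suc n ℕ.* n
  2*pairs zero    = refl
  2*pairs (suc n) = trans (ℕP.*-distribˡ-+ 2 (suc n) (pairs (suc n)))
    (trans (cong (2 ℕ.* suc n ℕ.+_) (2*pairs n)) (lem n))
    where
    lem : ∀ n → 2 ℕ.* suc n ℕ.+ suc n ℕ.* n ≡ suc (suc n) ℕ.* suc n
    lem = solve-∀

  -- With n = 5 + k the right side is 4n(n - 1)(n - 2). The value n = 5 is the first from which it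
  -- dominates (n + 1)^3: there 216 ≤ 240, whereas 125 > 96 at n = 4.
  cube≤24*triples₅ : ∀ k → (6 ℕ.+ k) ℕ.^ 3 ℕ.≤ 24 ℕ.* triples (5 ℕ.+ k)
  cube≤24*triples₅ zero    = from-yes (216 ℕ.≤? 240)
  cube≤24*triples₅ (suc k) = begin
    (7 ℕ.+ k) ℕ.^ 3
      -- The added polynomial is the slack between the growth 12(5 + k)(4 + k) of the right side and
      -- the difference of consecutive cubes on the left.
      ≤⟨ ℕP.m≤m+n _ (9 ℕ.* (k ℕ.* k) ℕ.+ 69 ℕ.* k ℕ.+ 113) ⟩
    (7 ℕ.+ k) ℕ.^ 3 ℕ.+ (9 ℕ.* (k ℕ.* k) ℕ.+ 69 ℕ.* k ℕ.+ 113)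
      ≡⟨ lem k ⟩
    12 ℕ.* ((5 ℕ.+ k) ℕ.* (4 ℕ.+ k)) ℕ.+ (6 ℕ.+ k) ℕ.^ 3
      ≡⟨ cong (λ z → 12 ℕ.* z ℕ.+ (6 ℕ.+ k) ℕ.^ 3) (sym (2*pairs (4 ℕ.+ k))) ⟩
    12 ℕ.* (2 ℕ.* pairs (5 ℕ.+ k)) ℕ.+ (6 ℕ.+ k) ℕ.^ 3
      ≤⟨ ℕP.+-mono-≤ (ℕP.≤-reflexive (sym (ℕP.*-assoc 12 2 (pairs (5 ℕ.+ k))))) (cube≤24*triples₅ k) ⟩
    24 ℕ.* pairs (5 ℕ.+ k) ℕ.+ 24 ℕ.* triples (5 ℕ.+ k)
      ≡⟨ sym (ℕP.*-distribˡ-+ 24 (pairs (5 ℕ.+ k)) (triples (5 ℕ.+ k))) ⟩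
    24 ℕ.* triples (6 ℕ.+ k) ∎
    where
    open ℕP.≤-Reasoning
    lem : ∀ k → (7 ℕ.+ k) ℕ.^ 3 ℕ.+ (9 ℕ.* (k ℕ.* k) ℕ.+ 69 ℕ.* k ℕ.+ 113) ≡
                12 ℕ.* ((5 ℕ.+ k) ℕ.* (4 ℕ.+ k)) ℕ.+ (6 ℕ.+ k) ℕ.^ 3
    lem = solve 1 (λ k →
      (con 7 :+ k) :^ 3 :+ (con 9 :* (k :* k) :+ con 69 :* k :+ con 113) :=
      con 12 :* ((con 5 :+ k) :* (con 4 :+ k)) :+ (con 6 :+ k) :^ 3) refl

  cube≤24*triples : ∀ n → 5 ℕ.≤ n → suc n ℕ.^ 3 ℕ.≤ 24 ℕ.* triples n
  cube≤24*triples n 5≤n = subst (λ n → suc n ℕ.^ 3 ℕ.≤ 24 ℕ.* triples n) (ℕP.m+[n∸m]≡n 5≤n)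
    (cube≤24*triples₅ (n ℕ.∸ 5))

-- Expectations over random graphs with rational edge probabilities

module Expectation where
  open Triples
  open import Data.Rational using (_+_; _*_; _-_; _≤_; _<_; _/_)
  open ℚ-Lemmas
  open Combinatorics
  open +-*-Solver

  pow : ℚ → ℕ → ℚ
  pow x zero    = 1ℚ
  pow x (suc n) = x * pow x n

  ind : Bool → ℚ
  ind true  = 1ℚ
  ind false = 0ℚ

  0≤ind : ∀ b → 0ℚ ≤ ind b
  0≤ind true  = 0≤1
  0≤ind false = ℚP.≤-refl

  ind-∧ : ∀ a b → ind (a ∧ b) ≡ ind a * ind b
  ind-∧ true  b = sym (ℚP.*-identityˡ (ind b))
  ind-∧ false b = sym (ℚP.*-zeroˡ (ind b))

  ind-∨ : ∀ a b → ind (a ∨ b) ≤ ind a + ind b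
  ind-∨ true  b = p≤p+q (0≤ind b)
  ind-∨ false b = ℚP.≤-reflexive (sym (ℚP.+-identityˡ (ind b)))

  ind-not : ∀ b → ind (not b) + ind b ≡ 1ℚ
  ind-not true  = refl
  ind-not false = refl

  ind-not-∨ : ∀ a b → ind (not (a ∨ b)) ≡ ind (not b) * ind (not a)
  ind-not-∨ true  b = sym (ℚP.*-zeroʳ (ind (not b)))
  ind-not-∨ false b = sym (ℚP.*-identityʳ (ind (not b)))

  ind-mono : ∀ {a b} → (T a → T b) → ind a ≤ ind b
  ind-mono {false} {b}     _ = 0≤ind b
  ind-mono {true}  {true}  _ = ℚP.≤-refl
  ind-mono {true}  {false} h = ⊥-elim (h tt)

  module _ (p q : ℚ) where

    -- The expectation is integrated coordinate by coordinate along the code of the graph, with the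
    -- edges at the newest vertex innermost. Independence then becomes pulling constants out of an
    -- inner integral.
    𝔼ₛ : ∀ {n} → (Subset n → ℚ) → ℚ
    𝔼ₛ {zero}  f = f []
    𝔼ₛ {suc n} f = p * 𝔼ₛ (λ S → f (true ∷ S)) + q * 𝔼ₛ (λ S → f (false ∷ S))

    𝔼 : ∀ {n} → (LabelledGraph n → ℚ) → ℚ
    𝔼 {zero}  f = f ∅
    𝔼 {suc n} f = 𝔼 λ G → 𝔼ₛ λ S → f (G ▹ S)

    Pr : ∀ {n} → (LabelledGraph n → Bool) → ℚ
    Pr A = 𝔼 λ G → ind (A G)

  sum : ∀ {A : Set} → List A → (A → ℚ) → ℚ
  sum []       f = 0ℚ
  sum (x ∷ xs) f = f x + sum xs f

  module _ {A : Set} where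
    sum-cong : ∀ (xs : List A) {f g} → (∀ x → f x ≡ g x) → sum xs f ≡ sum xs g
    sum-cong []       h = refl
    sum-cong (x ∷ xs) h = cong₂ _+_ (h x) (sum-cong xs h)

    sum-* : ∀ (xs : List A) {f} c → sum xs (λ x → c * f x) ≡ c * sum xs f
    sum-* []           c = sym (ℚP.*-zeroʳ c)
    sum-* (x ∷ xs) {f} c = trans (cong (c * f x +_) (sum-* xs c)) (sym (ℚP.*-distribˡ-+ c (f x) (sum xs f)))

    sum-++ : ∀ (xs ys : List A) {f} → sum (xs List.++ ys) f ≡ sum xs f + sum ys f
    sum-++ []       ys {f} = sym (ℚP.+-identityˡ (sum ys f))
    sum-++ (x ∷ xs) ys {f} = trans (cong (f x +_) (sum-++ xs ys)) (sym (ℚP.+-assoc (f x) (sum xs f) (sum ys f)))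

    sum-map : ∀ {B : Set} (xs : List B) {g : B → A} {f} → sum (List.map g xs) f ≡ sum xs (λ x → f (g x))
    sum-map []              = refl
    sum-map (x ∷ xs) {g} {f} = cong (f (g x) +_) (sum-map xs)

    sum-cartesian : ∀ {B C : Set} (g : B → C → A) xs ys {f} →
      sum (cartesianProductWith g xs ys) f ≡ sum xs (λ x → sum ys (λ y → f (g x y)))
    sum-cartesian g []       ys     = refl
    sum-cartesian g (x ∷ xs) ys {f} = trans (sum-++ (List.map (g x) ys) _)
      (cong₂ _+_ (sum-map ys) (sum-cartesian g xs ys))

  module _ {p q : ℚ} where

    𝔼ₛ-cong : ∀ {n} {f g : Subset n → ℚ} → (∀ S → f S ≡ g S) → 𝔼ₛ p q f ≡ 𝔼ₛ p q g
    𝔼ₛ-cong {zero}  h = h []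
    𝔼ₛ-cong {suc n} h = cong₂ (λ a b → p * a + q * b)
      (𝔼ₛ-cong (λ S → h (true ∷ S))) (𝔼ₛ-cong (λ S → h (false ∷ S)))

    𝔼-cong : ∀ {n} {f g : LabelledGraph n → ℚ} → (∀ G → f G ≡ g G) → 𝔼 p q f ≡ 𝔼 p q g
    𝔼-cong {zero}  h = h ∅
    𝔼-cong {suc n} h = 𝔼-cong λ G → 𝔼ₛ-cong λ S → h (G ▹ S)

    𝔼ₛ-* : ∀ {n} c (f : Subset n → ℚ) → 𝔼ₛ p q (λ S → c * f S) ≡ c * 𝔼ₛ p q f
    𝔼ₛ-* {zero}  c f = refl
    𝔼ₛ-* {suc n} c f = trans
      (cong₂ (λ a b → p * a + q * b) (𝔼ₛ-* c (λ S → f (true ∷ S))) (𝔼ₛ-* c (λ S → f (false ∷ S))))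
      (solve 5 (λ p q c a b → p :* (c :* a) :+ q :* (c :* b) := c :* (p :* a :+ q :* b)) refl
        p q c (𝔼ₛ p q (λ S → f (true ∷ S))) (𝔼ₛ p q (λ S → f (false ∷ S))))

    𝔼-* : ∀ {n} c (f : LabelledGraph n → ℚ) → 𝔼 p q (λ G → c * f G) ≡ c * 𝔼 p q f
    𝔼-* {zero}  c f = refl
    𝔼-* {suc n} c f = trans (𝔼-cong λ G → 𝔼ₛ-* c (λ S → f (G ▹ S))) (𝔼-* {n} c _)

    𝔼ₛ-+ : ∀ {n} (f g : Subset n → ℚ) → 𝔼ₛ p q (λ S → f S + g S) ≡ 𝔼ₛ p q f + 𝔼ₛ p q g
    𝔼ₛ-+ {zero}  f g = refl
    𝔼ₛ-+ {suc n} f g = trans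
      (cong₂ (λ a b → p * a + q * b) (𝔼ₛ-+ (λ S → f (true ∷ S)) (λ S → g (true ∷ S)))
                                      (𝔼ₛ-+ (λ S → f (false ∷ S)) (λ S → g (false ∷ S))))
      (solve 6 (λ p q a b c d → p :* (a :+ b) :+ q :* (c :+ d) := (p :* a :+ q :* c) :+ (p :* b :+ q :* d)) refl
        p q (𝔼ₛ p q (λ S → f (true ∷ S))) (𝔼ₛ p q (λ S → g (true ∷ S)))
            (𝔼ₛ p q (λ S → f (false ∷ S))) (𝔼ₛ p q (λ S → g (false ∷ S))))

    𝔼-+ : ∀ {n} (f g : LabelledGraph n → ℚ) → 𝔼 p q (λ G → f G + g G) ≡ 𝔼 p q f + 𝔼 p q g
    𝔼-+ {zero}  f g = refl
    𝔼-+ {suc n} f g = trans (𝔼-cong λ G → 𝔼ₛ-+ (λ S → f (G ▹ S)) (λ S → g (G ▹ S))) (𝔼-+ {n} _ _)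

  subsetWeight : ℚ → ∀ {n} → Subset n → ℚ
  subsetWeight p []          = 1ℚ
  subsetWeight p (true ∷ S)  = p * subsetWeight p S
  subsetWeight p (false ∷ S) = (1ℚ - p) * subsetWeight p S

  graphWeight : ℚ → ∀ {n} → LabelledGraph n → ℚ
  graphWeight p ∅       = 1ℚ
  graphWeight p (G ▹ S) = graphWeight p G * subsetWeight p S

  sum-subsets : ∀ p {n} (f : Subset n → ℚ) →
                sum (subsets n) (λ S → subsetWeight p S * f S) ≡ 𝔼ₛ p (1ℚ - p) f
  sum-subsets p {zero}  f = trans (ℚP.+-identityʳ (1ℚ * f [])) (ℚP.*-identityˡ (f []))
  sum-subsets p {suc n} f = trans (sum-cartesian _∷_ (true ∷ false ∷ []) (subsets n))
    (cong₂ _+_ (branch true p λ _ → refl)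
      (trans (ℚP.+-identityʳ _) (branch false (1ℚ - p) λ _ → refl)))
    where
    branch : ∀ b c → (∀ S → subsetWeight p (b ∷ S) ≡ c * subsetWeight p S) →
             sum (subsets n) (λ S → subsetWeight p (b ∷ S) * f (b ∷ S)) ≡
             c * 𝔼ₛ p (1ℚ - p) (λ S → f (b ∷ S))
    branch b c h = trans
      (sum-cong (subsets n) λ S → trans (cong (_* f (b ∷ S)) (h S)) (ℚP.*-assoc c (subsetWeight p S) (f (b ∷ S))))
      (trans (sum-* (subsets n) c) (cong (c *_) (sum-subsets p (λ S → f (b ∷ S)))))

  sum-graphs : ∀ p {n} (f : LabelledGraph n → ℚ) →
               sum (graphs n) (λ G → graphWeight p G * f G) ≡ 𝔼 p (1ℚ - p) f
  sum-graphs p {zero}  f = trans (ℚP.+-identityʳ (1ℚ * f ∅)) (ℚP.*-identityˡ (f ∅))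
  sum-graphs p {suc n} f = trans (sum-cartesian _▹_ (graphs n) (subsets n)) (trans
    (sum-cong (graphs n) λ G → trans
      (sum-cong (subsets n) λ S → ℚP.*-assoc (graphWeight p G) (subsetWeight p S) (f (G ▹ S)))
      (trans (sum-* (subsets n) (graphWeight p G))
        (cong (graphWeight p G *_) (sum-subsets p (λ S → f (G ▹ S))))))
    (sum-graphs p (λ G → 𝔼ₛ p (1ℚ - p) (λ S → f (G ▹ S)))))

  seq-weight : ∀ x m {n} (G : LabelledGraph n) → seq (weight x G) m ≡ graphWeight (seq x m) G
  seq-weight x m ∅       = refl
  seq-weight x m (G ▹ S) = cong₂ _*_ (seq-weight x m G) (go S)
    where
    go : ∀ {n} (S : Subset n) →
         seq (Vec.foldr′ (λ e w → Defs.edgeWeight x e Defs.* w) Defs.1ℝ S) m ≡ subsetWeight (seq x m) S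
    go []          = refl
    go (true ∷ S)  = cong (seq x m *_) (go S)
    go (false ∷ S) = cong ((1ℚ - seq x m) *_) (go S)

  filterᵇ-∷ : ∀ {X : Set} (A : X → Bool) x xs →
              filterᵇ A (x ∷ xs) ≡ (if A x then x ∷ filterᵇ A xs else filterᵇ A xs)
  filterᵇ-∷ A x xs with A x
  ... | true  = refl
  ... | false = refl

  -- An equality at every index, not only in the limit, because sums and products of reals are
  -- termwise. It carries all rational estimates over to `ℙ`.
  seq-ℙ : ∀ x m {n} (A : LabelledGraph n → Bool) → seq (ℙ x A) m ≡ Pr (seq x m) (1ℚ - seq x m) A
  seq-ℙ x m {n} A = trans (go (graphs n)) (sum-graphs (seq x m) (λ G → ind (A G)))
    where
    total : List (LabelledGraph n) → ℝ
    total Gs = List.foldr Defs._+_ Defs.0ℝ (List.map (weight x) Gs)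
    go : ∀ Gs → seq (total (filterᵇ A Gs)) m ≡
                sum Gs (λ G → graphWeight (seq x m) G * ind (A G))
    go []       = refl
    go (G ∷ Gs) = trans (cong (λ Gs → seq (total Gs) m) (filterᵇ-∷ A G Gs)) (step (A G))
      where
      rest = sum Gs (λ G → graphWeight (seq x m) G * ind (A G))
      step : ∀ b → seq (total (if b then G ∷ filterᵇ A Gs else filterᵇ A Gs)) m ≡
                   graphWeight (seq x m) G * ind b + rest
      step true  = cong₂ _+_ (trans (seq-weight x m G) (sym (ℚP.*-identityʳ _))) (go Gs)
      step false = trans (go Gs) (sym (trans
        (cong (_+ rest) (ℚP.*-zeroʳ (graphWeight (seq x m) G))) (ℚP.+-identityˡ rest)))

  n/1-+ : ∀ m n → n/1 (m ℕ.+ n) ≡ n/1 m + n/1 n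
  n/1-+ zero    n = sym (ℚP.+-identityˡ (n/1 n))
  n/1-+ (suc m) n = trans (n/1-suc (m ℕ.+ n)) (trans (cong (1ℚ +_) (n/1-+ m n))
    (trans (sym (ℚP.+-assoc 1ℚ (n/1 m) (n/1 n))) (cong (_+ n/1 n) (sym (n/1-suc m)))))

  n/1-* : ∀ m n → n/1 (m ℕ.* n) ≡ n/1 m * n/1 n
  n/1-* zero    n = sym (ℚP.*-zeroˡ (n/1 n))
  n/1-* (suc m) n = trans (n/1-+ n (m ℕ.* n)) (trans (cong (n/1 n +_) (n/1-* m n))
    (trans (solve 2 (λ m n → n :+ m :* n := (con 1ℚ :+ m) :* n) refl (n/1 m) (n/1 n))
      (cong (_* n/1 n) (sym (n/1-suc m)))))

  n^k*pow : ∀ n k q → n/1 (n ℕ.^ k) * pow q k ≡ pow (n/1 n * q) k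
  n^k*pow n zero    q = refl
  n^k*pow n (suc k) q = trans (cong (_* (q * pow q k)) (n/1-* n (n ℕ.^ k)))
    (trans (solve 4 (λ n m q r → (n :* m) :* (q :* r) := (n :* q) :* (m :* r)) refl
      (n/1 n) (n/1 (n ℕ.^ k)) q (pow q k)) (cong (n/1 n * q *_) (n^k*pow n k q)))

  0≤pow : ∀ {x} n → 0ℚ ≤ x → 0ℚ ≤ pow x n
  0≤pow zero    h = 0≤1
  0≤pow (suc n) h = 0≤p*q h (0≤pow n h)

  pow-mono : ∀ {x y} n → 0ℚ ≤ x → x ≤ y → pow x n ≤ pow y n
  pow-mono zero    0≤x x≤y = ℚP.≤-refl
  pow-mono (suc n) 0≤x x≤y = *-mono-≤-nonNeg 0≤x (0≤pow n (ℚP.≤-trans 0≤x x≤y)) x≤y (pow-mono n 0≤x x≤y)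

  -- Distinct edges, and the two events to be estimated

  Same : ∀ {n} → Edge n → Edge n → Set
  Same (i , j) (k , l) = (i ≡ k × j ≡ l) ⊎ (i ≡ l × j ≡ k)

  same? : ∀ {n} (e e′ : Edge n) → Dec (Same e e′)
  same? (i , j) (k , l) = (i FinP.≟ k ×-dec j FinP.≟ l) ⊎-dec (i FinP.≟ l ×-dec j FinP.≟ k)

  -- What independence of the listed edges requires: they differ as unordered pairs, and none of
  -- them is a loop.
  Simple : ∀ {n} → List (Edge n) → Set
  Simple es = AllPairs (λ e e′ → ¬ Same e e′) es × All (λ (i , j) → i ≢ j) es

  simple? : ∀ {n} (es : List (Edge n)) → Dec (Simple es)
  simple? es = AllPairs.allPairs? (λ e e′ → ¬? (same? e e′)) es
       ×-dec All.all? (λ (i , j) → ¬? (i FinP.≟ j)) es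

  simple-image : ∀ {k n} {π : List (Edge k)} {ι : Fin k → Fin n} → Inj ι → Simple π → Simple (image ι π)
  simple-image inj (distinct , loopless) =
    AllPairsP.map⁺ (AllPairs.map (λ ¬s s → ¬s (Sum.map pull pull s)) distinct) ,
    AllP.map⁺ (All.map (λ i≢j eq → i≢j (inj _ _ eq)) loopless)
    where
    pull : ∀ {i j k l} → _ → i ≡ k × j ≡ l
    pull (e , e′) = inj _ _ e , inj _ _ e′

  -- Overwrites the status of one edge. That a quantity does not depend on an edge is expressed as
  -- invariance under this operation.
  set : ∀ {n} → LabelledGraph n → Edge n → Bool → LabelledGraph n
  set (G ▹ S) (zero  , zero)  b = G ▹ S
  set (G ▹ S) (zero  , suc j) b = G ▹ (S [ j ]≔ b)
  set (G ▹ S) (suc i , zero)  b = G ▹ (S [ i ]≔ b)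
  set (G ▹ S) (suc i , suc j) b = set G (i , j) b ▹ S

  adj-set : ∀ {n} (G : LabelledGraph n) e b k l → ¬ Same e (k , l) → adj (set G e b) k l ≡ adj G k l
  adj-set (G ▹ S) (zero  , zero)  b k       l       ¬s = refl
  adj-set (G ▹ S) (zero  , suc j) b zero    zero    ¬s = refl
  adj-set (G ▹ S) (zero  , suc j) b zero    (suc l) ¬s =
    VecP.lookup∘update′ (λ l≡j → ¬s (inj₁ (refl , cong suc (sym l≡j)))) S b
  adj-set (G ▹ S) (zero  , suc j) b (suc k) zero    ¬s =
    VecP.lookup∘update′ (λ k≡j → ¬s (inj₂ (refl , cong suc (sym k≡j)))) S b
  adj-set (G ▹ S) (zero  , suc j) b (suc k) (suc l) ¬s = refl
  adj-set (G ▹ S) (suc i , zero)  b zero    zero    ¬s = refl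
  adj-set (G ▹ S) (suc i , zero)  b zero    (suc l) ¬s =
    VecP.lookup∘update′ (λ l≡i → ¬s (inj₂ (cong suc (sym l≡i) , refl))) S b
  adj-set (G ▹ S) (suc i , zero)  b (suc k) zero    ¬s =
    VecP.lookup∘update′ (λ k≡i → ¬s (inj₁ (cong suc (sym k≡i) , refl))) S b
  adj-set (G ▹ S) (suc i , zero)  b (suc k) (suc l) ¬s = refl
  adj-set (G ▹ S) (suc i , suc j) b zero    zero    ¬s = refl
  adj-set (G ▹ S) (suc i , suc j) b zero    (suc l) ¬s = refl
  adj-set (G ▹ S) (suc i , suc j) b (suc k) zero    ¬s = refl
  adj-set (G ▹ S) (suc i , suc j) b (suc k) (suc l) ¬s =
    adj-set G (i , j) b k l λ s → ¬s (Sum.map both both s)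
    where
    both : ∀ {n} {i j k l : Fin n} → i ≡ k × j ≡ l → suc i ≡ suc k × suc j ≡ suc l
    both (e , e′) = cong suc e , cong suc e′

  -- The newest vertex is to be the hub of the kite, and its edges are independent of the rest.
  -- Excluding triangles of the complement makes the two leaves of a cherry adjacent in the graph.
  good : ∀ {n} → LabelledGraph n → Bool
  good ∅       = false
  good (G ▹ S) = not (hasMissing S) ∧ (not (occurs (missing G) triangle) ∧ cherry G)

  bad : ∀ {n} → LabelledGraph n → Bool
  bad G = occurs (missing G) triangle ∨ (occurs (missing G) square ∨ occurs (missing G) pentagon)

  -- Estimates for fixed rational p and q with p + q = 1

  module Model {p q : ℚ} (0≤p : 0ℚ ≤ p) (0≤q : 0ℚ ≤ q) (p+q≡1 : p + q ≡ 1ℚ) where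

    mix : ∀ c → p * c + q * c ≡ c
    mix c = trans (sym (ℚP.*-distribʳ-+ c p q)) (trans (cong (_* c) p+q≡1) (ℚP.*-identityˡ c))

    p≤1 : p ≤ 1ℚ
    p≤1 = subst (p ≤_) p+q≡1 (p≤p+q 0≤q)

    𝔼ₛ-const : ∀ {n} c → 𝔼ₛ p q {n} (λ _ → c) ≡ c
    𝔼ₛ-const {zero}  c = refl
    𝔼ₛ-const {suc n} c = trans (cong (λ z → p * z + q * z) (𝔼ₛ-const {n} c)) (mix c)

    𝔼-const : ∀ {n} c → 𝔼 p q {n} (λ _ → c) ≡ c
    𝔼-const {zero}  c = refl
    𝔼-const {suc n} c = trans (𝔼-cong {n = n} λ _ → 𝔼ₛ-const {n} c) (𝔼-const {n} c)

    𝔼ₛ-mono : ∀ {n} {f g : Subset n → ℚ} → (∀ S → f S ≤ g S) → 𝔼ₛ p q f ≤ 𝔼ₛ p q g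
    𝔼ₛ-mono {zero}  h = h []
    𝔼ₛ-mono {suc n} h = ℚP.+-mono-≤
      (ℚP.*-monoˡ-≤-nonNeg p {{nn 0≤p}} (𝔼ₛ-mono (λ S → h (true ∷ S))))
      (ℚP.*-monoˡ-≤-nonNeg q {{nn 0≤q}} (𝔼ₛ-mono (λ S → h (false ∷ S))))

    0≤𝔼ₛ : ∀ {n} {f : Subset n → ℚ} → (∀ S → 0ℚ ≤ f S) → 0ℚ ≤ 𝔼ₛ p q f
    0≤𝔼ₛ {n} {f} h = subst (_≤ 𝔼ₛ p q f) (𝔼ₛ-const {n} 0ℚ) (𝔼ₛ-mono h)

    pow≤1 : ∀ n → pow p n ≤ 1ℚ
    pow≤1 zero    = ℚP.≤-refl
    pow≤1 (suc n) = *-mono-≤-nonNeg 0≤p 0≤1 p≤1 (pow≤1 n)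

    𝔼-mono : ∀ {n} {f g : LabelledGraph n → ℚ} → (∀ G → f G ≤ g G) → 𝔼 p q f ≤ 𝔼 p q g
    𝔼-mono {zero}  h = h ∅
    𝔼-mono {suc n} h = 𝔼-mono λ G → 𝔼ₛ-mono λ S → h (G ▹ S)

    Pr-mono : ∀ {n} {A B : LabelledGraph n → Bool} → (∀ G → T (A G) → T (B G)) → Pr p q A ≤ Pr p q B
    Pr-mono h = 𝔼-mono λ G → ind-mono (h G)

    0≤Pr : ∀ {n} (A : LabelledGraph n → Bool) → 0ℚ ≤ Pr p q A
    0≤Pr {n} A = subst (_≤ Pr p q A) (𝔼-const {n} 0ℚ) (𝔼-mono λ G → 0≤ind (A G))

    Pr-∨ : ∀ {n} (A B : LabelledGraph n → Bool) → Pr p q (λ G → A G ∨ B G) ≤ Pr p q A + Pr p q B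
    Pr-∨ A B = ℚP.≤-trans (𝔼-mono λ G → ind-∨ (A G) (B G)) (ℚP.≤-reflexive (𝔼-+ (λ G → ind (A G)) (λ G → ind (B G))))

    union-bound : ∀ {n} {X : Set} (xs : List X) (A : X → LabelledGraph n → Bool) {b} →
                  (∀ x → Pr p q (A x) ≤ b) →
                  Pr p q (λ G → any (λ x → A x G) xs) ≤ n/1 (List.length xs) * b
    union-bound {n} []       A {b} h = ℚP.≤-reflexive (trans (𝔼-const {n} 0ℚ) (sym (ℚP.*-zeroˡ b)))
    union-bound     (x ∷ xs) A {b} h = begin
      Pr p q (λ G → A x G ∨ any (λ x → A x G) xs)   ≤⟨ Pr-∨ (A x) (λ G → any (λ x → A x G) xs) ⟩
      Pr p q (A x) + Pr p q (λ G → any (λ x → A x G) xs)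
                                                     ≤⟨ ℚP.+-mono-≤ (h x) (union-bound xs A h) ⟩
      b + n/1 (List.length xs) * b                   ≡⟨ solve 2 (λ b l → b :+ l :* b := (con 1ℚ :+ l) :* b) refl b (n/1 (List.length xs)) ⟩
      (1ℚ + n/1 (List.length xs)) * b                ≡⟨ cong (_* b) (sym (n/1-suc (List.length xs))) ⟩
      n/1 (suc (List.length xs)) * b                 ∎
      where open ℚP.≤-Reasoning

    𝔼ₛ-missing : ∀ {n} j {f : Subset n → ℚ} → (∀ S b → f (S [ j ]≔ b) ≡ f S) →
                 𝔼ₛ p q (λ S → ind (not (lookup S j)) * f S) ≡ q * 𝔼ₛ p q f
    𝔼ₛ-missing {suc n} zero {f} inv = begin
      p * 𝔼ₛ p q (λ S → 0ℚ * f (true ∷ S)) + q * 𝔼ₛ p q (λ S → 1ℚ * f (false ∷ S))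
        ≡⟨ cong₂ (λ a b → p * a + q * b) (𝔼ₛ-* 0ℚ (λ S → f (true ∷ S))) (𝔼ₛ-* 1ℚ (λ S → f (false ∷ S))) ⟩
      p * (0ℚ * a) + q * (1ℚ * b)
        ≡⟨ solve 4 (λ p q a b → p :* (con 0ℚ :* a) :+ q :* (con 1ℚ :* b) := q :* b) refl p q a b ⟩
      q * b
        -- Invariance makes the two branches `a` and `b` equal, so `b` is also their mixture, the
        -- full expectation.
        ≡⟨ cong (q *_) (sym (trans (cong (λ z → p * z + q * b) (𝔼ₛ-cong λ S → inv (false ∷ S) true)) (mix b))) ⟩
      q * (p * a + q * b) ∎
      where
      open ≡-Reasoning
      a = 𝔼ₛ p q (λ S → f (true ∷ S))
      b = 𝔼ₛ p q (λ S → f (false ∷ S))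
    𝔼ₛ-missing {suc n} (suc j) {f} inv = trans
      (cong₂ (λ a b → p * a + q * b) (𝔼ₛ-missing j (λ S b → inv (true ∷ S) b))
                                      (𝔼ₛ-missing j (λ S b → inv (false ∷ S) b)))
      (solve 4 (λ p q a b → p :* (q :* a) :+ q :* (q :* b) := q :* (p :* a :+ q :* b)) refl
        p q (𝔼ₛ p q (λ S → f (true ∷ S))) (𝔼ₛ p q (λ S → f (false ∷ S))))

    -- Independence of one edge from anything that ignores it. Following the code down to the entry
    -- that stores the edge reduces the claim to `𝔼ₛ-missing`.
    𝔼-missing : ∀ {n} i j → i ≢ j → {f : LabelledGraph n → ℚ} → (∀ G b → f (set G (i , j) b) ≡ f G) →
                𝔼 p q (λ G → ind (missing G i j) * f G) ≡ q * 𝔼 p q f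
    𝔼-missing {suc n} zero zero i≢j inv = ⊥-elim (i≢j refl)
    𝔼-missing {suc n} zero (suc j) i≢j inv =
      trans (𝔼-cong λ G → 𝔼ₛ-missing j λ S → inv (G ▹ S)) (𝔼-* {n = n} q _)
    𝔼-missing {suc n} (suc i) zero i≢j inv =
      trans (𝔼-cong λ G → 𝔼ₛ-missing i λ S → inv (G ▹ S)) (𝔼-* {n = n} q _)
    𝔼-missing {suc n} (suc i) (suc j) i≢j {f} inv =
      trans (𝔼-cong λ G → 𝔼ₛ-* (ind (missing G i j)) (λ S → f (G ▹ S)))
        (𝔼-missing i j (λ i≡j → i≢j (cong suc i≡j)) λ G b → 𝔼ₛ-cong λ S → inv (G ▹ S) b)

    Pr-missing : ∀ {n} {es : List (Edge n)} → Simple es →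
                 Pr p q (λ G → all (uncurry (missing G)) es) ≡ pow q (List.length es)
    Pr-missing {n} {[]} _ = 𝔼-const {n} 1ℚ
    Pr-missing {n} {(i , j) ∷ es} (e∉es ∷ distinct , i≢j ∷ loopless) = trans
      (𝔼-cong λ G → ind-∧ (missing G i j) (all (uncurry (missing G)) es))
      (trans (𝔼-missing i j i≢j {λ G → ind (all (uncurry (missing G)) es)} λ G b → cong ind (unchanged G b e∉es))
        (cong (q *_) (Pr-missing (distinct , loopless))))
      where
      unchanged : ∀ G b {es} → All (λ e → ¬ Same (i , j) e) es →
                  all (uncurry (missing (set G (i , j) b))) es ≡ all (uncurry (missing G)) es
      unchanged G b []        = refl
      unchanged G b (_∷_ {k , l} e≢ es) = cong₂ (λ x y → not x ∧ y) (adj-set G (i , j) b k l e≢) (unchanged G b es)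

    Pr-occurs : ∀ {k} n {π : List (Edge k)} → Simple π →
                Pr p q {n} (λ G → occurs (missing G) π) ≤ n/1 (n ℕ.^ k) * pow q (List.length π)
    Pr-occurs {k} n {π} simple = subst (λ l → Pr p q {n} (λ G → occurs (missing G) π) ≤ n/1 l * pow q (List.length π))
      (length-vecs k n) (union-bound (vecs k n) (λ v G → isCopy (missing G) π v) (λ v → one v (injective? v)))
      where
      -- The decision is generalised to a variable, so that matching on it simplifies the event; for
      -- a map that is not injective the event is empty.
      one : ∀ v (d : Dec (Inj (lookup v))) →
            Pr p q {n} (λ G → does d ∧ all (uncurry (missing G)) (image (lookup v) π)) ≤ pow q (List.length π)
      one v (yes inj) = ℚP.≤-reflexive (trans (Pr-missing (simple-image inj simple))
                          (cong (pow q) (ListP.length-map _ π)))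
      one v (no _)    = ℚP.≤-trans (ℚP.≤-reflexive (𝔼-const {n} 0ℚ)) (0≤pow (List.length π) 0≤q)

    𝔼ₛ-complement : ∀ {n} (A : Subset n → Bool) →
                    𝔼ₛ p q (λ S → ind (not (A S))) + 𝔼ₛ p q (λ S → ind (A S)) ≡ 1ℚ
    𝔼ₛ-complement {n} A = trans (sym (𝔼ₛ-+ (λ S → ind (not (A S))) (λ S → ind (A S))))
      (trans (𝔼ₛ-cong λ S → ind-not (A S)) (𝔼ₛ-const {n} 1ℚ))

    full≡pow : ∀ n → 𝔼ₛ p q {n} (λ S → ind (not (hasMissing S))) ≡ pow p n
    full≡pow zero    = refl
    full≡pow (suc n) = trans
      (cong₂ (λ a b → p * a + q * b) (full≡pow n) (𝔼ₛ-const {n} 0ℚ))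
      (trans (cong (p * pow p n +_) (ℚP.*-zeroʳ q)) (ℚP.+-identityʳ (p * pow p n)))

    -- The left side is at most n q p^(n - 1), the probability of exactly one missing element. The
    -- weaker exponent n is uniform and suits the induction.
    hasMissing-≥ : ∀ n → n/1 n * (q * pow p n) ≤ 𝔼ₛ p q {n} (λ S → ind (hasMissing S))
    hasMissing-≥ zero    = ℚP.≤-reflexive (ℚP.*-zeroˡ (q * 1ℚ))
    hasMissing-≥ (suc n) = begin
      n/1 (suc n) * (q * (p * P))          ≡⟨ cong (_* (q * (p * P))) (n/1-suc n) ⟩
      (1ℚ + n/1 n) * (q * (p * P))         ≡⟨ solve 4 (λ n q p P → (con 1ℚ :+ n) :* (q :* (p :* P)) :=
                                                p :* (n :* (q :* P)) :+ q :* (p :* P)) refl (n/1 n) q p P ⟩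
      p * (n/1 n * (q * P)) + q * (p * P)  ≤⟨ ℚP.+-mono-≤ (ℚP.*-monoˡ-≤-nonNeg p {{nn 0≤p}} (hasMissing-≥ n))
                                                (ℚP.*-monoˡ-≤-nonNeg q {{nn 0≤q}} (pow≤1 (suc n))) ⟩
      p * h + q * 1ℚ                       ≡⟨ cong (λ z → p * h + q * z) (sym (𝔼ₛ-const {n} 1ℚ)) ⟩
      𝔼ₛ p q {suc n} (λ S → ind (hasMissing S)) ∎
      where
      open ℚP.≤-Reasoning
      P = pow p n
      h = 𝔼ₛ p q {n} (λ S → ind (hasMissing S))

    -- Analogous, from exactly two missing elements. Splitting on the first entry, an edge leaves
    -- `twoMissing` of the rest, while a missing edge leaves `hasMissing`.
    twoMissing-≥ : ∀ n → pow p n * (q * q) * n/1 (pairs n) ≤ 𝔼ₛ p q {n} (λ S → ind (twoMissing S))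
    twoMissing-≥ zero    = ℚP.≤-reflexive (ℚP.*-zeroʳ (1ℚ * (q * q)))
    twoMissing-≥ (suc n) = begin
      p * P * (q * q) * n/1 (n ℕ.+ pairs n)
        ≡⟨ cong (p * P * (q * q) *_) (n/1-+ n (pairs n)) ⟩
      p * P * (q * q) * (n/1 n + n/1 (pairs n))
        ≡⟨ solve 5 (λ p P q n t → p :* P :* (q :* q) :* (n :+ t) :=
             p :* (P :* (q :* q) :* t) :+ p :* (q :* (n :* (q :* P)))) refl p P q (n/1 n) (n/1 (pairs n)) ⟩
      p * (P * (q * q) * n/1 (pairs n)) + p * (q * (n/1 n * (q * P)))
        ≤⟨ ℚP.+-mono-≤ (ℚP.*-monoˡ-≤-nonNeg p {{nn 0≤p}} (twoMissing-≥ n)) (begin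
             p * r    ≤⟨ ℚP.*-monoʳ-≤-nonNeg r {{nn 0≤r}} p≤1 ⟩
             1ℚ * r   ≡⟨ ℚP.*-identityˡ r ⟩
             r        ≤⟨ ℚP.*-monoˡ-≤-nonNeg q {{nn 0≤q}} (hasMissing-≥ n) ⟩
             q * 𝔼ₛ p q {n} (λ S → ind (hasMissing S)) ∎) ⟩
      𝔼ₛ p q {suc n} (λ S → ind (twoMissing S)) ∎
      where
      open ℚP.≤-Reasoning
      P = pow p n
      r = q * (n/1 n * (q * P))
      0≤r : 0ℚ ≤ r
      0≤r = 0≤p*q 0≤q (0≤p*q (0≤n/1 n) (0≤p*q 0≤q (0≤pow n 0≤p)))

    noCherry : ∀ n → ℚ
    noCherry n = Pr p q {n} (λ G → not (cherry G))

    -- The test at the newest vertex reads only the edges of that vertex, hence the product.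
    noCherry-suc : ∀ n → noCherry (suc n) ≡ 𝔼ₛ p q {n} (λ S → ind (not (twoMissing S))) * noCherry n
    noCherry-suc n = trans
      (𝔼-cong {n = n} λ G → trans (𝔼ₛ-cong {n = n} λ S → ind-not-∨ (twoMissing S) (cherry G))
        (trans (𝔼ₛ-* {n = n} (ind (not (cherry G))) (λ S → ind (not (twoMissing S)))) (ℚP.*-comm (ind (not (cherry G))) f)))
      (𝔼-* {n = n} f (λ G → ind (not (cherry G))))
      where f = 𝔼ₛ p q {n} (λ S → ind (not (twoMissing S)))

    -- From ∏ (1 − yᵢ) ≤ 1 / (1 + Σ yᵢ), where yᵢ is the probability that vertex i is the
    -- centre of a counted cherry.
    noCherry-≤ : ∀ n → noCherry n * (1ℚ + pow p n * (q * q) * n/1 (triples n)) ≤ 1ℚ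
    noCherry-≤ zero    = ℚP.≤-reflexive (trans (ℚP.*-identityˡ _) (trans (cong (1ℚ +_) (ℚP.*-zeroʳ (1ℚ * (q * q)))) (ℚP.+-identityʳ 1ℚ)))
    noCherry-≤ (suc n) = begin
      noCherry (suc n) * (1ℚ + p * P * (q * q) * n/1 (pairs n ℕ.+ triples n))
        ≡⟨ cong₂ (λ z t → z * (1ℚ + p * P * (q * q) * t)) (noCherry-suc n) (n/1-+ (pairs n) (triples n)) ⟩
      f * Z * (1ℚ + p * P * (q * q) * (s + t))
        ≤⟨ ℚP.*-monoˡ-≤-nonNeg (f * Z) {{nn 0≤fZ}} (ℚP.+-monoʳ-≤ 1ℚ shrink) ⟩
      f * Z * (1ℚ + (A + B))
        ≤⟨ ℚP.*-monoˡ-≤-nonNeg (f * Z) {{nn 0≤fZ}} (p≤p+q {1ℚ + (A + B)} {A * B} (0≤p*q 0≤A 0≤B)) ⟩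
      f * Z * (1ℚ + (A + B) + A * B)
        ≡⟨ solve 4 (λ f z a b → f :* z :* (con 1ℚ :+ (a :+ b) :+ a :* b) :=
             z :* (con 1ℚ :+ a) :* (f :* (con 1ℚ :+ b))) refl f Z A B ⟩
      Z * (1ℚ + A) * (f * (1ℚ + B))
        ≤⟨ ℚP.*-monoʳ-≤-nonNeg (f * (1ℚ + B)) {{nn (0≤p*q 0≤f (0≤p+q 0≤1 0≤B))}} (noCherry-≤ n) ⟩
      1ℚ * (f * (1ℚ + B))
        ≤⟨ ℚP.*-monoˡ-≤-nonNeg 1ℚ (ℚP.*-monoˡ-≤-nonNeg f {{nn 0≤f}} (ℚP.+-monoʳ-≤ 1ℚ (twoMissing-≥ n))) ⟩
      -- Since f + y = 1, the product f(1 + y) equals 1 - y^2, and adding y^2 gives exactly 1.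
      1ℚ * (f * (1ℚ + y))
        ≤⟨ p≤p+q {1ℚ * (f * (1ℚ + y))} {y * y} (0≤p*q 0≤y 0≤y) ⟩
      1ℚ * (f * (1ℚ + y)) + y * y
        ≡⟨ solve 2 (λ f y → con 1ℚ :* (f :* (con 1ℚ :+ y)) :+ y :* y := f :+ y :* (f :+ y)) refl f y ⟩
      f + y * (f + y)
        ≡⟨ cong (λ z → f + y * z) (𝔼ₛ-complement {n} twoMissing) ⟩
      f + y * 1ℚ
        ≡⟨ trans (cong (f +_) (ℚP.*-identityʳ y)) (𝔼ₛ-complement {n} twoMissing) ⟩
      1ℚ ∎
      where
      open ℚP.≤-Reasoning
      P = pow p n
      Z = noCherry n
      s = n/1 (pairs n)
      t = n/1 (triples n)
      f = 𝔼ₛ p q {n} (λ S → ind (not (twoMissing S)))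
      y = 𝔼ₛ p q {n} (λ S → ind (twoMissing S))
      A = P * (q * q) * t
      B = P * (q * q) * s
      0≤Pqq : 0ℚ ≤ P * (q * q)
      0≤Pqq = 0≤p*q (0≤pow n 0≤p) (0≤p*q 0≤q 0≤q)
      0≤A : 0ℚ ≤ A
      0≤A = 0≤p*q 0≤Pqq (0≤n/1 (triples n))
      0≤B : 0ℚ ≤ B
      0≤B = 0≤p*q 0≤Pqq (0≤n/1 (pairs n))
      0≤f : 0ℚ ≤ f
      0≤f = 0≤𝔼ₛ {n} (λ S → 0≤ind (not (twoMissing S)))
      0≤y : 0ℚ ≤ y
      0≤y = 0≤𝔼ₛ {n} (λ S → 0≤ind (twoMissing S))
      0≤fZ : 0ℚ ≤ f * Z
      0≤fZ = 0≤p*q 0≤f (0≤Pr {n} (λ G → not (cherry G)))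
      -- The bound uses one common power of p for all vertices. Adding a vertex only lowers this
      -- power, so the contribution of the older vertices can be kept at its former value.
      shrink : p * P * (q * q) * (s + t) ≤ A + B
      shrink = begin
        p * P * (q * q) * (s + t)
          ≡⟨ solve 5 (λ p P q s t → p :* P :* (q :* q) :* (s :+ t) :=
               p :* (P :* (q :* q) :* t :+ P :* (q :* q) :* s)) refl p P q s t ⟩
        p * (A + B)   ≤⟨ ℚP.*-monoʳ-≤-nonNeg (A + B) {{nn (0≤p+q 0≤A 0≤B)}} p≤1 ⟩
        1ℚ * (A + B)  ≡⟨ ℚP.*-identityˡ (A + B) ⟩
        A + B         ∎

    bernoulli : ∀ n → 1ℚ ≤ pow p n + n/1 n * q
    bernoulli zero    = p≤p+q {1ℚ} (ℚP.≤-reflexive (sym (ℚP.*-zeroˡ q)))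
    bernoulli (suc n) = begin
      1ℚ                                         ≡⟨ sym p+q≡1 ⟩
      p + q                                      ≡⟨ cong (_+ q) (sym (ℚP.*-identityʳ p)) ⟩
      p * 1ℚ + q                                 ≤⟨ ℚP.+-monoˡ-≤ q (ℚP.*-monoˡ-≤-nonNeg p {{nn 0≤p}} (bernoulli n)) ⟩
      p * (P + r) + q                            ≡⟨ cong (_+ q) (ℚP.*-distribˡ-+ p P r) ⟩
      p * P + p * r + q                          ≤⟨ ℚP.+-monoˡ-≤ q (ℚP.+-monoʳ-≤ (p * P)
                                                      (ℚP.≤-trans (ℚP.*-monoʳ-≤-nonNeg r {{nn (0≤p*q (0≤n/1 n) 0≤q)}} p≤1)
                                                        (ℚP.≤-reflexive (ℚP.*-identityˡ r)))) ⟩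
      p * P + r + q                              ≡⟨ solve 3 (λ a n q → a :+ n :* q :+ q := a :+ (con 1ℚ :+ n) :* q)
                                                      refl (p * P) (n/1 n) q ⟩
      p * P + (1ℚ + n/1 n) * q                   ≡⟨ cong (λ z → p * P + z * q) (sym (n/1-suc n)) ⟩
      p * P + n/1 (suc n) * q                    ∎
      where
      open ℚP.≤-Reasoning
      P = pow p n
      r = n/1 n * q

    -- A cycle has as many edges as vertices, so the n^k maps and the factor q^k combine to (nq)^k.
    Pr-cycle : ∀ {k n b} {π : List (Edge k)} → Simple π → List.length π ≡ k → n/1 n * q ≤ b →
               Pr p q {n} (λ G → occurs (missing G) π) ≤ pow b k
    Pr-cycle {k} {n} {b} {π} simple len nq≤b = begin
      Pr p q {n} (λ G → occurs (missing G) π)   ≤⟨ Pr-occurs n simple ⟩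
      n/1 (n ℕ.^ k) * pow q (List.length π)     ≡⟨ cong (λ l → n/1 (n ℕ.^ k) * pow q l) len ⟩
      n/1 (n ℕ.^ k) * pow q k                   ≡⟨ n^k*pow n k q ⟩
      pow (n/1 n * q) k                         ≤⟨ pow-mono k (0≤p*q (0≤n/1 n) 0≤q) nq≤b ⟩
      pow b k                                   ∎
      where open ℚP.≤-Reasoning

    Pr-bad : ∀ n → n/1 n * q ≤ ℤ.+ 1 / 8 → Pr p q {n} bad ≤ ℤ.+ 1 / 4
    Pr-bad n nq≤⅛ = begin
      Pr p q {n} bad
        ≤⟨ Pr-∨ {n} (λ G → occurs (missing G) triangle) (λ G → occurs (missing G) square ∨ occurs (missing G) pentagon) ⟩
      Pr p q {n} (λ G → occurs (missing G) triangle) +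
        Pr p q {n} (λ G → occurs (missing G) square ∨ occurs (missing G) pentagon)
        ≤⟨ ℚP.+-mono-≤ (Pr-cycle {n = n} (from-yes (simple? triangle)) refl nq≤⅛)
             (ℚP.≤-trans (Pr-∨ {n} (λ G → occurs (missing G) square) (λ G → occurs (missing G) pentagon)) (ℚP.+-mono-≤
               (Pr-cycle {n = n} (from-yes (simple? square)) refl nq≤⅛)
               (Pr-cycle {n = n} (from-yes (simple? pentagon)) refl nq≤⅛))) ⟩
      pow (ℤ.+ 1 / 8) 3 + (pow (ℤ.+ 1 / 8) 4 + pow (ℤ.+ 1 / 8) 5)
        ≤⟨ ℚP.≤ᵇ⇒≤ tt ⟩
      ℤ.+ 1 / 4 ∎
      where open ℚP.≤-Reasoning

    core : ∀ {n} → LabelledGraph n → Bool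
    core G = not (occurs (missing G) triangle) ∧ cherry G

    Pr-good≡ : ∀ n → Pr p q {suc n} good ≡ pow p n * Pr p q {n} core
    Pr-good≡ n = trans
      (𝔼-cong {n = n} λ G → trans
        (𝔼ₛ-cong {n = n} λ S → trans (ind-∧ (not (hasMissing S)) (core G)) (ℚP.*-comm (ind (not (hasMissing S))) (ind (core G))))
        (trans (𝔼ₛ-* {n = n} (ind (core G)) (λ S → ind (not (hasMissing S))))
          (trans (cong (ind (core G) *_) (full≡pow n)) (ℚP.*-comm (ind (core G)) (pow p n)))))
      (𝔼-* {n = n} (pow p n) (λ G → ind (core G)))

    -- Pointwise, either `core` holds or one of its two conditions fails: a complement triangle is
    -- present or the cherry is absent.
    core-≥ : ∀ n → 1ℚ ≤ Pr p q {n} core + (Pr p q {n} (λ G → occurs (missing G) triangle) + noCherry n)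
    core-≥ n = begin
      1ℚ                                                  ≡⟨ sym (𝔼-const {n} 1ℚ) ⟩
      𝔼 p q {n} (λ G → 1ℚ)                                ≤⟨ 𝔼-mono {n} (λ G → pointwise (occurs (missing G) triangle) (cherry G)) ⟩
      𝔼 p q {n} (λ G → ind (core G) + (ind (occurs (missing G) triangle) + ind (not (cherry G))))
                                                          ≡⟨ 𝔼-+ {n = n} _ _ ⟩
      Pr p q {n} core + 𝔼 p q {n} (λ G → ind (occurs (missing G) triangle) + ind (not (cherry G)))
                                                          ≡⟨ cong (Pr p q {n} core +_) (𝔼-+ {n = n} _ _) ⟩
      Pr p q {n} core + (Pr p q {n} (λ G → occurs (missing G) triangle) + noCherry n) ∎
      where
      open ℚP.≤-Reasoning
      pointwise : ∀ t c → 1ℚ ≤ ind (not t ∧ c) + (ind t + ind (not c))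
      pointwise true  true  = ℚP.≤ᵇ⇒≤ tt
      pointwise true  false = ℚP.≤ᵇ⇒≤ tt
      pointwise false true  = ℚP.≤ᵇ⇒≤ tt
      pointwise false false = ℚP.≤ᵇ⇒≤ tt

    remainder : ∀ {a b c} → 1ℚ ≤ a + b → b ≤ c → 1ℚ - c ≤ a
    remainder {a} {b} {c} 1≤a+b b≤c = p≤q+e⇒p-q≤e {1ℚ} {c} {a} (begin
      1ℚ     ≤⟨ 1≤a+b ⟩
      a + b  ≤⟨ ℚP.+-monoʳ-≤ a b≤c ⟩
      a + c  ≡⟨ ℚP.+-comm a c ⟩
      c + a  ∎)
      where open ℚP.≤-Reasoning

    ⅞≤pow : ∀ n → n/1 n * q ≤ ℤ.+ 1 / 8 → ℤ.+ 7 / 8 ≤ pow p n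
    ⅞≤pow n nq≤⅛ = remainder {pow p n} {n/1 n * q} {ℤ.+ 1 / 8} (bernoulli n) nq≤⅛

    pred*q≤ : ∀ n {c} → n/1 (suc n) * q ≤ c → n/1 n * q ≤ c
    pred*q≤ n = ℚP.≤-trans (ℚP.*-monoʳ-≤-nonNeg q {{nn 0≤q}} (n/1-mono (ℕP.n≤1+n n)))

    -- By `noCherry-≤` it suffices that p^n q^2 times the number of triples is at least 15. The
    -- hypothesis makes q^2 times that number at least 2304/24 = 96, and p^n ≥ 1/2 still leaves 48.
    noCherry-≤1/16 : ∀ n → 5 ℕ.≤ n → n/1 (suc n) * q ≤ ℤ.+ 1 / 8 →
                     ℤ.+ 2304 / 1 ≤ q * q * n/1 (suc n ℕ.^ 3) → noCherry n ≤ ℤ.+ 1 / 16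
    noCherry-≤1/16 N 5≤N nq≤⅛ 2304≤ = begin
      Z                             ≡⟨ solve 1 (λ z → z := con (ℤ.+ 1 / 16) :* (z :* con (ℤ.+ 16 / 1))) refl Z ⟩
      ℤ.+ 1 / 16 * (Z * (ℤ.+ 16 / 1))
                                    ≤⟨ ℚP.*-monoˡ-≤-nonNeg (ℤ.+ 1 / 16) (ℚP.≤-trans
                                         (ℚP.*-monoˡ-≤-nonNeg Z {{nn 0≤Z}} (ℚP.+-monoʳ-≤ 1ℚ 15≤)) (noCherry-≤ N)) ⟩
      ℤ.+ 1 / 16 * 1ℚ               ≡⟨⟩
      ℤ.+ 1 / 16                    ∎
      where
      open ℚP.≤-Reasoning
      P = pow p N
      Z = noCherry N
      t = n/1 (triples N)
      0≤qq : 0ℚ ≤ q * q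
      0≤qq = 0≤p*q 0≤q 0≤q
      0≤Z : 0ℚ ≤ Z
      0≤Z = 0≤Pr {N} (λ G → not (cherry G))
      ½≤P : ½ ≤ P
      ½≤P = ℚP.≤-trans (ℚP.≤ᵇ⇒≤ tt) (⅞≤pow N (pred*q≤ N nq≤⅛))
      15≤ : ℤ.+ 15 / 1 ≤ P * (q * q) * t
      15≤ = begin
        ℤ.+ 15 / 1                           ≤⟨ ℚP.≤ᵇ⇒≤ tt ⟩
        ½ * (ℤ.+ 1 / 24 * (ℤ.+ 2304 / 1))    ≤⟨ ℚP.*-monoˡ-≤-nonNeg ½ (ℚP.*-monoˡ-≤-nonNeg (ℤ.+ 1 / 24) (begin
          ℤ.+ 2304 / 1                         ≤⟨ 2304≤ ⟩
          q * q * n/1 (suc N ℕ.^ 3)             ≤⟨ ℚP.*-monoˡ-≤-nonNeg (q * q) {{nn 0≤qq}} (n/1-mono (cube≤24*triples N 5≤N)) ⟩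
          q * q * n/1 (24 ℕ.* triples N)       ≡⟨ cong (q * q *_) (n/1-* 24 (triples N)) ⟩
          q * q * (n/1 24 * t)                 ∎)) ⟩
        ½ * (ℤ.+ 1 / 24 * (q * q * (n/1 24 * t)))
                                             ≡⟨ solve 2 (λ q t → con ½ :* (con (ℤ.+ 1 / 24) :* (q :* q :* (con (ℤ.+ 24 / 1) :* t)))
                                                  := con ½ :* (q :* q :* t)) refl q t ⟩
        ½ * (q * q * t)                      ≤⟨ ℚP.*-monoʳ-≤-nonNeg (q * q * t) {{nn (0≤p*q 0≤qq (0≤n/1 (triples N)))}} ½≤P ⟩
        P * (q * q * t)                      ≡⟨ sym (ℚP.*-assoc P (q * q) t) ⟩
        P * (q * q) * t                      ∎

    ⅞≤core : ∀ n → n/1 n * q ≤ ℤ.+ 1 / 8 → noCherry n ≤ ℤ.+ 1 / 16 → ℤ.+ 7 / 8 ≤ Pr p q {n} core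
    ⅞≤core n nq≤⅛ Z≤ = remainder {Pr p q {n} core} {c = ℤ.+ 1 / 16 + ℤ.+ 1 / 16} (core-≥ n)
      (ℚP.+-mono-≤ (ℚP.≤-trans (Pr-cycle {n = n} (from-yes (simple? triangle)) refl nq≤⅛) cube≤1/16) Z≤)
      where
      cube≤1/16 : pow (ℤ.+ 1 / 8) 3 ≤ ℤ.+ 1 / 16
      cube≤1/16 = ℚP.≤ᵇ⇒≤ tt

    -- 49/64 against 48/64. One factor is the probability that the newest vertex is a hub, the other
    -- that of `core`, for which 1 - 1/16 - 1/16 remains.
    ¾≤* : ∀ {x y} → ℤ.+ 7 / 8 ≤ x → ℤ.+ 7 / 8 ≤ y → ℤ.+ 3 / 4 ≤ x * y
    ¾≤* {x} {y} ⅞≤x ⅞≤y = begin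
      ℤ.+ 3 / 4                   ≤⟨ ℚP.≤ᵇ⇒≤ tt ⟩
      ℤ.+ 7 / 8 * (ℤ.+ 7 / 8)     ≤⟨ ℚP.*-monoˡ-≤-nonNeg (ℤ.+ 7 / 8) ⅞≤y ⟩
      ℤ.+ 7 / 8 * y               ≤⟨ ℚP.*-monoʳ-≤-nonNeg y {{nn (ℚP.≤-trans (ℚP.≤ᵇ⇒≤ tt) ⅞≤y)}} ⅞≤x ⟩
      x * y                       ∎
      where open ℚP.≤-Reasoning

    ¾≤good : ∀ n → n/1 n * q ≤ ℤ.+ 1 / 8 → noCherry n ≤ ℤ.+ 1 / 16 → ℤ.+ 3 / 4 ≤ Pr p q {suc n} good
    ¾≤good n nq≤⅛ Z≤ = subst (ℤ.+ 3 / 4 ≤_) (sym (Pr-good≡ n)) (¾≤* (⅞≤pow n nq≤⅛) (⅞≤core n nq≤⅛ Z≤))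

    Pr-good : ∀ n → 5 ℕ.≤ n → n/1 (suc n) * q ≤ ℤ.+ 1 / 8 → ℤ.+ 2304 / 1 ≤ q * q * n/1 (suc n ℕ.^ 3) →
              ℤ.+ 3 / 4 ≤ Pr p q {suc n} good
    Pr-good n 5≤n nq≤⅛ 2304≤ = ¾≤good n (pred*q≤ n nq≤⅛) (noCherry-≤1/16 n 5≤n nq≤⅛ 2304≤)

open import Defs

-- Null sequences, square roots and maxima of Cauchy reals

module Reals where
  open ℚ-Lemmas
  open +-*-Solver
  open Cauchy using (bounded; bisect; width; bisect-correct; module Bisected)

  infixl 5 _and_
  _and_ : ∀ {P Q : ℕ → Set} → Eventually P → Eventually Q → Eventually (λ n → P n × Q n)
  (M , f) and (N , g) = M ℕ.⊔ N , λ n h → f n (ℕP.m⊔n≤o⇒m≤o M N h) , g n (ℕP.m⊔n≤o⇒n≤o M N h)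

  eventually : ∀ {P Q : ℕ → Set} → (∀ n → P n → Q n) → Eventually P → Eventually Q
  eventually f (N , h) = N , λ n N≤n → f n (h n N≤n)

  ⟨_⟩-contradiction : ∀ {P : ℕ → Set} → (∀ n → P n → ⊥) → Eventually P → ⊥
  ⟨ f ⟩-contradiction (N , h) = f N (h N ℕP.≤-refl)

  0≤x² : ∀ x → 0ℚ ℚ.≤ x ℚ.* x
  0≤x² x with ℚP.≤-total 0ℚ x
  ... | inj₁ 0≤x = 0≤p*q 0≤x 0≤x
  ... | inj₂ x≤0 = subst (0ℚ ℚ.≤_) (solve 1 (λ x → (:- x) :* (:- x) := x :* x) refl x)
                     (0≤p*q (ℚP.neg-antimono-≤ x≤0) (ℚP.neg-antimono-≤ x≤0))

  -- Subadditivity of the square root, stated without roots: an error e^2 in a square costs at most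
  -- e after taking roots.
  x²≤c²+e² : ∀ {x c e} → 0ℚ ℚ.≤ c → 0ℚ ℚ.≤ e → x ℚ.* x ℚ.≤ c ℚ.* c ℚ.+ e ℚ.* e → x ℚ.≤ c ℚ.+ e
  x²≤c²+e² {x} {c} {e} 0≤c 0≤e h = ℚP.≮⇒≥ λ c+e<x → ℚP.<-irrefl {x ℚ.* x} refl (begin-strict
    x ℚ.* x                                       ≤⟨ h ⟩
    c ℚ.* c ℚ.+ e ℚ.* e                           ≤⟨ p≤p+q {c ℚ.* c ℚ.+ e ℚ.* e} (0≤p+q (0≤p*q 0≤c 0≤e) (0≤p*q 0≤c 0≤e)) ⟩
    c ℚ.* c ℚ.+ e ℚ.* e ℚ.+ (c ℚ.* e ℚ.+ c ℚ.* e) ≡⟨ solve 2 (λ c e → c :* c :+ e :* e :+ (c :* e :+ c :* e) :=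
                                                       (c :+ e) :* (c :+ e)) refl c e ⟩
    (c ℚ.+ e) ℚ.* (c ℚ.+ e)                       ≤⟨ ℚP.*-monoˡ-≤-nonNeg (c ℚ.+ e) {{nn (0≤p+q 0≤c 0≤e)}} (ℚP.<⇒≤ c+e<x) ⟩
    (c ℚ.+ e) ℚ.* x                               <⟨ ℚP.*-monoˡ-<-pos x {{ℚ.positive (ℚP.≤-<-trans (0≤p+q 0≤c 0≤e) c+e<x)}} c+e<x ⟩
    x ℚ.* x                                       ∎)
    where open ℚP.≤-Reasoning

  -- x ≈ y unfolds to Null (x - y).
  Null : ℝ → Set
  Null x = ∀ ε → 0ℚ ℚ.< ε → Eventually (λ n → ℚ.∣ seq x n ∣ ℚ.≤ ε)

  null-≗ : ∀ {x y} → (∀ n → seq x n ≡ seq y n) → Null x → Null y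
  null-≗ eq h ε 0<ε = eventually (λ n → subst (λ z → ℚ.∣ z ∣ ℚ.≤ ε) (eq n)) (h ε 0<ε)

  null-+ : ∀ {x y} → Null x → Null y → Null (x + y)
  null-+ {x} {y} hx hy ε 0<ε = eventually
    (λ n (a , b) → ℚP.≤-trans (ℚP.∣p+q∣≤∣p∣+∣q∣ (seq x n) (seq y n))
      (subst (ℚ.∣ seq x n ∣ ℚ.+ ℚ.∣ seq y n ∣ ℚ.≤_) (½e+½e≡e ε) (ℚP.+-mono-≤ a b)))
    (hx (½ ℚ.* ε) (½*-pos 0<ε) and hy (½ ℚ.* ε) (½*-pos 0<ε))

  null-* : ∀ x {y} → Null y → Null (x * y)
  null-* x {y} hy ε 0<ε =
    let K , 0<K , hK = bounded x
        δ , 0<δ , Kδ≡ε = divide {K} 0<K 0<ε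
    in eventually (λ n (a , b) → subst₂ ℚ._≤_ (sym (ℚP.∣p*q∣≡∣p∣*∣q∣ (seq x n) (seq y n))) Kδ≡ε
         (*-mono-≤-nonNeg (ℚP.0≤∣p∣ (seq x n)) (ℚP.<⇒≤ 0<δ) a b))
       (hK and hy δ 0<δ)

  null-neg : ∀ {x} → Null x → Null (- x)
  null-neg {x} hx ε 0<ε = eventually (λ n → subst (ℚ._≤ ε) (sym (ℚP.∣-p∣≡∣p∣ (seq x n)))) (hx ε 0<ε)

  null-sub : ∀ {x y} → Null x → Null y → Null (x - y)
  null-sub {x} {y} hx hy = null-+ {x} {(- y)} hx (null-neg {y} hy)

  null-≤ : ∀ {x y} → (∀ n → 0ℚ ℚ.≤ seq x n) → (∀ n → seq x n ℚ.≤ seq y n) → Null y → Null x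
  null-≤ {x} {y} 0≤x x≤y hy ε 0<ε = eventually (λ n h → begin
    ℚ.∣ seq x n ∣  ≡⟨ ℚP.0≤p⇒∣p∣≡p (0≤x n) ⟩
    seq x n        ≤⟨ x≤y n ⟩
    seq y n        ≤⟨ p≤∣p∣ (seq y n) ⟩
    ℚ.∣ seq y n ∣  ≤⟨ h ⟩
    ε              ∎) (hy ε 0<ε)
    where open ℚP.≤-Reasoning

  null-square : ∀ {x} → Null (x * x) → Null x
  null-square {x} h ε 0<ε = eventually (λ n xx≤εε → let a = ℚ.∣ seq x n ∣ in
    ℚP.≤-trans (x²≤c²+e² {a} {0ℚ} {ε} ℚP.≤-refl (ℚP.<⇒≤ 0<ε)
      (ℚP.≤-trans (ℚP.≤-reflexive (sym (ℚP.∣p*q∣≡∣p∣*∣q∣ (seq x n) (seq x n))))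
        (ℚP.≤-trans xx≤εε (ℚP.≤-reflexive (sym (ℚP.+-identityˡ (ε ℚ.* ε)))))))
      (ℚP.≤-reflexive (ℚP.+-identityˡ ε)))
    (h (ε ℚ.* ε) (0<p*q 0<ε 0<ε))

  -- A vanishing product of reals does not constructively yield a disjunction, but the negation of
  -- one alternative suffices. Beyond a Cauchy modulus N for ε/4, one rational comparison at N
  -- decides whether all later values of x are at most ε or all are at least ε/4 in absolute value.
  -- In the latter case, cancelling the factor ε/4 would make y null.
  null-product : ∀ {x y} → Null (x * y) → ¬ Null y → Null x
  null-product {x} {y} hxy ¬hy ε 0<ε = go
    where
    open ℚP.≤-Reasoning
    e = ½ ℚ.* ε
    d = ½ ℚ.* e
    0<d : 0ℚ ℚ.< d
    0<d = ½*-pos {e} (½*-pos {ε} 0<ε)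
    N = proj₁ (cauchy x d 0<d)
    close : ∀ m n → N ℕ.≤ m → N ℕ.≤ n → ℚ.∣ seq x m ∣ ℚ.≤ ℚ.∣ seq x n ∣ ℚ.+ d
    close m n N≤m N≤n = begin
      ℚ.∣ seq x m ∣
        ≡⟨ cong ℚ.∣_∣ (solve 2 (λ a b → a := b :+ (a :- b)) refl (seq x m) (seq x n)) ⟩
      ℚ.∣ seq x n ℚ.+ (seq x m ℚ.- seq x n) ∣
        ≤⟨ ℚP.∣p+q∣≤∣p∣+∣q∣ (seq x n) (seq x m ℚ.- seq x n) ⟩
      ℚ.∣ seq x n ∣ ℚ.+ ℚ.∣ seq x m ℚ.- seq x n ∣
        ≤⟨ ℚP.+-monoʳ-≤ ℚ.∣ seq x n ∣ (proj₂ (cauchy x d 0<d) m n N≤m N≤n) ⟩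
      ℚ.∣ seq x n ∣ ℚ.+ d ∎
    go : Eventually (λ n → ℚ.∣ seq x n ∣ ℚ.≤ ε)
    go with ℚ.∣ seq x N ∣ ℚ.≤? e
    ... | yes small = N , λ n N≤n → begin
      ℚ.∣ seq x n ∣       ≤⟨ close n N N≤n ℕP.≤-refl ⟩
      ℚ.∣ seq x N ∣ ℚ.+ d ≤⟨ ℚP.+-mono-≤ small (p≤p+q {d} (ℚP.<⇒≤ 0<d)) ⟩
      e ℚ.+ (d ℚ.+ d)     ≡⟨ trans (cong (e ℚ.+_) (½e+½e≡e e)) (½e+½e≡e ε) ⟩
      ε                   ∎
    ... | no large = ⊥-elim (¬hy λ η 0<η → eventually
      (λ n (N≤n , h) → ℚP.*-cancelˡ-≤-pos d {{ℚ.positive 0<d}} (begin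
        d ℚ.* ℚ.∣ seq y n ∣               ≤⟨ ℚP.*-monoʳ-≤-nonNeg ℚ.∣ seq y n ∣ {{nn (ℚP.0≤∣p∣ (seq y n))}} (away n N≤n) ⟩
        ℚ.∣ seq x n ∣ ℚ.* ℚ.∣ seq y n ∣   ≡⟨ sym (ℚP.∣p*q∣≡∣p∣*∣q∣ (seq x n) (seq y n)) ⟩
        ℚ.∣ seq x n ℚ.* seq y n ∣         ≤⟨ h ⟩
        d ℚ.* η                           ∎))
      ((N , λ n N≤n → N≤n) and hxy (d ℚ.* η) (0<p*q 0<d 0<η)))
      where
      away : ∀ n → N ℕ.≤ n → d ℚ.≤ ℚ.∣ seq x n ∣
      away n N≤n = ℚP.≮⇒≥ λ small → large (begin
        ℚ.∣ seq x N ∣        ≤⟨ close N n ℕP.≤-refl N≤n ⟩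
        ℚ.∣ seq x n ∣ ℚ.+ d  ≤⟨ ℚP.+-monoˡ-≤ d (ℚP.<⇒≤ small) ⟩
        d ℚ.+ d              ≡⟨ ½e+½e≡e e ⟩
        e                    ∎)

  -- Bisection places the truncated argument between l^2 and (l + w)^2. The gap (2l + w)w tends to
  -- 0, because l is bounded and w is a bounded multiple of `½^ n`.
  null-√² : ∀ x → Null ((0ℝ ⊔ x) - √ x * √ x)
  null-√² x ε 0<ε =
    let K , 0<K , hK = bounded (0ℝ ⊔ x)
        L , 0<L , hL = bounded (√ x)
        0≤K+1 = 0≤p+q {K} {1ℚ} (ℚP.<⇒≤ 0<K) 0≤1
        M = L ℚ.+ L ℚ.+ (K ℚ.+ 1ℚ)
        0≤M = 0≤p+q {L ℚ.+ L} {K ℚ.+ 1ℚ} (0≤p+q {L} {L} (ℚP.<⇒≤ 0<L) (ℚP.<⇒≤ 0<L)) 0≤K+1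
    in eventually (λ n ((a≤K , l≤L) , small) → step n K L (ℚP.<⇒≤ 0<K) 0≤M a≤K l≤L small)
         ((hK and hL) and K*½^n→0 {M ℚ.* (K ℚ.+ 1ℚ)} {ε} (0≤p*q {M} {K ℚ.+ 1ℚ} 0≤M 0≤K+1) 0<ε)
    where
    step : ∀ n K L → 0ℚ ℚ.≤ K → 0ℚ ℚ.≤ L ℚ.+ L ℚ.+ (K ℚ.+ 1ℚ) → ℚ.∣ 0ℚ ℚ.⊔ seq x n ∣ ℚ.≤ K → ℚ.∣ seq (√ x) n ∣ ℚ.≤ L →
           (L ℚ.+ L ℚ.+ (K ℚ.+ 1ℚ)) ℚ.* (K ℚ.+ 1ℚ) ℚ.* ½^ n ℚ.≤ ε →
           ℚ.∣ (0ℚ ℚ.⊔ seq x n) ℚ.- seq (√ x) n ℚ.* seq (√ x) n ∣ ℚ.≤ ε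
    step n K L 0≤K 0≤M a≤K l≤L small = ℚP.≤-trans
      (p≤q+e∧q≤p+e⇒∣p-q∣≤e {a} {l ℚ.* l} {M ℚ.* ((K ℚ.+ 1ℚ) ℚ.* ½^ n)} (begin
        a                                     ≤⟨ ℚP.<⇒≤ B.a<l+w² ⟩
        (l ℚ.+ w) ℚ.* (l ℚ.+ w)               ≡⟨ solve 2 (λ l w → (l :+ w) :* (l :+ w) :=
                                                   l :* l :+ (l :+ l :+ w) :* w) refl l w ⟩
        l ℚ.* l ℚ.+ (l ℚ.+ l ℚ.+ w) ℚ.* w     ≤⟨ ℚP.+-monoʳ-≤ (l ℚ.* l) (*-mono-≤-nonNeg
                                                   (0≤p+q (0≤p+q B.0≤l B.0≤l) 0≤w) 0≤w′
                                                   (ℚP.+-mono-≤ (ℚP.+-mono-≤ l≤ l≤) (ℚP.≤-trans w≤ w′≤)) w≤) ⟩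
        l ℚ.* l ℚ.+ M ℚ.* w′                  ∎)
        (ℚP.≤-trans B.l²≤a (p≤p+q {a} (0≤p*q 0≤M 0≤w′))))
      (subst (ℚ._≤ ε) (ℚP.*-assoc M (K ℚ.+ 1ℚ) (½^ n)) small)
      where
      open ℚP.≤-Reasoning
      a = 0ℚ ℚ.⊔ seq x n
      l = bisect a n
      w = width a n
      w′ = (K ℚ.+ 1ℚ) ℚ.* ½^ n
      M = L ℚ.+ L ℚ.+ (K ℚ.+ 1ℚ)
      0≤a : 0ℚ ℚ.≤ a
      0≤a = ℚP.p≤p⊔q 0ℚ (seq x n)
      module B = Bisected (bisect-correct {a} n 0≤a)
      0≤w : 0ℚ ℚ.≤ w
      0≤w = Cauchy.0≤width {a} n 0≤a
      0≤K+1 : 0ℚ ℚ.≤ K ℚ.+ 1ℚ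
      0≤K+1 = 0≤p+q 0≤K 0≤1
      0≤w′ : 0ℚ ℚ.≤ w′
      0≤w′ = 0≤p*q 0≤K+1 (0≤½^n n)
      l≤ : l ℚ.≤ L
      l≤ = ℚP.≤-trans (p≤∣p∣ l) l≤L
      w≤ : w ℚ.≤ w′
      w≤ = ℚP.*-monoʳ-≤-nonNeg (½^ n) {{nn (0≤½^n n)}} (ℚP.+-monoˡ-≤ 1ℚ (ℚP.≤-trans (p≤∣p∣ a) a≤K))
      ½^n≤1 : ½^ n ℚ.≤ 1ℚ
      ½^n≤1 = begin
        ½^ n                          ≡⟨ sym (ℚP.*-identityˡ (½^ n)) ⟩
        1ℚ ℚ.* ½^ n                   ≤⟨ ℚP.*-monoʳ-≤-nonNeg (½^ n) {{nn (0≤½^n n)}} (p≤p+q {1ℚ} (0≤n/1 n)) ⟩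
        (1ℚ ℚ.+ n/1 n) ℚ.* ½^ n       ≤⟨ [1+n]*½^n≤1 n ⟩
        1ℚ                            ∎
      w′≤ : w′ ℚ.≤ K ℚ.+ 1ℚ
      w′≤ = ℚP.≤-trans (ℚP.*-monoˡ-≤-nonNeg (K ℚ.+ 1ℚ) {{nn 0≤K+1}} ½^n≤1) (ℚP.≤-reflexive (ℚP.*-identityʳ (K ℚ.+ 1ℚ)))

  0≤√ : ∀ x n → 0ℚ ℚ.≤ seq (√ x) n
  0≤√ x n = Bisected.0≤l (bisect-correct {0ℚ ℚ.⊔ seq x n} n (ℚP.p≤p⊔q 0ℚ (seq x n)))

  √-≤ : ∀ {x} c → 0ℚ ℚ.≤ c → x ≤ fromℚ (c ℚ.* c) → √ x ≤ fromℚ c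
  √-≤ {x} c 0≤c h ε 0<ε = eventually
    (λ n x≤ → x²≤c²+e² 0≤c (ℚP.<⇒≤ 0<ε) (ℚP.≤-trans
      (Bisected.l²≤a (bisect-correct {0ℚ ℚ.⊔ seq x n} n (ℚP.p≤p⊔q 0ℚ (seq x n))))
      (ℚP.⊔-lub (0≤p+q (0≤x² c) (0≤x² ε)) x≤)))
    (h (ε ℚ.* ε) (0<p*q 0<ε 0<ε))

  ≤-√ : ∀ {x} c → fromℚ (c ℚ.* c) ≤ x → fromℚ c ≤ √ x
  ≤-√ {x} c h ε 0<ε = eventually
    (λ n (c²≤ , near) → x²≤c²+e² (0≤√ x n) (ℚP.<⇒≤ 0<ε) (begin
      c ℚ.* c                                             ≤⟨ c²≤ ⟩
      seq x n ℚ.+ ½ ℚ.* (ε ℚ.* ε)                         ≤⟨ ℚP.+-monoˡ-≤ (½ ℚ.* (ε ℚ.* ε)) (ℚP.≤-trans (ℚP.p≤q⊔p 0ℚ (seq x n))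
                                                               (∣p-q∣≤e⇒p≤q+e {0ℚ ℚ.⊔ seq x n} {seq (√ x) n ℚ.* seq (√ x) n} near)) ⟩
      seq (√ x) n ℚ.* seq (√ x) n ℚ.+ ½ ℚ.* (ε ℚ.* ε) ℚ.+ ½ ℚ.* (ε ℚ.* ε)
                                                          ≡⟨ trans (ℚP.+-assoc (seq (√ x) n ℚ.* seq (√ x) n) _ _)
                                                               (cong (seq (√ x) n ℚ.* seq (√ x) n ℚ.+_) (½e+½e≡e (ε ℚ.* ε))) ⟩
      seq (√ x) n ℚ.* seq (√ x) n ℚ.+ ε ℚ.* ε             ∎))
    (h (½ ℚ.* (ε ℚ.* ε)) (½*-pos (0<p*q 0<ε 0<ε)) and null-√² x (½ ℚ.* (ε ℚ.* ε)) (½*-pos (0<p*q 0<ε 0<ε)))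
    where open ℚP.≤-Reasoning

  ≤-max : ∀ {k} (v : Vector ℝ k) i n → seq (v i) n ℚ.≤ seq (max v) n
  ≤-max v zero    n = ℚP.p≤p⊔q (seq (v zero) n) _
  ≤-max v (suc i) n = ℚP.≤-trans (≤-max (λ j → v (suc j)) i n) (ℚP.p≤q⊔p (seq (v zero) n) _)

  max-lub : ∀ {k} (v : Vector ℝ k) {y} → 0ℝ ≤ y → (∀ i → v i ≤ y) → max v ≤ y
  max-lub {zero}  v 0≤y h = 0≤y
  max-lub {suc k} v {y} 0≤y h ε 0<ε = eventually (λ n (a , b) → ℚP.⊔-lub a b)
    (h zero ε 0<ε and max-lub (λ i → v (suc i)) {y} 0≤y (λ i → h (suc i)) ε 0<ε)

  -- Valid at every index, not just up to ε, since maxima are termwise. Squares of distances can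
  -- then be compared index by index.
  dist≤diam : ∀ {d k} (x : Vector (Point d) k) i j n → seq (dist (x i) (x j)) n ℚ.≤ seq (diam x) n
  dist≤diam x i j n = ℚP.≤-trans (≤-max (λ j → dist (x i) (x j)) j n) (≤-max (λ i → max (λ j → dist (x i) (x j))) i n)

-- No 4-cycle in a diameter graph of the plane

module FourCycle where
  open ℚ-Lemmas
  open +-*-Solver
  open Reals

  0≤q-p : ∀ {p q} → p ℚ.≤ q → 0ℚ ℚ.≤ q ℚ.- p
  0≤q-p {p} {q} p≤q = subst (ℚ._≤ q ℚ.- p) (ℚP.+-inverseʳ p) (ℚP.+-monoˡ-≤ (ℚ.- p) p≤q)

  -- The trailing `0ℝ` makes `dist x y` definitionally equal to `√ (sqDist x y)`.
  sqDist : Point 2 → Point 2 → ℝ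
  sqDist x y = (x 0F - y 0F) * (x 0F - y 0F) + ((x 1F - y 1F) * (x 1F - y 1F) + 0ℝ)

  0≤sqDist : ∀ x y n → 0ℚ ℚ.≤ seq (sqDist x y) n
  0≤sqDist x y n = 0≤p+q (0≤x² (seq (x 0F) n ℚ.- seq (y 0F) n))
    (0≤p+q (0≤x² (seq (x 1F) n ℚ.- seq (y 1F) n)) ℚP.≤-refl)

  null-sqDist⇒≈ : ∀ x y → Null (sqDist x y) → x ≈ᵖ y
  null-sqDist⇒≈ x y h 0F = null-square {x 0F - y 0F} (null-≤ {(x 0F - y 0F) * (x 0F - y 0F)} {sqDist x y}
    (λ n → 0≤x² (seq (x 0F) n ℚ.- seq (y 0F) n))
    (λ n → p≤p+q (0≤p+q (0≤x² (seq (x 1F) n ℚ.- seq (y 1F) n)) ℚP.≤-refl)) h)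
  null-sqDist⇒≈ x y h 1F = null-square {x 1F - y 1F} (null-≤ {(x 1F - y 1F) * (x 1F - y 1F)} {sqDist x y}
    (λ n → 0≤x² (seq (x 1F) n ℚ.- seq (y 1F) n))
    (λ n → let a = seq (x 0F) n ℚ.- seq (y 0F) n ; b = seq (x 1F) n ℚ.- seq (y 1F) n in
      ℚP.≤-trans (p≤p+q {b ℚ.* b} (0≤x² a))
        (ℚP.≤-reflexive (solve 2 (λ a b → b :* b :+ a :* a := a :* a :+ (b :* b :+ con 0ℚ)) refl a b))) h)

  null-dist² : ∀ x y → Null (sqDist x y - dist x y * dist x y)
  null-dist² x y = null-≗ {(0ℝ ⊔ sqDist x y) - dist x y * dist x y} {sqDist x y - dist x y * dist x y}
    (λ n → cong (ℚ._- seq (dist x y) n ℚ.* seq (dist x y) n) (ℚP.p≤q⇒p⊔q≡q (0≤sqDist x y n)))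
    (null-√² (sqDist x y))

  null-sqDist-D² : ∀ x y D → dist x y ≈ D → Null (sqDist x y - D * D)
  null-sqDist-D² x y D h = null-≗ {(sqDist x y - l * l) + (l + D) * (l - D)} {sqDist x y - D * D}
    (λ n → solve 3 (λ s l d → (s :- l :* l) :+ (l :+ d) :* (l :- d) := s :- d :* d) refl
      (seq (sqDist x y) n) (seq l n) (seq D n))
    (null-+ {sqDist x y - l * l} {(l + D) * (l - D)} (null-dist² x y) (null-* (l + D) {l - D} h))
    where l = dist x y

  module _ (a d b e : Point 2) (D : ℝ)
           (ad : dist a d ≈ D) (db : dist d b ≈ D) (be : dist b e ≈ D) (ea : dist e a ≈ D)
           (ab : ∀ n → seq (dist a b) n ℚ.≤ seq D n) (de : ∀ n → seq (dist d e) n ℚ.≤ seq D n) where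

    -- In the 4-cycle a, d, b, e the vectors u and w are the diagonals, and s is twice the vector
    -- between their midpoints; X, Y, Z are the squared lengths of u, w, s. The null sequences n₁ to
    -- n₄ record that the sides have length D, and n₅, n₆ are the errors of the approximate roots at
    -- the diagonals.
    D² X Y Z n₁ n₂ n₃ n₄ n₅ n₆ u₀ u₁ w₀ w₁ s₀ s₁ u·w u·s w·s two : ℝ
    D² = D * D
    X = sqDist a b
    Y = sqDist d e
    n₁ = sqDist a d - D²
    n₂ = sqDist e a - D²
    n₃ = sqDist d b - D²
    n₄ = sqDist b e - D²
    n₅ = X - dist a b * dist a b
    n₆ = Y - dist d e * dist d e
    u₀ = a 0F - b 0F
    u₁ = a 1F - b 1F
    w₀ = d 0F - e 0F
    w₁ = d 1F - e 1F
    s₀ = (a 0F + b 0F) - (d 0F + e 0F)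
    s₁ = (a 1F + b 1F) - (d 1F + e 1F)
    Z = s₀ * s₀ + s₁ * s₁
    u·w = u₀ * w₀ + u₁ * w₁
    u·s = u₀ * s₀ + u₁ * s₁
    w·s = w₀ * s₀ + w₁ * s₁
    two = fromℚ (ℤ.+ 2 ℚ./ 1)

    null₁ : Null n₁
    null₁ = null-sqDist-D² a d D ad
    null₂ : Null n₂
    null₂ = null-sqDist-D² e a D ea
    null₃ : Null n₃
    null₃ = null-sqDist-D² d b D db
    null₄ : Null n₄
    null₄ = null-sqDist-D² b e D be

    -- A signed sum of the four squared sides, with two plus and two minus signs, is 2 u·w, and the
    -- terms D² cancel. The other two ways of pairing the signs give u·s and w·s.
    null-u·w : Null u·w
    null-u·w = null-≗ {½ℝ * ((n₃ - n₁) - (n₄ - n₂))} {u·w}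
      (λ n → solve 9 (λ a₀ a₁ b₀ b₁ d₀ d₁ e₀ e₁ D →
        let sq x₀ x₁ y₀ y₁ = (x₀ :- y₀) :* (x₀ :- y₀) :+ ((x₁ :- y₁) :* (x₁ :- y₁) :+ con 0ℚ) in
        con ½ :* (((sq d₀ d₁ b₀ b₁ :- D :* D) :- (sq a₀ a₁ d₀ d₁ :- D :* D)) :-
                  ((sq b₀ b₁ e₀ e₁ :- D :* D) :- (sq e₀ e₁ a₀ a₁ :- D :* D)))
        := (a₀ :- b₀) :* (d₀ :- e₀) :+ (a₁ :- b₁) :* (d₁ :- e₁)) refl
        (seq (a 0F) n) (seq (a 1F) n) (seq (b 0F) n) (seq (b 1F) n)
        (seq (d 0F) n) (seq (d 1F) n) (seq (e 0F) n) (seq (e 1F) n) (seq D n))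
      (null-* ½ℝ {(n₃ - n₁) - (n₄ - n₂)} (null-sub {n₃ - n₁} {n₄ - n₂} (null-sub {n₃} {n₁} null₃ null₁) (null-sub {n₄} {n₂} null₄ null₂)))

    null-u·s : Null u·s
    null-u·s = null-≗ {½ℝ * ((n₁ - n₃) + (n₂ - n₄))} {u·s}
      (λ n → solve 9 (λ a₀ a₁ b₀ b₁ d₀ d₁ e₀ e₁ D →
        let sq x₀ x₁ y₀ y₁ = (x₀ :- y₀) :* (x₀ :- y₀) :+ ((x₁ :- y₁) :* (x₁ :- y₁) :+ con 0ℚ) in
        con ½ :* (((sq a₀ a₁ d₀ d₁ :- D :* D) :- (sq d₀ d₁ b₀ b₁ :- D :* D)) :+
                  ((sq e₀ e₁ a₀ a₁ :- D :* D) :- (sq b₀ b₁ e₀ e₁ :- D :* D)))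
        := (a₀ :- b₀) :* ((a₀ :+ b₀) :- (d₀ :+ e₀)) :+ (a₁ :- b₁) :* ((a₁ :+ b₁) :- (d₁ :+ e₁))) refl
        (seq (a 0F) n) (seq (a 1F) n) (seq (b 0F) n) (seq (b 1F) n)
        (seq (d 0F) n) (seq (d 1F) n) (seq (e 0F) n) (seq (e 1F) n) (seq D n))
      (null-* ½ℝ {(n₁ - n₃) + (n₂ - n₄)} (null-+ {n₁ - n₃} {n₂ - n₄} (null-sub {n₁} {n₃} null₁ null₃) (null-sub {n₂} {n₄} null₂ null₄)))

    null-w·s : Null w·s
    null-w·s = null-≗ {½ℝ * ((n₂ - n₁) + (n₄ - n₃))} {w·s}
      (λ n → solve 9 (λ a₀ a₁ b₀ b₁ d₀ d₁ e₀ e₁ D →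
        let sq x₀ x₁ y₀ y₁ = (x₀ :- y₀) :* (x₀ :- y₀) :+ ((x₁ :- y₁) :* (x₁ :- y₁) :+ con 0ℚ) in
        con ½ :* (((sq e₀ e₁ a₀ a₁ :- D :* D) :- (sq a₀ a₁ d₀ d₁ :- D :* D)) :+
                  ((sq b₀ b₁ e₀ e₁ :- D :* D) :- (sq d₀ d₁ b₀ b₁ :- D :* D)))
        := (d₀ :- e₀) :* ((a₀ :+ b₀) :- (d₀ :+ e₀)) :+ (d₁ :- e₁) :* ((a₁ :+ b₁) :- (d₁ :+ e₁))) refl
        (seq (a 0F) n) (seq (a 1F) n) (seq (b 0F) n) (seq (b 1F) n)
        (seq (d 0F) n) (seq (d 1F) n) (seq (e 0F) n) (seq (e 1F) n) (seq D n))
      (null-* ½ℝ {(n₂ - n₁) + (n₄ - n₃)} (null-+ {n₂ - n₁} {n₄ - n₃} (null-sub {n₂} {n₁} null₂ null₁) (null-sub {n₄} {n₃} null₄ null₃)))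

    -- The Gram determinant of the vectors b − a, e − d and a + b − d − e of the plane is 0.
    null-XYZ : Null (X * Y * Z)
    null-XYZ = null-≗ {((u·w * Z) * u·w + (u·s * Y) * u·s) + ((w·s * X) * w·s - (two * (u·s * w·s)) * u·w)} {X * Y * Z}
      (λ n →
        solve 6 (λ u₀ u₁ w₀ w₁ s₀ s₁ →
          let u·w = u₀ :* w₀ :+ u₁ :* w₁
              u·s = u₀ :* s₀ :+ u₁ :* s₁
              w·s = w₀ :* s₀ :+ w₁ :* s₁
              uu = u₀ :* u₀ :+ (u₁ :* u₁ :+ con 0ℚ)
              ww = w₀ :* w₀ :+ (w₁ :* w₁ :+ con 0ℚ)
              ss = s₀ :* s₀ :+ s₁ :* s₁ in
          ((u·w :* ss) :* u·w :+ (u·s :* ww) :* u·s) :+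
          ((w·s :* uu) :* w·s :- (con (ℤ.+ 2 ℚ./ 1) :* (u·s :* w·s)) :* u·w) := uu :* ww :* ss) refl
          (seq u₀ n) (seq u₁ n) (seq w₀ n) (seq w₁ n) (seq s₀ n) (seq s₁ n))
      (null-+ {(u·w * Z) * u·w + (u·s * Y) * u·s} {(w·s * X) * w·s - (two * (u·s * w·s)) * u·w}
        (null-+ {(u·w * Z) * u·w} {(u·s * Y) * u·s} (null-* (u·w * Z) {u·w} null-u·w) (null-* (u·s * Y) {u·s} null-u·s))
        (null-sub {(w·s * X) * w·s} {(two * (u·s * w·s)) * u·w} (null-* (w·s * X) {w·s} null-w·s) (null-* (two * (u·s * w·s)) {u·w} null-u·w)))

    lab² lde² : ℝ
    lab² = dist a b * dist a b
    lde² = dist d e * dist d e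

    square-mono : ∀ {x y} → 0ℚ ℚ.≤ x → x ℚ.≤ y → x ℚ.* x ℚ.≤ y ℚ.* y
    square-mono {x} {y} 0≤x x≤y = *-mono-≤-nonNeg 0≤x (ℚP.≤-trans 0≤x x≤y) x≤y x≤y

    lab²≤D² : ∀ n → seq lab² n ℚ.≤ seq D² n
    lab²≤D² n = square-mono (0≤√ X n) (ab n)
    lde²≤D² : ∀ n → seq lde² n ℚ.≤ seq D² n
    lde²≤D² n = square-mono (0≤√ Y n) (de n)

    null-rest : Null (n₅ + n₆ - ((n₁ + n₂) + (n₃ + n₄)))
    null-rest = null-sub {n₅ + n₆} {(n₁ + n₂) + (n₃ + n₄)}
      (null-+ {n₅} {n₆} (null-dist² a b) (null-dist² d e))
      (null-+ {n₁ + n₂} {n₃ + n₄} (null-+ {n₁} {n₂} null₁ null₂) (null-+ {n₃} {n₄} null₃ null₄))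

    -- |a − b|² + |d − e|² + |a + b − d − e|² is the sum of the squares of the four sides.
    D²≤Z : ∀ n → seq D² n ℚ.≤ seq (Z + (n₅ + n₆ - ((n₁ + n₂) + (n₃ + n₄)))) n
    D²≤Z n = begin
      D²ₙ                                                    ≤⟨ p≤p+q {D²ₙ} (0≤p+q (0≤p+q 0≤D² 0≤ab) 0≤de) ⟩
      D²ₙ ℚ.+ (D²ₙ ℚ.+ (D²ₙ ℚ.- seq lab² n) ℚ.+ (D²ₙ ℚ.- seq lde² n))
        ≡⟨ solve 11 (λ a₀ a₁ b₀ b₁ d₀ d₁ e₀ e₁ D l m →
             let sq x₀ x₁ y₀ y₁ = (x₀ :- y₀) :* (x₀ :- y₀) :+ ((x₁ :- y₁) :* (x₁ :- y₁) :+ con 0ℚ)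
                 s₀ = (a₀ :+ b₀) :- (d₀ :+ e₀)
                 s₁ = (a₁ :+ b₁) :- (d₁ :+ e₁) in
             D :* D :+ (D :* D :+ (D :* D :- l :* l) :+ (D :* D :- m :* m)) :=
             (s₀ :* s₀ :+ s₁ :* s₁) :+
             ((sq a₀ a₁ b₀ b₁ :- l :* l) :+ (sq d₀ d₁ e₀ e₁ :- m :* m) :-
              (((sq a₀ a₁ d₀ d₁ :- D :* D) :+ (sq e₀ e₁ a₀ a₁ :- D :* D)) :+
               ((sq d₀ d₁ b₀ b₁ :- D :* D) :+ (sq b₀ b₁ e₀ e₁ :- D :* D))))) refl
             (seq (a 0F) n) (seq (a 1F) n) (seq (b 0F) n) (seq (b 1F) n)
             (seq (d 0F) n) (seq (d 1F) n) (seq (e 0F) n) (seq (e 1F) n) (seq D n)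
             (seq (dist a b) n) (seq (dist d e) n) ⟩
      seq (Z + (n₅ + n₆ - ((n₁ + n₂) + (n₃ + n₄)))) n        ∎
      where
      open ℚP.≤-Reasoning
      D²ₙ = seq D² n
      0≤D² : 0ℚ ℚ.≤ D²ₙ
      0≤D² = 0≤x² (seq D n)
      0≤ab : 0ℚ ℚ.≤ D²ₙ ℚ.- seq lab² n
      0≤ab = 0≤q-p (lab²≤D² n)
      0≤de : 0ℚ ℚ.≤ D²ₙ ℚ.- seq lde² n
      0≤de = 0≤q-p (lde²≤D² n)

    -- Z exceeds D² up to a null term, because the diagonals are no longer than D. Hence D² can
    -- replace Z in the vanishing product.
    null-XYD² : Null (X * Y * D²)
    null-XYD² = null-≤ {X * Y * D²} {X * Y * (Z + rest)}
      (λ n → 0≤p*q (0≤XY n) (0≤x² (seq D n)))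
      (λ n → ℚP.*-monoˡ-≤-nonNeg (seq (X * Y) n) {{nn (0≤XY n)}} (D²≤Z n))
      (null-≗ {X * Y * Z + X * Y * rest} {X * Y * (Z + rest)}
        (λ n → sym (ℚP.*-distribˡ-+ (seq (X * Y) n) (seq Z n) (seq rest n)))
        (null-+ {X * Y * Z} {X * Y * rest} null-XYZ (null-* (X * Y) {rest} null-rest)))
      where
      rest = n₅ + n₆ - ((n₁ + n₂) + (n₃ + n₄))
      0≤XY : ∀ n → 0ℚ ℚ.≤ seq (X * Y) n
      0≤XY n = 0≤p*q (0≤sqDist a b n) (0≤sqDist d e n)

    null-D²⇒null-X : Null D² → Null X
    null-D²⇒null-X h = null-≤ {X} {D² + n₅} (0≤sqDist a b)
      (λ n → ℚP.≤-trans
        (ℚP.≤-reflexive (solve 2 (λ x l → x := l :+ (x :- l)) refl (seq X n) (seq lab² n)))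
        (ℚP.+-monoˡ-≤ (seq n₅ n) (lab²≤D² n)))
      (null-+ {D²} {n₅} h (null-dist² a b))

    -- `null-product` strips the factors D² and Y, neither of which is null: a null D² would
    -- collapse a and b, a null Y would identify d and e. What remains says that X is null.
    degenerate : ¬ a ≈ᵖ b → ¬ d ≈ᵖ e → ⊥
    degenerate a≉b d≉e = ¬null-X (null-product {X} {Y} (null-product {X * Y} {D²} null-XYD²
        (λ h → ¬null-X (null-D²⇒null-X h)))
      (λ h → d≉e (null-sqDist⇒≈ d e h)))
      where
      ¬null-X : ¬ Null X
      ¬null-X h = a≉b (null-sqDist⇒≈ a b h)

  no-4-cycle : ∀ {k} (x : Vector (Point 2) k) → InjectiveFamily x → ∀ {i j k l} → i ≢ k → j ≢ l →
               dist (x i) (x j) ≈ diam x → dist (x j) (x k) ≈ diam x →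
               dist (x k) (x l) ≈ diam x → dist (x l) (x i) ≈ diam x → ⊥
  no-4-cycle x inj {i} {j} {k} {l} i≢k j≢l ij jk kl li =
    degenerate (x i) (x j) (x k) (x l) (diam x) ij jk kl li
      (dist≤diam x i k) (dist≤diam x j l) (λ eq → i≢k (inj i k eq)) (λ eq → j≢l (inj j l eq))

-- A triangle with a pendant edge as a diameter graph of the plane

module Kite where
  open ℚ-Lemmas
  open +-*-Solver
  open Reals
  open FourCycle using (sqDist)

  √3 : ℝ
  √3 = √ (fromℚ (ℤ.+ 3 ℚ./ 1))

  -- Rational values at mutual distance at least 2/5, so that comparing first coordinates already
  -- separates the points. The last point is (8/5, 6/5), a scaled 3-4-5 triple at distance exactly 2
  -- from the origin.
  firstCoordinate : Fin 4 → ℚ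
  firstCoordinate 0F = 0ℚ
  firstCoordinate 1F = ℤ.+ 2 ℚ./ 1
  firstCoordinate 2F = 1ℚ
  firstCoordinate 3F = ℤ.+ 8 ℚ./ 5

  secondCoordinate : Fin 4 → ℝ
  secondCoordinate 0F = 0ℝ
  secondCoordinate 1F = 0ℝ
  secondCoordinate 2F = √3
  secondCoordinate 3F = fromℚ (ℤ.+ 6 ℚ./ 5)

  -- The vertices of an equilateral triangle of side 2, and a point of the Reuleaux arc
  -- opposite to the first of them.
  kite : Vector (Point 2) 4
  kite i 0F = fromℚ (firstCoordinate i)
  kite i 1F = secondCoordinate i

  edge : Fin 4 → Fin 4 → Bool
  edge 0F 0F      = false
  edge 0F (suc _) = true
  edge (suc _) 0F = true
  edge 1F 2F      = true
  edge 2F 1F      = true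
  edge _  _       = false

  distinct : ∀ i j → ℚ.∣ firstCoordinate i ℚ.- firstCoordinate j ∣ ℚ.≤ ℤ.+ 1 ℚ./ 5 → i ≡ j
  distinct = from-yes (FinP.all? λ i → FinP.all? λ j →
    (ℚ.∣ firstCoordinate i ℚ.- firstCoordinate j ∣ ℚ.≤? ℤ.+ 1 ℚ./ 5) →-dec (i FinP.≟ j))

  kite-injective : InjectiveFamily kite
  kite-injective i j eq = let N , h = eq 0F (ℤ.+ 1 ℚ./ 5) (ℚP.positive⁻¹ (ℤ.+ 1 ℚ./ 5)) in
    distinct i j (h N ℕP.≤-refl)

  -- Edges have length 2 and the remaining distances are at most 3/2. The gap gives a positive way
  -- to refute equality with the diameter.
  Length : Bool → ℝ → Set
  Length true  x = fromℚ (ℤ.+ 2 ℚ./ 1) ≤ x × x ≤ fromℚ (ℤ.+ 2 ℚ./ 1)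
  Length false x = x ≤ fromℚ (ℤ.+ 3 ℚ./ 2)

  pointwise-≤ : ∀ {x y} → (∀ n → seq x n ℚ.≤ seq y n) → x ≤ y
  pointwise-≤ h ε 0<ε = 0 , λ n _ → ℚP.≤-trans (h n) (p≤p+q (ℚP.<⇒≤ 0<ε))

  ≤-dist-sym : ∀ {d} (x y : Point d) {z} → dist x y ≤ z → dist y x ≤ z
  ≤-dist-sym x y {z} h ε 0<ε = eventually (λ n → subst (ℚ._≤ seq z n ℚ.+ ε) (dist-sym x y n)) (h ε 0<ε)

  dist-sym-≤ : ∀ {d} (x y : Point d) {z} → z ≤ dist x y → z ≤ dist y x
  dist-sym-≤ x y {z} h ε 0<ε = eventually (λ n → subst (λ t → seq z n ℚ.≤ t ℚ.+ ε) (dist-sym x y n)) (h ε 0<ε)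

  length-sym : ∀ b {d} (x y : Point d) → Length b (dist x y) → Length b (dist y x)
  length-sym true  x y (lo , hi) = dist-sym-≤ x y {fromℚ (ℤ.+ 2 ℚ./ 1)} lo , ≤-dist-sym x y {fromℚ (ℤ.+ 2 ℚ./ 1)} hi
  length-sym false x y hi        = ≤-dist-sym x y {fromℚ (ℤ.+ 3 ℚ./ 2)} hi

  long : ∀ {x} → fromℚ (ℤ.+ 4 ℚ./ 1) ≤ x → x ≤ fromℚ (ℤ.+ 4 ℚ./ 1) → Length true (√ x)
  long {x} lo hi = ≤-√ {x} (ℤ.+ 2 ℚ./ 1) lo , √-≤ {x} (ℤ.+ 2 ℚ./ 1) (ℚP.≤ᵇ⇒≤ tt) hi

  short : ∀ {x} → x ≤ fromℚ (ℤ.+ 9 ℚ./ 4) → Length false (√ x)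
  short {x} = √-≤ {x} (ℤ.+ 3 ℚ./ 2) (ℚP.≤ᵇ⇒≤ tt)

  √3²≈3 : Null (fromℚ (ℤ.+ 3 ℚ./ 1) - √3 * √3)
  √3²≈3 = null-√² (fromℚ (ℤ.+ 3 ℚ./ 1))

  3/2≤√3 : fromℚ (ℤ.+ 3 ℚ./ 2) ≤ √3
  3/2≤√3 = ≤-√ {fromℚ (ℤ.+ 3 ℚ./ 1)} (ℤ.+ 3 ℚ./ 2) (pointwise-≤ {fromℚ (ℤ.+ 9 ℚ./ 4)} {fromℚ (ℤ.+ 3 ℚ./ 1)} λ _ → ℚP.≤ᵇ⇒≤ tt)

  1+√3²-long : ∀ x → (∀ n → seq x n ≡ 1ℚ ℚ.+ seq √3 n ℚ.* seq √3 n) → Length true (√ x)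
  1+√3²-long x eq = long {x}
    (λ ε 0<ε → eventually (λ n h → subst (λ z → ℤ.+ 4 ℚ./ 1 ℚ.≤ z ℚ.+ ε) (sym (eq n))
      (subst (ℤ.+ 4 ℚ./ 1 ℚ.≤_) (sym (ℚP.+-assoc 1ℚ (seq √3 n ℚ.* seq √3 n) ε))
        (ℚP.+-monoʳ-≤ 1ℚ (∣p-q∣≤e⇒p≤q+e {ℤ.+ 3 ℚ./ 1} {seq √3 n ℚ.* seq √3 n} h)))) (√3²≈3 ε 0<ε))
    (λ ε 0<ε → eventually (λ n h → subst (ℚ._≤ ℤ.+ 4 ℚ./ 1 ℚ.+ ε) (sym (eq n))
      (subst (1ℚ ℚ.+ seq √3 n ℚ.* seq √3 n ℚ.≤_) (sym (ℚP.+-assoc 1ℚ (ℤ.+ 3 ℚ./ 1) ε))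
        (ℚP.+-monoʳ-≤ 1ℚ (∣p-q∣≤e⇒p≤q+e {seq √3 n ℚ.* seq √3 n} {ℤ.+ 3 ℚ./ 1}
          (subst (ℚ._≤ ε) (∣p-q∣≡∣q-p∣ (ℤ.+ 3 ℚ./ 1) (seq √3 n ℚ.* seq √3 n)) h))))) (√3²≈3 ε 0<ε))

  2-3-short : Length false (dist (kite 2F) (kite 3F))
  2-3-short = short {x} λ ε 0<ε → eventually
    -- The squared length is t^2 + 9/5 - (12/5)t with t near √3. Errors δ in t^2 ≤ 3 and in t ≥ 3/2
    -- add up to (1 + 12/5)δ = (17/5)δ, whence δ = (5/17)ε; the main term is 6/5.
    (λ n (sq , lo) → let t = seq √3 n ; δ = ℤ.+ 5 ℚ./ 17 ℚ.* ε in begin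
      seq x n
        ≡⟨ solve 1 (λ t → (con 1ℚ :- con (ℤ.+ 8 ℚ./ 5)) :* (con 1ℚ :- con (ℤ.+ 8 ℚ./ 5)) :+
             ((t :- con (ℤ.+ 6 ℚ./ 5)) :* (t :- con (ℤ.+ 6 ℚ./ 5)) :+ con 0ℚ) :=
             t :* t :+ (con (ℤ.+ 9 ℚ./ 5) :- con (ℤ.+ 12 ℚ./ 5) :* t)) refl t ⟩
      t ℚ.* t ℚ.+ (ℤ.+ 9 ℚ./ 5 ℚ.- ℤ.+ 12 ℚ./ 5 ℚ.* t)
        ≤⟨ ℚP.+-mono-≤ (∣p-q∣≤e⇒p≤q+e {t ℚ.* t} {ℤ.+ 3 ℚ./ 1} (subst (ℚ._≤ δ) (∣p-q∣≡∣q-p∣ (ℤ.+ 3 ℚ./ 1) (t ℚ.* t)) sq))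
             (ℚP.+-monoʳ-≤ (ℤ.+ 9 ℚ./ 5) (ℚP.neg-antimono-≤ (ℚP.*-monoˡ-≤-nonNeg (ℤ.+ 12 ℚ./ 5)
               (p≤q+e⇒p-q≤e {ℤ.+ 3 ℚ./ 2} {δ} {t} (subst (ℤ.+ 3 ℚ./ 2 ℚ.≤_) (ℚP.+-comm t δ) lo))))) ⟩
      ℤ.+ 3 ℚ./ 1 ℚ.+ δ ℚ.+ (ℤ.+ 9 ℚ./ 5 ℚ.- ℤ.+ 12 ℚ./ 5 ℚ.* (ℤ.+ 3 ℚ./ 2 ℚ.- δ))
        ≡⟨ solve 1 (λ ε → let δ = con (ℤ.+ 5 ℚ./ 17) :* ε in
             con (ℤ.+ 3 ℚ./ 1) :+ δ :+ (con (ℤ.+ 9 ℚ./ 5) :- con (ℤ.+ 12 ℚ./ 5) :* (con (ℤ.+ 3 ℚ./ 2) :- δ)) :=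
             con (ℤ.+ 6 ℚ./ 5) :+ ε) refl ε ⟩
      ℤ.+ 6 ℚ./ 5 ℚ.+ ε
        ≤⟨ ℚP.+-monoˡ-≤ ε (ℚP.≤ᵇ⇒≤ {ℤ.+ 6 ℚ./ 5} {ℤ.+ 9 ℚ./ 4} tt) ⟩
      ℤ.+ 9 ℚ./ 4 ℚ.+ ε ∎)
    (√3²≈3 (ℤ.+ 5 ℚ./ 17 ℚ.* ε) (0<δ 0<ε) and 3/2≤√3 (ℤ.+ 5 ℚ./ 17 ℚ.* ε) (0<δ 0<ε))
    where
    open ℚP.≤-Reasoning
    x = sqDist (kite 2F) (kite 3F)
    0<δ : ∀ {ε} → 0ℚ ℚ.< ε → 0ℚ ℚ.< ℤ.+ 5 ℚ./ 17 ℚ.* ε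
    0<δ = 0<p*q (ℚP.positive⁻¹ (ℤ.+ 5 ℚ./ 17))

  kite-length : ∀ i j → i ≢ j → Length (edge i j) (dist (kite i) (kite j))
  kite-length 0F 1F _ = long {sqDist (kite 0F) (kite 1F)} (λ ε 0<ε → 0 , λ _ _ → p≤p+q {ℤ.+ 4 ℚ./ 1} (ℚP.<⇒≤ 0<ε)) (λ ε 0<ε → 0 , λ _ _ → p≤p+q {ℤ.+ 4 ℚ./ 1} (ℚP.<⇒≤ 0<ε))
  kite-length 0F 2F _ = 1+√3²-long (sqDist (kite 0F) (kite 2F)) λ n → solve 1 (λ t →
    (con 0ℚ :- con 1ℚ) :* (con 0ℚ :- con 1ℚ) :+ ((con 0ℚ :- t) :* (con 0ℚ :- t) :+ con 0ℚ) := con 1ℚ :+ t :* t) refl (seq √3 n)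
  kite-length 0F 3F _ = long {sqDist (kite 0F) (kite 3F)} (λ ε 0<ε → 0 , λ _ _ → p≤p+q {ℤ.+ 4 ℚ./ 1} (ℚP.<⇒≤ 0<ε)) (λ ε 0<ε → 0 , λ _ _ → p≤p+q {ℤ.+ 4 ℚ./ 1} (ℚP.<⇒≤ 0<ε))
  kite-length 1F 2F _ = 1+√3²-long (sqDist (kite 1F) (kite 2F)) λ n → solve 1 (λ t →
    (con (ℤ.+ 2 ℚ./ 1) :- con 1ℚ) :* (con (ℤ.+ 2 ℚ./ 1) :- con 1ℚ) :+ ((con 0ℚ :- t) :* (con 0ℚ :- t) :+ con 0ℚ)
    := con 1ℚ :+ t :* t) refl (seq √3 n)
  kite-length 1F 3F _ = short {sqDist (kite 1F) (kite 3F)} (pointwise-≤ {sqDist (kite 1F) (kite 3F)} {fromℚ (ℤ.+ 9 ℚ./ 4)} λ _ → ℚP.≤ᵇ⇒≤ tt)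
  kite-length 2F 3F _ = 2-3-short
  kite-length 1F 0F _ = length-sym true  (kite 0F) (kite 1F) (kite-length 0F 1F λ ())
  kite-length 2F 0F _ = length-sym true  (kite 0F) (kite 2F) (kite-length 0F 2F λ ())
  kite-length 3F 0F _ = length-sym true  (kite 0F) (kite 3F) (kite-length 0F 3F λ ())
  kite-length 2F 1F _ = length-sym true  (kite 1F) (kite 2F) (kite-length 1F 2F λ ())
  kite-length 3F 1F _ = length-sym false (kite 1F) (kite 3F) (kite-length 1F 3F λ ())
  kite-length 3F 2F _ = length-sym false (kite 2F) (kite 3F) 2-3-short
  kite-length 0F 0F h = ⊥-elim (h refl)
  kite-length 1F 1F h = ⊥-elim (h refl)
  kite-length 2F 2F h = ⊥-elim (h refl)
  kite-length 3F 3F h = ⊥-elim (h refl)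

  dist-self : ∀ i → dist (kite i) (kite i) ≤ fromℚ (ℤ.+ 2 ℚ./ 1)
  dist-self i = √-≤ {x} (ℤ.+ 2 ℚ./ 1) (ℚP.≤ᵇ⇒≤ tt) (pointwise-≤ {x} {fromℚ (ℤ.+ 4 ℚ./ 1)} λ n →
    subst (ℚ._≤ ℤ.+ 4 ℚ./ 1) (sym (solve 2 (λ a b → (a :- a) :* (a :- a) :+ ((b :- b) :* (b :- b) :+ con 0ℚ) := con 0ℚ)
      refl (firstCoordinate i) (seq (secondCoordinate i) n))) (ℚP.≤ᵇ⇒≤ tt))
    where x = sqDist (kite i) (kite i)

  length⇒≤2 : ∀ b {x} → Length b x → x ≤ fromℚ (ℤ.+ 2 ℚ./ 1)
  length⇒≤2 true  (_ , hi)     = hi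
  length⇒≤2 false hi ε 0<ε = eventually (λ n h → ℚP.≤-trans h (ℚP.+-monoˡ-≤ ε (ℚP.≤ᵇ⇒≤ {ℤ.+ 3 ℚ./ 2} {ℤ.+ 2 ℚ./ 1} tt))) (hi ε 0<ε)

  dist≤2 : ∀ i j → dist (kite i) (kite j) ≤ fromℚ (ℤ.+ 2 ℚ./ 1)
  dist≤2 i j with i FinP.≟ j
  ... | yes refl = dist-self i
  ... | no i≢j   = length⇒≤2 (edge i j) (kite-length i j i≢j)

  diam≤2 : diam kite ≤ fromℚ (ℤ.+ 2 ℚ./ 1)
  diam≤2 = max-lub (λ i → max (λ j → dist (kite i) (kite j))) {fromℚ (ℤ.+ 2 ℚ./ 1)} 0≤2 λ i →
    max-lub (λ j → dist (kite i) (kite j)) {fromℚ (ℤ.+ 2 ℚ./ 1)} 0≤2 λ j → dist≤2 i j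
    where
    0≤2 : 0ℝ ≤ fromℚ (ℤ.+ 2 ℚ./ 1)
    0≤2 = pointwise-≤ {0ℝ} {fromℚ (ℤ.+ 2 ℚ./ 1)} λ _ → ℚP.≤ᵇ⇒≤ tt

  2≤diam : fromℚ (ℤ.+ 2 ℚ./ 1) ≤ diam kite
  2≤diam ε 0<ε = eventually (λ n h → ℚP.≤-trans h (ℚP.+-monoˡ-≤ ε (dist≤diam kite 0F 1F n)))
    (proj₁ (kite-length 0F 1F λ ()) ε 0<ε)

  long⇒diam : ∀ {i j} → Length true (dist (kite i) (kite j)) → dist (kite i) (kite j) ≈ diam kite
  long⇒diam {i} {j} (lo , _) ε 0<ε = eventually
    (λ n (2≤d , D≤2) → p≤q+e∧q≤p+e⇒∣p-q∣≤e {seq (dist (kite i) (kite j)) n} {seq (diam kite) n} {ε}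
      (ℚP.≤-trans (dist≤diam kite i j n) (p≤p+q (ℚP.<⇒≤ 0<ε)))
      (begin
        seq (diam kite) n                                            ≤⟨ D≤2 ⟩
        ℤ.+ 2 ℚ./ 1 ℚ.+ ½ ℚ.* ε                                      ≤⟨ ℚP.+-monoˡ-≤ (½ ℚ.* ε) 2≤d ⟩
        seq (dist (kite i) (kite j)) n ℚ.+ ½ ℚ.* ε ℚ.+ ½ ℚ.* ε       ≡⟨ trans (ℚP.+-assoc (seq (dist (kite i) (kite j)) n) _ _)
                                                                          (cong (seq (dist (kite i) (kite j)) n ℚ.+_) (½e+½e≡e ε)) ⟩
        seq (dist (kite i) (kite j)) n ℚ.+ ε                         ∎))
    (lo (½ ℚ.* ε) (½*-pos 0<ε) and diam≤2 (½ ℚ.* ε) (½*-pos 0<ε))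
    where open ℚP.≤-Reasoning

  short⇒¬diam : ∀ {i j} → Length false (dist (kite i) (kite j)) → ¬ dist (kite i) (kite j) ≈ diam kite
  short⇒¬diam {i} {j} hi eq = ⟨ (λ n ((d≤ , 2≤D) , near) → 2≰ (begin
      ℤ.+ 2 ℚ./ 1                            ≤⟨ 2≤D ⟩
      seq (diam kite) n ℚ.+ ε                ≤⟨ ℚP.+-monoˡ-≤ ε (∣p-q∣≤e⇒p≤q+e {seq (diam kite) n} {seq (dist (kite i) (kite j)) n}
                                                  (subst (ℚ._≤ ε) (∣p-q∣≡∣q-p∣ (seq (dist (kite i) (kite j)) n) (seq (diam kite) n)) near)) ⟩
      seq (dist (kite i) (kite j)) n ℚ.+ ε ℚ.+ ε
                                             ≤⟨ ℚP.+-monoˡ-≤ ε (ℚP.+-monoˡ-≤ ε d≤) ⟩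
      ℤ.+ 3 ℚ./ 2 ℚ.+ ε ℚ.+ ε ℚ.+ ε          ∎)) ⟩-contradiction
    (hi ε 0<ε and 2≤diam ε 0<ε and eq ε 0<ε)
    where
    open ℚP.≤-Reasoning
    ε : ℚ
    -- Three errors of this size must stay below the gap 1/2 between 3/2 and 2.
    ε = ℤ.+ 1 ℚ./ 8
    0<ε : 0ℚ ℚ.< ε
    0<ε = ℚP.positive⁻¹ ε
    2≰ : ¬ ℤ.+ 2 ℚ./ 1 ℚ.≤ ℤ.+ 3 ℚ./ 2 ℚ.+ ε ℚ.+ ε ℚ.+ ε
    2≰ h = ℚP.≤⇒≤ᵇ h

  edge-irrefl : ∀ i → edge i i ≡ false
  edge-irrefl 0F = refl
  edge-irrefl 1F = refl
  edge-irrefl 2F = refl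
  edge-irrefl 3F = refl

  edge⇒diameter : ∀ i j → T (edge i j) → Adj (diameterGraph kite) i j
  edge⇒diameter i j h = i≢j , go (edge i j) h (kite-length i j i≢j)
    where
    i≢j : i ≢ j
    i≢j eq = subst T (trans (cong (edge i) (sym eq)) (edge-irrefl i)) h
    go : ∀ b → T b → Length b (dist (kite i) (kite j)) → dist (kite i) (kite j) ≈ diam kite
    go true _ = long⇒diam {i} {j}

  diameter⇒edge : ∀ i j → Adj (diameterGraph kite) i j → T (edge i j)
  diameter⇒edge i j (i≢j , eq) = go (edge i j) (kite-length i j i≢j)
    where
    go : ∀ b → Length b (dist (kite i) (kite j)) → T b
    go true  _ = tt
    go false s = short⇒¬diam {i} {j} s eq

-- From the two events to diameter subgraphs

module DiameterSubgraphs where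
  open Combinatorics
  open Expectation using (good; bad)
  open FourCycle using (no-4-cycle)
  open Kite

  cyclicComplement⇒bad : ∀ {n} (G : LabelledGraph n) → CyclicComplement G → T (bad G)
  cyclicComplement⇒bad G (inj₁ c)        = Equivalence.from T-∨ (inj₁ (copy⇒occurs c))
  cyclicComplement⇒bad G (inj₂ (inj₁ c)) = Equivalence.from (T-∨ {occurs (missing G) triangle})
    (inj₂ (Equivalence.from T-∨ (inj₁ (copy⇒occurs c))))
  cyclicComplement⇒bad G (inj₂ (inj₂ c)) = Equivalence.from (T-∨ {occurs (missing G) triangle})
    (inj₂ (Equivalence.from (T-∨ {occurs (missing G) square}) (inj₂ (copy⇒occurs c))))

  large⇒bad : ∀ {n k} (G : LabelledGraph n) → 5 ℕ.≤ k → HasDiameterSubgraph 2 k G → T (bad G)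
  large⇒bad G 5≤k (W , ∣W∣≡k , (m , x , x-inj , iso) , _) =
    [ (λ c → ⊥-elim (no-square c)) , cyclicComplement⇒bad G ]′ (five-vertices G ι inj)
    where
    open Enumeration (enumerate W 5 (subst (5 ℕ.≤_) (sym ∣W∣≡k) 5≤k))
    open _≅_ iso
    no-square : ¬ Copy (λ i j → adj G (ι i) (ι j)) square
    no-square (κ , κ-inj , e₀₁ ∷ e₁₂ ∷ e₂₃ ∷ e₃₀ ∷ []) =
      no-4-cycle x x-inj {φ 0F} {φ 1F} {φ 2F} {φ 3F} (λ eq → 0≢2 (φ-inj eq)) (λ eq → 1≢3 (φ-inj eq))
        (side e₀₁) (side e₁₂) (side e₂₃) (side e₃₀)
      where
      v : Fin 4 → Vertex (induced G W)
      v i = ι (κ i) , ι∈W (κ i)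
      φ : Fin 4 → Fin m
      φ i = Inverse.to bijection (v i)
      φ-inj : ∀ {i j} → φ i ≡ φ j → i ≡ j
      φ-inj {i} {j} eq = κ-inj i j (inj _ _ (cong proj₁
        (trans (sym (Inverse.strictlyInverseʳ bijection (v i)))
          (trans (cong (Inverse.from bijection) eq) (Inverse.strictlyInverseʳ bijection (v j))))))
      0≢2 : _≢_ {A = Fin 4} 0F 2F
      0≢2 ()
      1≢3 : _≢_ {A = Fin 4} 1F 3F
      1≢3 ()
      side : ∀ {i j} → T (adj G (ι (κ i)) (ι (κ j))) → dist (x (φ i)) (x (φ j)) ≈ diam x
      side {i} {j} h = proj₂ (Equivalence.to (adjacency (v i) (v j)) (adj⇒LAdj G _ _ h))

  module _ {n} (G : LabelledGraph n) (ι : Fin 4 → Fin n) (ι-inj : Inj ι)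
           (pattern-edge : ∀ i j → adj G (ι i) (ι j) ≡ edge i j) where
    open Range (range ι ι-inj)

    H : SimpleGraph
    H = induced G W

    to : Vertex H → Fin 4
    to (u , h) = proj₁ (∈W⇒ h)

    from : Fin 4 → Vertex H
    from i = ι i , ι∈W i

    ι-to : ∀ u → ι (to u) ≡ proj₁ u
    ι-to (u , h) = proj₂ (∈W⇒ h)

    -- Vertices of an induced subgraph carry membership proofs; uniqueness of these proofs is what
    -- makes `from` and `to` mutually inverse.
    vertex-≡ : ∀ {u v : Vertex H} → proj₁ u ≡ proj₁ v → u ≡ v
    vertex-≡ {u , h} {.u , h′} refl = cong (u ,_) ([]=-irrelevant h h′)

    from-to : ∀ u → from (to u) ≡ u
    from-to u = vertex-≡ (ι-to u)

    vertex↔Fin4 : Vertex H ↔ Fin 4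
    vertex↔Fin4 = mk↔ₛ′ to from (λ i → ι-inj _ _ (ι-to (from i))) from-to

    Adj⇒edge : ∀ u v → Adj H u v → T (edge (to u) (to v))
    Adj⇒edge u v h = subst T
      (trans (cong₂ (adj G) (sym (ι-to u)) (sym (ι-to v))) (pattern-edge (to u) (to v)))
      (LAdj⇒adj G (proj₁ u) (proj₁ v) h)

    edge⇒Adj : ∀ u v → T (edge (to u) (to v)) → Adj H u v
    edge⇒Adj u v h = adj⇒LAdj G (proj₁ u) (proj₁ v) (subst T
      (trans (sym (pattern-edge (to u) (to v))) (cong₂ (adj G) (ι-to u) (ι-to v))) h)

    from-Adj : ∀ i j → T (edge i j) → Adj H (from i) (from j)
    from-Adj i j h = adj⇒LAdj G (ι i) (ι j) (subst T (sym (pattern-edge i j)) h)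

    H≅kite : H ≅ diameterGraph kite
    H≅kite = record
      { bijection = vertex↔Fin4
      ; adjacency = λ u v → mk⇔ (λ h → edge⇒diameter (to u) (to v) (Adj⇒edge u v h))
                                 (λ h → edge⇒Adj u v (diameter⇒edge (to u) (to v) h))
      }

    colour : Fin 4 → Fin 3
    colour 0F = 0F
    colour 1F = 1F
    colour 2F = 2F
    colour 3F = 1F

    colour-proper : ∀ i j → T (edge i j) → colour i ≢ colour j
    colour-proper 0F 1F _ ()
    colour-proper 0F 2F _ ()
    colour-proper 0F 3F _ ()
    colour-proper 1F 0F _ ()
    colour-proper 2F 0F _ ()
    colour-proper 3F 0F _ ()
    colour-proper 1F 2F _ ()
    colour-proper 2F 1F _ ()

    corner : Fin 3 → Fin 4
    corner 0F = 0F
    corner 1F = 1F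
    corner 2F = 2F

    corners-adjacent : ∀ i j → i ≢ j → T (edge (corner i) (corner j))
    corners-adjacent 0F 0F h = h refl
    corners-adjacent 0F 1F h = tt
    corners-adjacent 0F 2F h = tt
    corners-adjacent 1F 0F h = tt
    corners-adjacent 1F 1F h = h refl
    corners-adjacent 1F 2F h = tt
    corners-adjacent 2F 0F h = tt
    corners-adjacent 2F 1F h = tt
    corners-adjacent 2F 2F h = h refl

    H-3-chromatic : HasChromaticNumber H 3
    H-3-chromatic = ((λ u → colour (to u)) , λ u v h → colour-proper (to u) (to v) (Adj⇒edge u v h)) , minimal
      where
      minimal : ∀ m → Colourable H m → 3 ℕ.≤ m
      minimal m (f , proper) = FinP.injective⇒≤ {f = λ i → f (from (corner i))} λ {i} {j} eq → inj i j eq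
        where
        inj : ∀ i j → f (from (corner i)) ≡ f (from (corner j)) → i ≡ j
        inj i j eq with i FinP.≟ j
        ... | yes i≡j = i≡j
        ... | no i≢j  = ⊥-elim (proper (from (corner i)) (from (corner j))
                          (from-Adj (corner i) (corner j) (corners-adjacent i j i≢j)) eq)

    H-connected : Connected H
    H-connected u v = subst₂ (Star (Adj H)) (from-to u) (from-to v) (to-hub (to u) ◅◅ from-hub (to v))
      where
      to-hub : ∀ i → Star (Adj H) (from i) (from 0F)
      to-hub 0F      = Star.ε
      to-hub (suc i) = from-Adj (suc i) 0F tt ◅ Star.ε
      from-hub : ∀ i → Star (Adj H) (from 0F) (from i)
      from-hub 0F      = Star.ε
      from-hub (suc i) = from-Adj 0F (suc i) tt ◅ Star.ε

    kite-subgraph : HasConnectedDiameterSubgraph 2 4 G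
    kite-subgraph = W , ∣W∣ , (4 , kite , kite-injective , H≅kite) , H-3-chromatic , H-connected

  nothing-missing : ∀ {n} (S : Subset n) → T (not (hasMissing S)) → ∀ j → lookup S j ≡ true
  nothing-missing (true ∷ S) h zero    = refl
  nothing-missing (true ∷ S) h (suc j) = nothing-missing S h j

  T⇒≡true : ∀ {b} → T b → b ≡ true
  T⇒≡true {true} _ = refl

  -- With the newest vertex as hub, the leaves b and c of the cherry complete the triangle, and its
  -- centre a, which misses both, is the pendant vertex.
  good⇒kite : ∀ {n} (G : LabelledGraph n) → T (good G) → HasConnectedDiameterSubgraph 2 4 G
  good⇒kite {suc n} (G ▹ S) h = kite-subgraph (G ▹ S) ι ι-inj pattern-edge
    where
    h₁ : T (not (hasMissing S)) × T (not (occurs (missing G) triangle) ∧ cherry G)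
    h₁ = Equivalence.to (T-∧ {not (hasMissing S)}) h
    h₂ : T (not (occurs (missing G) triangle)) × T (cherry G)
    h₂ = Equivalence.to (T-∧ {not (occurs (missing G) triangle)}) (proj₂ h₁)
    full : ∀ j → lookup S j ≡ true
    full = nothing-missing S (proj₁ h₁)
    open Cherry (cherry⇒ G (proj₂ h₂))

    order : Fin 3 → Fin n
    order 0F = b
    order 1F = c
    order 2F = a

    order-inj : Inj order
    order-inj 0F 0F _  = refl
    order-inj 0F 1F eq = ⊥-elim (b≢c eq)
    order-inj 0F 2F eq = ⊥-elim (a≢b (sym eq))
    order-inj 1F 0F eq = ⊥-elim (b≢c (sym eq))
    order-inj 1F 1F _  = refl
    order-inj 1F 2F eq = ⊥-elim (a≢c (sym eq))
    order-inj 2F 0F eq = ⊥-elim (a≢b eq)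
    order-inj 2F 1F eq = ⊥-elim (a≢c eq)
    order-inj 2F 2F _  = refl

    bc : adj G b c ≡ true
    -- If the edge between the leaves were missing too, the cherry would close to a triangle of the
    -- complement, which `good` excludes.
    bc = T⇒≡true (¬T-not⇒T λ bc-missing → subst T (T-not (proj₁ h₂)) (copy⇒occurs {r = missing G} {triangle}
      (order , order-inj , bc-missing ∷ missing-edge (trans (adj-symm G c a) ac) ∷ missing-edge ab ∷ [])))
      where
      missing-edge : ∀ {i j} → adj G i j ≡ false → T (missing G i j)
      missing-edge eq = subst (T ∘ not) (sym eq) tt

    ι : Fin 4 → Fin (suc n)
    ι zero    = zero
    ι (suc i) = suc (order i)

    ι-inj : Inj ι
    ι-inj zero    zero    _  = refl
    ι-inj (suc i) (suc j) eq = cong suc (order-inj i j (FinP.suc-injective eq))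

    pattern-edge : ∀ i j → adj (G ▹ S) (ι i) (ι j) ≡ edge i j
    pattern-edge 0F 0F      = refl
    pattern-edge 0F (suc j) = full (order j)
    pattern-edge (suc i) 0F = full (order i)
    pattern-edge 1F 1F      = adj-irrefl G b
    pattern-edge 1F 2F      = bc
    pattern-edge 1F 3F      = trans (adj-symm G b a) ab
    pattern-edge 2F 1F      = trans (adj-symm G c b) bc
    pattern-edge 2F 2F      = adj-irrefl G c
    pattern-edge 2F 3F      = trans (adj-symm G c a) ac
    pattern-edge 3F 1F      = ab
    pattern-edge 3F 2F      = ac
    pattern-edge 3F 3F      = adj-irrefl G a

-- From the asymptotic hypotheses to the thresholds

module Asymptotics where
  open ℚ-Lemmas
  open Reals
  open Expectation
  open DiameterSubgraphs
  open +-*-Solver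

  -- All that the rational estimates ask of one approximation q of 1 - p. Here 2304 = 48^2 comes
  -- from squaring the bound q n^(3/2) > 48.
  Parameters : ℕ → ℚ → Set
  Parameters n q = 0ℚ ℚ.≤ q × 0ℚ ℚ.≤ 1ℚ ℚ.- q × n/1 n ℚ.* q ℚ.≤ ℤ.+ 1 ℚ./ 8 ×
                   ℤ.+ 2304 ℚ./ 1 ℚ.≤ q ℚ.* q ℚ.* n/1 (n ℕ.^ 3)

  n*1/n : ∀ n → n/1 (suc n) ℚ.* (ℤ.+ 1 ℚ./ suc n) ≡ 1ℚ
  n*1/n n = ℚP.toℚᵘ-injective (begin
    ℚ.toℚᵘ (n/1 (suc n) ℚ.* (ℤ.+ 1 ℚ./ suc n))
      ≈⟨ ℚP.toℚᵘ-homo-* (n/1 (suc n)) (ℤ.+ 1 ℚ./ suc n) ⟩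
    ℚ.toℚᵘ (n/1 (suc n)) ℚᵘ.* ℚ.toℚᵘ (ℤ.+ 1 ℚ./ suc n)
      ≈⟨ ℚᵘP.*-cong (ℚP.toℚᵘ-fromℚᵘ (ℚᵘ.mkℚᵘ (ℤ.+ suc n) 0)) (ℚP.toℚᵘ-fromℚᵘ (ℚᵘ.mkℚᵘ (ℤ.+ 1) n)) ⟩
    ℚᵘ.mkℚᵘ (ℤ.+ suc n) 0 ℚᵘ.* ℚᵘ.mkℚᵘ (ℤ.+ 1) n
      ≈⟨ ℚᵘ.*≡* (cong ℤ.+_ (lem n)) ⟩
    ℚ.toℚᵘ 1ℚ ∎)
    where
    open ℚᵘP.≃-Reasoning
    lem : ∀ n → suc n ℕ.* 1 ℕ.* 1 ≡ 1 ℕ.* (1 ℕ.* suc n)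
    lem n = trans (ℕP.*-identityʳ (suc n ℕ.* 1)) (trans (ℕP.*-identityʳ (suc n))
      (sym (trans (ℕP.*-identityˡ (1 ℕ.* suc n)) (ℕP.*-identityˡ (suc n)))))

  0<1/n : ∀ n → 0ℚ ℚ.< ℤ.+ 1 ℚ./ suc n
  0<1/n n = ℚP.≰⇒> λ r≤0 → ℚP.<-irrefl refl (begin-strict
    0ℚ                                    <⟨ ℚP.positive⁻¹ 1ℚ ⟩
    1ℚ                                    ≡⟨ sym (n*1/n n) ⟩
    n/1 (suc n) ℚ.* (ℤ.+ 1 ℚ./ suc n)     ≤⟨ ℚP.*-monoˡ-≤-nonNeg (n/1 (suc n)) {{nn (0≤n/1 (suc n))}} r≤0 ⟩
    n/1 (suc n) ℚ.* 0ℚ                    ≡⟨ ℚP.*-zeroʳ (n/1 (suc n)) ⟩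
    0ℚ                                    ∎)
    where open ℚP.≤-Reasoning

  -- Order on `ℝ` bounds approximations only up to ε. The sign of the rational q itself is read off
  -- from a strictly positive lower bound for its product with l ≥ 0.
  nonneg : ∀ {q l c} → 0ℚ ℚ.≤ l → 0ℚ ℚ.< c → c ℚ.≤ q ℚ.* l → 0ℚ ℚ.≤ q
  nonneg {q} {l} {c} 0≤l 0<c c≤ql = ℚP.≮⇒≥ λ q<0 → ℚP.<-irrefl refl (begin-strict
    0ℚ        <⟨ 0<c ⟩
    c         ≤⟨ c≤ql ⟩
    q ℚ.* l   ≤⟨ ℚP.*-monoʳ-≤-nonNeg l {{nn 0≤l}} (ℚP.<⇒≤ q<0) ⟩
    0ℚ ℚ.* l  ≡⟨ ℚP.*-zeroˡ l ⟩
    0ℚ        ∎)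
    where open ℚP.≤-Reasoning

  -- One sixteenth of r = 1/(n + 1) comes from the little-o hypothesis and another sixteenth is the
  -- tolerance in the order on `ℝ`; together they give 1/8.
  n*q≤⅛ : ∀ n {q} → let r = ℤ.+ 1 ℚ./ suc n in
          q ℚ.⊔ ℚ.- q ℚ.≤ ℤ.+ 1 ℚ./ 16 ℚ.* (r ℚ.⊔ ℚ.- r) ℚ.+ ℤ.+ 1 ℚ./ 16 ℚ.* r →
          n/1 (suc n) ℚ.* q ℚ.≤ ℤ.+ 1 ℚ./ 8
  n*q≤⅛ n {q} h = begin
    n/1 (suc n) ℚ.* q                       ≤⟨ ℚP.*-monoˡ-≤-nonNeg (n/1 (suc n)) {{nn (0≤n/1 (suc n))}} (begin
      q                                       ≤⟨ ℚP.p≤p⊔q q (ℚ.- q) ⟩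
      q ℚ.⊔ ℚ.- q                             ≤⟨ h ⟩
      ℤ.+ 1 ℚ./ 16 ℚ.* (r ℚ.⊔ ℚ.- r) ℚ.+ ℤ.+ 1 ℚ./ 16 ℚ.* r
                                              ≡⟨ cong (λ z → ℤ.+ 1 ℚ./ 16 ℚ.* z ℚ.+ ℤ.+ 1 ℚ./ 16 ℚ.* r) (ℚP.p≥q⇒p⊔q≡p -r≤r) ⟩
      ℤ.+ 1 ℚ./ 16 ℚ.* r ℚ.+ ℤ.+ 1 ℚ./ 16 ℚ.* r
                                              ≡⟨ solve 1 (λ r → con (ℤ.+ 1 ℚ./ 16) :* r :+ con (ℤ.+ 1 ℚ./ 16) :* r
                                                   := con (ℤ.+ 1 ℚ./ 8) :* r) refl r ⟩
      ℤ.+ 1 ℚ./ 8 ℚ.* r                       ∎) ⟩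
    n/1 (suc n) ℚ.* (ℤ.+ 1 ℚ./ 8 ℚ.* r)     ≡⟨ solve 2 (λ n r → n :* (con (ℤ.+ 1 ℚ./ 8) :* r) := con (ℤ.+ 1 ℚ./ 8) :* (n :* r))
                                                 refl (n/1 (suc n)) r ⟩
    ℤ.+ 1 ℚ./ 8 ℚ.* (n/1 (suc n) ℚ.* r)     ≡⟨ cong (ℤ.+ 1 ℚ./ 8 ℚ.*_) (n*1/n n) ⟩
    ℤ.+ 1 ℚ./ 8 ℚ.* 1ℚ                      ≡⟨⟩
    ℤ.+ 1 ℚ./ 8                             ∎
    where
    open ℚP.≤-Reasoning
    r = ℤ.+ 1 ℚ./ suc n
    0≤r : 0ℚ ℚ.≤ r
    0≤r = ℚP.<⇒≤ (0<1/n n)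
    -r≤r : ℚ.- r ℚ.≤ r
    -r≤r = ℚP.≤-trans (ℚP.neg-antimono-≤ 0≤r) 0≤r

  0≤1-q : ∀ n {q} → 0ℚ ℚ.≤ q → n/1 (suc n) ℚ.* q ℚ.≤ ℤ.+ 1 ℚ./ 8 → 0ℚ ℚ.≤ 1ℚ ℚ.- q
  0≤1-q n {q} 0≤q nq≤⅛ = FourCycle.0≤q-p {q} {1ℚ} (begin
    q                              ≤⟨ p≤p+q {q} (0≤p*q (0≤n/1 n) 0≤q) ⟩
    q ℚ.+ n/1 n ℚ.* q              ≡⟨ solve 2 (λ q n → q :+ n :* q := (con 1ℚ :+ n) :* q) refl q (n/1 n) ⟩
    (1ℚ ℚ.+ n/1 n) ℚ.* q           ≡⟨ cong (ℚ._* q) (sym (n/1-suc n)) ⟩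
    n/1 (suc n) ℚ.* q              ≤⟨ nq≤⅛ ⟩
    ℤ.+ 1 ℚ./ 8                    ≤⟨ ℚP.≤ᵇ⇒≤ tt ⟩
    1ℚ                             ∎)
    where open ℚP.≤-Reasoning

  2304≤q²a : ∀ {q l a} → ℤ.+ 48 ℚ./ 1 ℚ.≤ q ℚ.* l → l ℚ.* l ℚ.≤ a → ℤ.+ 2304 ℚ./ 1 ℚ.≤ q ℚ.* q ℚ.* a
  2304≤q²a {q} {l} {a} 48≤ l²≤a = begin
    ℤ.+ 2304 ℚ./ 1                        ≡⟨⟩
    ℤ.+ 48 ℚ./ 1 ℚ.* (ℤ.+ 48 ℚ./ 1)       ≤⟨ *-mono-≤-nonNeg {ℤ.+ 48 ℚ./ 1} {q ℚ.* l} (ℚP.≤ᵇ⇒≤ tt)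
                                               (ℚP.≤-trans (ℚP.≤ᵇ⇒≤ tt) 48≤) 48≤ 48≤ ⟩
    q ℚ.* l ℚ.* (q ℚ.* l)                 ≡⟨ solve 2 (λ q l → q :* l :* (q :* l) := q :* q :* (l :* l)) refl q l ⟩
    q ℚ.* q ℚ.* (l ℚ.* l)                 ≤⟨ ℚP.*-monoˡ-≤-nonNeg (q ℚ.* q) {{nn (0≤x² q)}} l²≤a ⟩
    q ℚ.* q ℚ.* a                         ∎
    where open ℚP.≤-Reasoning

  parametersₘ : ∀ n {q l} → n/1 (suc n) ℚ.* q ℚ.≤ ℤ.+ 1 ℚ./ 8 → 0ℚ ℚ.≤ l → l ℚ.* l ℚ.≤ n/1 (suc n ℕ.^ 3) →
                ℤ.+ 48 ℚ./ 1 ℚ.≤ q ℚ.* l → Parameters (suc n) q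
  parametersₘ n {q} {l} nq≤⅛ 0≤l l²≤n³ 48≤ql = 0≤q , 0≤1-q n {q} 0≤q nq≤⅛ , nq≤⅛ , 2304≤q²a {q} {l} 48≤ql l²≤n³
    where
    0≤q : 0ℚ ℚ.≤ q
    0≤q = nonneg {q} {l} {ℤ.+ 48 ℚ./ 1} 0≤l (ℚP.positive⁻¹ (ℤ.+ 48 ℚ./ 1)) 48≤ql

  √²≤ : ∀ {a} → 0ℚ ℚ.≤ a → ∀ m → seq (√ (fromℚ a)) m ℚ.* seq (√ (fromℚ a)) m ℚ.≤ a
  √²≤ {a} 0≤a m = subst (seq (√ (fromℚ a)) m ℚ.* seq (√ (fromℚ a)) m ℚ.≤_) (ℚP.p≤q⇒p⊔q≡q 0≤a)
    (Cauchy.Bisected.l²≤a (Cauchy.bisect-correct {0ℚ ℚ.⊔ a} m (ℚP.p≤p⊔q 0ℚ a)))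

  parameters : ∀ n x →
    ∣ x ∣ ≤ fromℚ (ℤ.+ 1 ℚ./ 16) * ∣ recip (suc n) ∣ → fromℚ (ℤ.+ 48 ℚ./ 1) < x * suc n ^3/2 →
    Eventually (λ m → Parameters (suc n) (seq x m))
  parameters n x small (ε , 0<ε , large) = eventually
    (λ m (h₁ , h₂) → parametersₘ n {seq x m} {seq (suc n ^3/2) m} (n*q≤⅛ n {seq x m} h₁)
      (0≤√ (fromℕ (suc n ℕ.^ 3)) m) (√²≤ (0≤n/1 (suc n ℕ.^ 3)) m)
      (ℚP.≤-trans (p≤p+q {ℤ.+ 48 ℚ./ 1} (ℚP.<⇒≤ 0<ε)) h₂))
    (small (ℤ.+ 1 ℚ./ 16 ℚ.* (ℤ.+ 1 ℚ./ suc n)) (0<p*q (ℚP.positive⁻¹ (ℤ.+ 1 ℚ./ 16)) (0<1/n n)) and large)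

  module _ {n : ℕ} (5≤n : 5 ℕ.≤ n) (p : ℝ) (params : Eventually (λ m → Parameters (suc n) (seq (1ℝ - p) m))) where

    module At {m} (π : Parameters (suc n) (seq (1ℝ - p) m)) where
      pₘ qₘ : ℚ
      pₘ = seq p m
      qₘ = 1ℚ ℚ.- pₘ
      nq≤⅛ : n/1 (suc n) ℚ.* qₘ ℚ.≤ ℤ.+ 1 ℚ./ 8
      nq≤⅛ = proj₁ (proj₂ (proj₂ π))
      2304≤ : ℤ.+ 2304 ℚ./ 1 ℚ.≤ qₘ ℚ.* qₘ ℚ.* n/1 (suc n ℕ.^ 3)
      2304≤ = proj₂ (proj₂ (proj₂ π))
      0≤pₘ : 0ℚ ℚ.≤ pₘ
      0≤pₘ = subst (0ℚ ℚ.≤_) (solve 1 (λ p → con 1ℚ :- (con 1ℚ :- p) := p) refl pₘ) (proj₁ (proj₂ π))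
      open Model {pₘ} {qₘ} 0≤pₘ (proj₁ π) (solve 1 (λ p → p :+ (con 1ℚ :- p) := con 1ℚ) refl pₘ) public

    good-likely : ½ℝ < ℙ p (good {suc n})
    -- The witness of strictness is the margin 3/4 - 1/2.
    good-likely = ℤ.+ 1 ℚ./ 4 , ℚP.positive⁻¹ (ℤ.+ 1 ℚ./ 4) , eventually (λ m π → let open At π in
      subst (ℤ.+ 3 ℚ./ 4 ℚ.≤_) (sym (seq-ℙ p m {suc n} good)) (Pr-good n 5≤n nq≤⅛ 2304≤)) params

    -- Stated for every decidable event inside `bad`, because `ℙ[_]⟨_⟩>_` measures a property
    -- through such events.
    bad-unlikely : ∀ (A : LabelledGraph (suc n) → Bool) → (∀ G → T (A G) → T (bad G)) → ¬ ½ℝ < ℙ p A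
    bad-unlikely A A⊆bad (ε , 0<ε , large) = ⟨ (λ m (π , h) → let open At π in ½≰¼ (begin
        ½                   ≤⟨ p≤p+q {½} (ℚP.<⇒≤ 0<ε) ⟩
        ½ ℚ.+ ε             ≤⟨ h ⟩
        seq (ℙ p A) m       ≡⟨ seq-ℙ p m A ⟩
        Pr pₘ qₘ A          ≤⟨ Pr-mono {suc n} {A} {bad} A⊆bad ⟩
        Pr pₘ qₘ {suc n} bad ≤⟨ Pr-bad (suc n) nq≤⅛ ⟩
        ℤ.+ 1 ℚ./ 4         ∎)) ⟩-contradiction (params and large)
      where
      open ℚP.≤-Reasoning
      ½≰¼ : ¬ ½ ℚ.≤ ℤ.+ 1 ℚ./ 4
      ½≰¼ h = ℚP.≤⇒≤ᵇ h

    at-most-4 : ∀ k {E : LabelledGraph (suc n) → Set} → (∀ G → E G → HasDiameterSubgraph 2 k G) →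
                ℙ[ p ]⟨ E ⟩> ½ℝ → k ℕ.≤ 4
    at-most-4 k E⊆ (A , A⊆E , likely) = ℕP.≮⇒≥ λ 5≤k →
      bad-unlikely A (λ G h → large⇒bad G 5≤k (E⊆ G (A⊆E G h))) likely

    forget-connected : ∀ {k} (G : LabelledGraph (suc n)) → HasConnectedDiameterSubgraph 2 k G → HasDiameterSubgraph 2 k G
    forget-connected G (W , ∣W∣≡k , diameter , chromatic , _) = W , ∣W∣≡k , diameter , chromatic

    u≡4 : IsU 2 (suc n) p 4
    u≡4 = inj₁ (ℕ.s≤s ℕ.z≤n ,
      (good , (λ G h → forget-connected G (good⇒kite G h)) , good-likely) ,
      λ k _ → at-most-4 k {HasDiameterSubgraph 2 k} (λ G h → h))

    u′≡4 : IsU′ 2 (suc n) p 4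
    u′≡4 = inj₁ (ℕ.s≤s ℕ.z≤n , (good , good⇒kite , good-likely) ,
      λ k _ → at-most-4 k {HasConnectedDiameterSubgraph 2 k} forget-connected)

theorem15 : (p : ℕ → ℝ) →
    (∀ n → 0ℝ ≤ p n × p n ≤ 1ℝ) →
    (λ n → 1ℝ - p n) =o recip →
    (λ n → (1ℝ - p n) * n ^3/2) ⟶∞ →
    Eventually (λ n → IsU 2 n (p n) 4 × IsU′ 2 n (p n) 4)
theorem15 p _ small large =
  let M , small-from = small (fromℚ (ℤ.+ 1 ℚ./ 16)) 0<1/16
      N , large-from = large (fromℚ (ℤ.+ 48 ℚ./ 1))
  -- The summand 6 leaves at least five vertices besides the hub, as the bound on the number of
  -- triples requires.
  in 6 ℕ.+ (M ℕ.+ N) , λ where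
    (suc n) (ℕ.s≤s bound) →
      let M≤ = ℕP.≤-trans (ℕP.m≤m+n M N) (ℕP.≤-trans (ℕP.m≤n+m (M ℕ.+ N) 6) (ℕ.s≤s bound))
          N≤ = ℕP.≤-trans (ℕP.m≤n+m N M) (ℕP.≤-trans (ℕP.m≤n+m (M ℕ.+ N) 6) (ℕ.s≤s bound))
          5≤n = ℕP.≤-trans (ℕP.m≤m+n 5 (M ℕ.+ N)) bound
          params = parameters n (1ℝ - p (suc n)) (small-from (suc n) M≤) (large-from (suc n) N≤)
      in u≡4 5≤n (p (suc n)) params , u′≡4 5≤n (p (suc n)) params
  where
  open Asymptotics
  0<1/16 : 0ℝ < fromℚ (ℤ.+ 1 ℚ./ 16)
  0<1/16 = ℤ.+ 1 ℚ./ 16 , ℚP.positive⁻¹ (ℤ.+ 1 ℚ./ 16) , 0 , λ _ _ → ℚP.≤ᵇ⇒≤ tt
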